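{- Up to isomorphy, the tournaments of the class $\mathcal{T}$ are exactly those of the class $\mathcal{M}=\mathcal{H}\cup \mathcal{I}\cup \mathcal{J} \cup \mathcal{J}^{\star} \cup \mathcal{K} \cup \mathcal{K}^{\star}\cup \mathcal{L}\cup \mathcal{L}^{\star}$. Moreover, for all $T\in\mathcal{M}$, we have $V(T)\setminus W_{5}(T)=\sigma(T)=\{0,1\}$.
   Context: A tournament $T=(V,A)$ is a finite set $V$ with a set $A$ of ordered pairs of distinct vertices such that for all $x\neq y$, exactly one of $(x,y),(y,x)$ is in $A$; write $x\longrightarrow y$ for $(x,y)\in A$. For $X\subseteq V$, $T[X]=(X,A\cap(X\times X))$, and $T-x=T[V\setminus\{x\}]$. The dual of $T$ is $T^{\star}=(V,\{(x,y):(y,x)\in A\})$; for a class $\mathcal{X}$ of tournaments, $\mathcal{X}^{\star}=\{T^{\star}:T\in\mathcal{X}\}$. An interval of $T$ is a subset $I\subseteq V$ such that every $x\in V\setminus I$ satisfies $x\longrightarrow I$ or $I\longrightarrow x$; $\emptyset$, singletons and $V$ are trivial intervals, and $T$ is indecomposable if all its intervals are trivial. Write $\mathbb{N}_{n}=\{0,\dots,n-1\}$. $C_{3}=(\{0,1,2\},\{(0,1),(1,2),(2,0)\})$. For $n\geq 2$, $W_{2n+1}$ is the tournament on $\mathbb{N}_{2n+1}$ such that $W_{2n+1}[\mathbb{N}_{2n}]$ is the usual total order ($i\longrightarrow j$ iff $i<j$) and the out-neighbourhood of $2n$ is $\{2i:i\in\mathbb{N}_{n}\}$. For an indecomposable tournament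 $T$, $W_{5}(T)$ is the set of vertices $v$ such that some $W\subseteq V$ with $v\in W$ has $T[W]\simeq W_{5}$. A vertex $x$ of an indecomposable $T$ is critical if $T-x$ is decomposable; $\sigma(T)$ (the support) is the set of non-critical vertices. $\mathcal{T}$ is the class of indecomposable tournaments $T$ on at least 3 vertices with $|W_{5}(T)|=|V(T)|-2$. For $X\subseteq V$ with $|X|\geq3$ and $T[X]$ indecomposable: $X^{ - }=\{x\in V\setminus X: x\longrightarrow X\}$, $X^{+}=\{x\in V\setminus X: X\longrightarrow x\}$; for $u\in X$, $X(u)=\{x\in V\setminus X:\{u,x\}$ is an interval of $T[X\cup\{x\}]\}$, $X^{ - }(u)=\{x\in X(u):x\longrightarrow u\}$, $X^{+}(u)=\{x\in X(u):u\longrightarrow x\}$. The outside graph $G^{T}_{X}$ has vertex set $V\setminus X$ and edges the pairs $\{x,y\}$ such that $T[X\cup\{x,y\}]$ is indecomposable; $\mathcal{C}(G)$ denotes the set of connected components of a graph $G$. A tournament $T$ is $C_{3}$-critical if $T$ is indecomposable, $\mathbb{N}_{3}\subseteq V(T)$, $T[\mathbb{N}_{3}]=C_{3}$, and $\sigma(T)\subseteq\mathbb{N}_{3}$. $\mathcal{H}$ (resp. $\mathcal{I}$, $\mathcal{J}$, $\mathcal{K}$, $\mathcal{L}$) is the class of $C_{3}$-critical tournaments $T$ such that $\mathcal{C}(G^{T}_{\mathbb{N}_{3}})$ equals, respectively: $\{\mathbb{N}_{3}^{+}(0)\cup \mathbb{N}_{3}^{ - }, \mathbb{N}_{3}^{+}\cup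 \mathbb{N}_{3}^{ - }(1)\}$; $\{\mathbb{N}_{3}^{+}(0)\cup \mathbb{N}_{3}^{+}(2), \mathbb{N}_{3}^{+}(1)\cup \mathbb{N}_{3}^{ - }(0)\}$; $\{\mathbb{N}_{3}^{+}(1)\cup \mathbb{N}_{3}^{ - }, \mathbb{N}_{3}^{ - }(1)\cup \mathbb{N}_{3}^{ - }(0)\}$; $\{\mathbb{N}_{3}^{+}(1)\cup \mathbb{N}_{3}^{ - }, \mathbb{N}_{3}^{+}(0)\cup \mathbb{N}_{3}^{ - }(2)\}$; $\{\mathbb{N}_{3}^{+}(1)\cup \mathbb{N}_{3}^{ - }, \mathbb{N}_{3}^{+}(0)\cup \mathbb{N}_{3}^{ - }(2), \mathbb{N}_{3}^{+} \cup \mathbb{N}_{3}^{ - }(0)\}$ (here $\mathbb{N}_{3}^{\pm}$, $\mathbb{N}_{3}^{\pm}(u)$ are the sets above for $X=\mathbb{N}_{3}$). -}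

module Defs where

open import Data.Nat using (ℕ; zero; suc; _+_; _∸_; _<ᵇ_)
open import Data.Bool using (Bool; true; false; not)
open import Data.Fin using (Fin; zero; suc; toℕ)
open import Data.Fin.Subset using (Subset; _∈_; _∉_; ⁅_⁆; _∪_; ∣_∣; ⊤; ∁)
open import Data.Vec using (tabulate)
open import Data.Product using (Σ; ∃; _×_; _,_)
open import Data.Sum using (_⊎_; inj₁; inj₂; swap)
open import Relation.Nullary using (¬_)
open import Relation.Binary.PropositionalEquality using (_≡_; _≢_)
open import Function.Bundles using (_↔_; Inverse; _⇔_)
open import Function.Definitions using (Injective)
open import Data.Nat using (_≤_)

record Tournament (n : ℕ) : Set where
  field
    arc    : Fin n → Fin n → Bool
    irrefl : ∀ x → arc x x ≡ false
    total  : ∀ x y → x ≢ y → arc x y ≡ true ⊎ arc y x ≡ true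
    asym   : ∀ x y → arc x y ≡ true → arc y x ≡ false

open Tournament public

_∶_⟶_ : ∀ {n} → Tournament n → Fin n → Fin n → Set
T ∶ x ⟶ y = arc T x y ≡ true

dual : ∀ {n} → Tournament n → Tournament n
dual T = record
  { arc    = λ x y → arc T y x
  ; irrefl = λ x → irrefl T x
  ; total  = λ x y ne → swap (total T x y ne)
  ; asym   = λ x y p → asym T y x p
  }

Isomorphic : ∀ {n m} → Tournament n → Tournament m → Set
Isomorphic {n} {m} T T' =
  Σ (Fin n ↔ Fin m) λ f →
    ∀ x y → arc T' (Inverse.to f x) (Inverse.to f y) ≡ arc T x y

IsInterval : ∀ {n} → Tournament n → Subset n → Subset n → Set
IsInterval {n} T X I =
  (∀ x → x ∈ I → x ∈ X) ×
  (∀ x → x ∈ X → x ∉ I →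
     (∀ y → y ∈ I → T ∶ x ⟶ y) ⊎ (∀ y → y ∈ I → T ∶ y ⟶ x))

Trivial : ∀ {n} → Subset n → Subset n → Set
Trivial X I = ∣ I ∣ ≤ 1 ⊎ I ≡ X

Indec : ∀ {n} → Tournament n → Subset n → Set
Indec {n} T X = ∀ (I : Subset n) → IsInterval T X I → Trivial X I

Indecomposable : ∀ {n} → Tournament n → Set
Indecomposable T = Indec T ⊤

NonCritical : ∀ {n} → Tournament n → Fin n → Set
NonCritical T x = Indec T (∁ ⁅ x ⁆)

arcW5 : Fin 5 → Fin 5 → Bool
arcW5 i j with toℕ i | toℕ j
... | 4 | 0 = true
... | 4 | 2 = true
... | 4 | _ = false
... | 0 | 4 = false
... | 2 | 4 = false
... | _ | 4 = true
... | a | b = a <ᵇ b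

-- v ∈ W5(T): some W ∋ v with T[W] ≃ W5 (an arc-preserving injection of W5 whose image contains v)
InW5 : ∀ {n} → Tournament n → Fin n → Set
InW5 {n} T v =
  Σ (Fin 5 → Fin n) λ f →
    Injective _≡_ _≡_ f ×
    (∀ i j → arc T (f i) (f j) ≡ arcW5 i j) ×
    ∃ λ i → f i ≡ v

InClassT : ∀ {n} → Tournament n → Set
InClassT {n} T =
  Indecomposable T × 3 ≤ n ×
  Σ (Subset n) λ S → (∀ v → (v ∈ S) ⇔ InW5 T v) × ∣ S ∣ ≡ n ∸ 2

Minus : ∀ {n} → Tournament n → Subset n → Fin n → Set
Minus T X x = x ∉ X × (∀ y → y ∈ X → T ∶ x ⟶ y)

Plus : ∀ {n} → Tournament n → Subset n → Fin n → Set
Plus T X x = x ∉ X × (∀ y → y ∈ X → T ∶ y ⟶ x)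

-- x ∈ X(u): {u,x} is an interval of T[X ∪ {x}]
AtU : ∀ {n} → Tournament n → Subset n → Fin n → Fin n → Set
AtU T X u x = x ∉ X ×
  (∀ y → y ∈ X → y ≢ u →
     (T ∶ y ⟶ u × T ∶ y ⟶ x) ⊎ (T ∶ u ⟶ y × T ∶ x ⟶ y))

MinusU : ∀ {n} → Tournament n → Subset n → Fin n → Fin n → Set
MinusU T X u x = AtU T X u x × T ∶ x ⟶ u

PlusU : ∀ {n} → Tournament n → Subset n → Fin n → Fin n → Set
PlusU T X u x = AtU T X u x × T ∶ u ⟶ x

OEdge : ∀ {n} → Tournament n → Subset n → Fin n → Fin n → Set
OEdge T X x y = x ∉ X × y ∉ X × x ≢ y × Indec T ((X ∪ ⁅ x ⁆) ∪ ⁅ y ⁆)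

data Reach {n} (T : Tournament n) (X : Subset n) : Fin n → Fin n → Set where
  here : ∀ {x} → Reach T X x x
  step : ∀ {x y z} → OEdge T X x y → Reach T X y z → Reach T X x z

IsComponent : ∀ {n} → Tournament n → Subset n → Subset n → Set
IsComponent T X C =
  (∀ x → x ∈ C → x ∉ X) ×
  (∃ λ x → x ∈ C) ×
  (∀ x y → x ∈ C → (y ∈ C ⇔ Reach T X x y))

SameAs : ∀ {n} → Subset n → (Fin n → Set) → Set
SameAs C P = ∀ x → (x ∈ C) ⇔ P x

Comps2 : ∀ {n} → Tournament n → Subset n → (P Q : Fin n → Set) → Set
Comps2 T X P Q =
  (∃ λ C → IsComponent T X C × SameAs C P) ×
  (∃ λ C → IsComponent T X C × SameAs C Q) ×
  (∀ C → IsComponent T X C → SameAs C P ⊎ SameAs C Q)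

Comps3 : ∀ {n} → Tournament n → Subset n → (P Q R : Fin n → Set) → Set
Comps3 T X P Q R =
  (∃ λ C → IsComponent T X C × SameAs C P) ×
  (∃ λ C → IsComponent T X C × SameAs C Q) ×
  (∃ λ C → IsComponent T X C × SameAs C R) ×
  (∀ C → IsComponent T X C → SameAs C P ⊎ SameAs C Q ⊎ SameAs C R)

_∪ᵖ_ : ∀ {n} → (Fin n → Set) → (Fin n → Set) → (Fin n → Set)
(P ∪ᵖ Q) x = P x ⊎ Q x

N3 : ∀ {n} → Subset n
N3 = tabulate (λ x → toℕ x <ᵇ 3)

v0 v1 v2 : ∀ {k} → Fin (3 + k)
v0 = zero
v1 = suc zero
v2 = suc (suc zero)

emb3 : ∀ {k} → Fin 3 → Fin (3 + k)
emb3 zero = v0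
emb3 (suc zero) = v1
emb3 (suc (suc zero)) = v2

arcC3 : Fin 3 → Fin 3 → Bool
arcC3 zero (suc zero) = true
arcC3 (suc zero) (suc (suc zero)) = true
arcC3 (suc (suc zero)) zero = true
arcC3 _ _ = false

C3Critical : ∀ {k} → Tournament (3 + k) → Set
C3Critical T =
  Indecomposable T ×
  (∀ i j → arc T (emb3 i) (emb3 j) ≡ arcC3 i j) ×
  (∀ x → NonCritical T x → x ∈ N3)

module _ {k : ℕ} (T : Tournament (3 + k)) where
  private
    m  = Minus T N3
    p  = Plus T N3
    m' = λ (u : Fin (3 + k)) → MinusU T N3 u
    p' = λ (u : Fin (3 + k)) → PlusU T N3 u

  InH InI InJ InK InL : Set
  InH = C3Critical T × Comps2 T N3 (p' v0 ∪ᵖ m) (p ∪ᵖ m' v1)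
  InI = C3Critical T × Comps2 T N3 (p' v0 ∪ᵖ p' v2) (p' v1 ∪ᵖ m' v0)
  InJ = C3Critical T × Comps2 T N3 (p' v1 ∪ᵖ m) (m' v1 ∪ᵖ m' v0)
  InK = C3Critical T × Comps2 T N3 (p' v1 ∪ᵖ m) (p' v0 ∪ᵖ m' v2)
  InL = C3Critical T × Comps3 T N3 (p' v1 ∪ᵖ m) (p' v0 ∪ᵖ m' v2) (p ∪ᵖ m' v0)

InDual : ∀ {k} → (Tournament (3 + k) → Set) → Tournament (3 + k) → Set
InDual {k} X T = Σ (Tournament (3 + k)) λ T' → X T' × (∀ x y → arc T x y ≡ arc (dual T') x y)

InM : ∀ {k} → Tournament (3 + k) → Set
InM T = InH T ⊎ InI T ⊎ InJ T ⊎ InDual InJ T ⊎ InK T ⊎ InDual InK T ⊎ InL T ⊎ InDual InL T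

{-# OPTIONS --safe #-}
-- Let a → b be the two vertices of T outside W5(T).  If a → b lies on no 3-cycle, the other vertices split into
-- P → {a , b}, a → Q → b and {a , b} → R, and the forbidden copies of W5 through a or b force a nontrivial
-- interval.  Otherwise put X = {a , b , c} for a 3-cycle a → b → c → a.  An indecomposable superset of X with six
-- vertices would put a or b into a W5, or else T into the Paley tournament P7, so there is none.  By the absence of
-- such supersets a vertex outside X has neighbours of one type only in the outside graph, and neighbourhoods of
-- vertices of one type are nested; indecomposability makes them nonempty and distinct.  Hence the components are
-- half graphs between two types, every vertex outside X is critical, and T is governed by a matching on the eight
-- types.  A copy of W5 through c shows two edges of that matching, which leaves nine cases; taking c to be the source
-- of the vertices closing a 3-cycle with a → b (for T or for its dual) leaves the classes of the theorem.
-- Conversely, indecomposable sets can be enlarged by two vertices at a time, so by parity a C3-critical tournament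
-- has no indecomposable superset of N3 with six vertices and the same structure results.  Two edges of different
-- components form a W5 with the vertex 2; adding 0 or 1 to it and enlarging ends at T − 1 or T − 0.
module Submission where

open import Defs
open import Data.Bool using (Bool; true; false; not; _∧_; _∨_; if_then_else_)
open import Data.Bool.Properties using (not-involutive; ¬-not; ∧-zeroʳ) renaming (_≟_ to _≟ᴮ_)
open import Data.Empty using (⊥; ⊥-elim)
open import Data.Fin using (Fin; zero; suc; toℕ)
open import Data.Fin.Properties using (_≟_; all?; any?; suc-injective)
open import Data.Fin.Permutation using (transpose; _∘ₚ_)
open import Data.Fin.Subset using (Subset; _∈_; _∉_; ⁅_⁆; _∪_; ∣_∣; ⊤; ∁)
open import Data.Fin.Subset.Properties using (anySubset?; ∣⊤∣≡n; ∣∁p∣≡n∸∣p∣)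
open import Data.List as List using (List; []; _∷_)
open import Data.Nat using (ℕ; zero; suc; _+_; _∸_; _≤_; _<_; _<ᵇ_; _≤ᵇ_; _≤?_; z≤n; s≤s)
open import Data.Nat.Properties using (≤-refl; ≤-trans; +-suc; m≤n⇒m≤1+n; n<1+n; <-irrefl; ≤-pred; ≮⇒≥; m≤n+m; m≤m+n; n≤1+n; ≤-reflexive; m∸[m∸n]≡n) renaming (suc-injective to ℕ-suc-injective)
open import Data.Product using (Σ; ∃; ∃₂; _×_; _,_; proj₁; proj₂)
open import Data.Sum using (_⊎_; inj₁; inj₂; [_,_]′)
open import Data.Unit using (tt) renaming (⊤ to ⊤₀)
open import Data.Vec using (Vec; []; _∷_; lookup; tabulate; map; _++_)
open import Data.Vec.Properties using (lookup∘tabulate; lookup⇒[]=; []=⇒lookup; tabulate-cong; tabulate∘lookup; lookup-map; lookup-replicate; lookup-zipWith)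
open import Data.Fin.Patterns using (0F; 1F; 2F; 3F; 4F; 5F; 6F; 7F)
open import Data.Vec.Relation.Unary.All using (All; []; _∷_)
open import Data.Vec.Relation.Unary.All.Properties using (lookup⁺)
open import Data.Vec.Relation.Unary.AllPairs using (AllPairs; []; _∷_)
open import Function using (_∘_; id; case_of_)
open import Function.Bundles using (_⇔_; mk⇔; Equivalence; _↔_; Inverse)
open import Relation.Binary.PropositionalEquality using (_≡_; _≢_; refl; sym; trans; cong; cong₂; subst; ≢-sym)
open import Relation.Nullary using (¬_; Dec; yes; no; does)
open import Relation.Nullary.Decidable using (_×-dec_; _⊎-dec_; _→-dec_; ¬?; dec-true; dec-false)

-- The obstacle is that T is arbitrarily large, while hypotheses and conclusions speak of small
-- sets. The bridge is the pair of rules in `Local`: each concerns three vertices outside X, hence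
-- six-vertex tournaments, and is settled by evaluation over all types. The unbounded structure then
-- follows from the two rules by exhibiting intervals. Both implications pass through `Local`;
-- avoiding W5 yields it in one direction, parity in the other. The exclusion of six-vertex
-- supersets cannot be purely local, because P7 minus a vertex contains no W5 at all. There the
-- global hypotheses enter, through `stuck`: T is indecomposable and c lies in a copy of W5. The
-- matching depends on c and not only on a and b, and the one found at a given c need not be listed
-- (`famF` is not); hence the extremal choice of c and the return to the dual. The finite checks cut
-- most branches early, and the tests inside them are opaque so that later type checking does not
-- unfold them.

-- Booleans and arcs of a tournament

true≢false : {A : Set} {b : Bool} → b ≡ true → b ≡ false → A
true≢false refl ()

does⁺ : {P : Set} (d : Dec P) → P → does d ≡ true
does⁺ = dec-true

does⁻ : {P : Set} (d : Dec P) → does d ≡ true → P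
does⁻ (yes p) _ = p

undoes⁻ : {P : Set} (d : Dec P) → does d ≡ false → ¬ P
undoes⁻ (no ¬p) _ = ¬p

∧⁻ : ∀ {a b} → a ∧ b ≡ true → a ≡ true × b ≡ true
∧⁻ {true} p = refl , p

∧⁺ : ∀ {a b} → a ≡ true → b ≡ true → a ∧ b ≡ true
∧⁺ refl p = p

∨⁻ : ∀ {a b} → a ∨ b ≡ true → a ≡ true ⊎ b ≡ true
∨⁻ {true}  _ = inj₁ refl
∨⁻ {false} p = inj₂ p

∨⁺ˡ : ∀ {a b} → a ≡ true → a ∨ b ≡ true
∨⁺ˡ refl = refl

∨⁺ʳ : ∀ {a b} → b ≡ true → a ∨ b ≡ true
∨⁺ʳ {true}  _ = refl
∨⁺ʳ {false} p = p

∨-false⁻ : ∀ {a b} → a ∨ b ≡ false → a ≡ false × b ≡ false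
∨-false⁻ {false} p = refl , p

not⁺ : ∀ {a} → a ≡ false → not a ≡ true
not⁺ refl = refl

not-true⁻ : ∀ {a} → not a ≡ true → a ≡ false
not-true⁻ {false} _ = refl

∨-false⁺ : ∀ {a b} → a ≡ false → b ≡ false → a ∨ b ≡ false
∨-false⁺ refl p = p

refute : ∀ {a} → (a ≡ true → ⊥) → a ≡ false
refute {true} h = ⊥-elim (h refl)
refute {false} h = refl

bool-case : (b : Bool) → b ≡ true ⊎ b ≡ false
bool-case true  = inj₁ refl
bool-case false = inj₂ refl

not-swap : ∀ {a b} → a ≡ not b → b ≡ not a
not-swap {b = b} p = trans (sym (not-involutive b)) (cong not (sym p))

not-cong⁻ : ∀ {a b} → not a ≡ not b → a ≡ b
not-cong⁻ {true}  {true}  _ = refl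
not-cong⁻ {false} {false} _ = refl

module _ {n : ℕ} (T : Tournament n) where

  flip-arc : ∀ {x y} → x ≢ y → arc T y x ≡ not (arc T x y)
  flip-arc {x} {y} x≢y with arc T x y in eq
  ... | true = asym T x y eq
  ... | false with total T x y x≢y
  ...   | inj₁ p = true≢false p eq
  ...   | inj₂ p = p

  arc⇒≢ : ∀ {x y} → arc T x y ≡ true → x ≢ y
  arc⇒≢ {x} p refl = true≢false p (irrefl T x)

  flip-cong : ∀ {x y z w} → x ≢ y → z ≢ w → arc T x y ≡ arc T z w → arc T y x ≡ arc T w z
  flip-cong x≢y z≢w p = trans (flip-arc x≢y) (trans (cong not p) (sym (flip-arc z≢w)))

-- Intervals and indecomposability of vertex sets

-- Sets of vertices are Boolean functions; Prime T u says that T[u] is indecomposable.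

VSet : ℕ → Set
VSet n = Fin n → Bool

infix 4 _⊆ᵛ_
_⊆ᵛ_ : ∀ {n} → VSet n → VSet n → Set
f ⊆ᵛ u = ∀ x → f x ≡ true → u x ≡ true

-- Equality of outgoing arcs covers both alternatives of `IsInterval`, since `flip-arc` determines
-- the reverse arcs.
Module : ∀ {n} → Tournament n → VSet n → VSet n → Set
Module T u f = f ⊆ᵛ u ×
  (∀ x y z → u x ≡ true → f x ≡ false → f y ≡ true → f z ≡ true → arc T x y ≡ arc T x z)

Prime : ∀ {n} → Tournament n → VSet n → Set
Prime T u = ∀ f → Module T u f → ∀ x y → x ≢ y → f x ≡ true → f y ≡ true → u ⊆ᵛ f

-- The failure of `Prime` in positive form: the arguments below take the interval apart, so it comes
-- with two members and a missed vertex. `prime-dec` finds one by searching all subsets.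
NonPrime : ∀ {n} → Tournament n → VSet n → Set
NonPrime T u = ∃ λ f → Module T u f × (∃₂ λ x y → x ≢ y × f x ≡ true × f y ≡ true) ×
  (∃ λ z → u z ≡ true × f z ≡ false)

allᵛ : ∀ {n} → VSet n
allᵛ _ = true

_==_ : ∀ {n} → Fin n → Fin n → Bool
x == y = does (x ≟ y)

==-refl : ∀ {n} (x : Fin n) → (x == x) ≡ true
==-refl x = does⁺ (x ≟ x) refl

==⁻ : ∀ {n} (x y : Fin n) → (x == y) ≡ true → x ≡ y
==⁻ x y = does⁻ (x ≟ y)

≢⇒==false : ∀ {n} {x y : Fin n} → x ≢ y → (x == y) ≡ false
≢⇒==false {x = x} {y} = dec-false (x ≟ y)

infixl 6 _⊕_
_⊕_ : ∀ {n} → VSet n → Fin n → VSet n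
(u ⊕ x) v = u v ∨ (v == x)

⊕-old : ∀ {n} {u : VSet n} {x v} → u v ≡ true → (u ⊕ x) v ≡ true
⊕-old = ∨⁺ˡ

⊕-new : ∀ {n} (u : VSet n) x → (u ⊕ x) x ≡ true
⊕-new u x = ∨⁺ʳ {u x} (==-refl x)

⊕⁻ : ∀ {n} (u : VSet n) {x v} → (u ⊕ x) v ≡ true → u v ≡ true ⊎ v ≡ x
⊕⁻ u {x} {v} p with ∨⁻ {u v} p
... | inj₁ q = inj₁ q
... | inj₂ q = inj₂ (==⁻ v x q)

⊕-false : ∀ {n} {u : VSet n} {x v} → u v ≡ false → v ≢ x → (u ⊕ x) v ≡ false
⊕-false p q rewrite p = ≢⇒==false q

Prime-cong : ∀ {n} {T : Tournament n} {u w : VSet n} → u ⊆ᵛ w → w ⊆ᵛ u → Prime T u → Prime T w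
Prime-cong uw wu pr f (f⊆ , unif) x y x≢y fx fy z wz =
  pr f ((λ v q → wu v (f⊆ v q)) , λ a b c ua → unif a b c (uw a ua)) x y x≢y fx fy z (wu z wz)

prime-dec : ∀ {n} (T : Tournament n) u → Prime T u ⊎ NonPrime T u
prime-dec {n} T u with anySubset? bad?
  where
  Bad : Subset n → Set
  Bad I = Module T u (lookup I) × (∃₂ λ x y → x ≢ y × lookup I x ≡ true × lookup I y ≡ true) ×
    (∃ λ z → u z ≡ true × lookup I z ≡ false)
  bad? : ∀ I → Dec (Bad I)
  bad? I =
    (all? (λ x → (lookup I x ≟ᴮ true) →-dec (u x ≟ᴮ true)) ×-dec
     all? (λ x → all? λ y → all? λ z → (u x ≟ᴮ true) →-dec ((lookup I x ≟ᴮ false) →-dec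
       ((lookup I y ≟ᴮ true) →-dec ((lookup I z ≟ᴮ true) →-dec (arc T x y ≟ᴮ arc T x z))))))
    ×-dec any? (λ x → any? λ y → ¬? (x ≟ y) ×-dec ((lookup I x ≟ᴮ true) ×-dec (lookup I y ≟ᴮ true)))
    ×-dec any? (λ z → (u z ≟ᴮ true) ×-dec (lookup I z ≟ᴮ false))
... | yes (I , bad) = inj₂ (lookup I , bad)
... | no none = inj₁ λ f (f⊆ , unif) x y x≢y fx fy z uz →
  [ id , (λ fz → ⊥-elim (none (tabulate f ,
    ( (λ v q → f⊆ v (trans (sym (lookup∘tabulate f v)) q))
    , (λ a b c ua fa fb fc → unif a b c ua (un f a fa) (un f b fb) (un f c fc)))
    , (x , y , x≢y , tab f x fx , tab f y fy) , (z , uz , tab f z fz)))) ]′ (bool-case (f z))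
  where
  tab : ∀ (f : VSet n) v {b} → f v ≡ b → lookup (tabulate f) v ≡ b
  tab f v q = trans (lookup∘tabulate f v) q
  un : ∀ (f : VSet n) v {b} → lookup (tabulate f) v ≡ b → f v ≡ b
  un f v q = trans (sym (lookup∘tabulate f v)) q

Prime⇒¬NonPrime : ∀ {n} {T : Tournament n} {u} → Prime T u → ¬ NonPrime T u
Prime⇒¬NonPrime pr (f , md , (x , y , x≢y , fx , fy) , (z , uz , fz)) =
  true≢false (pr f md x y x≢y fx fy z uz) fz

prime? : ∀ {n} (T : Tournament n) u → Dec (Prime T u)
prime? T u with prime-dec T u
... | inj₁ p = yes p
... | inj₂ np = no λ p → Prime⇒¬NonPrime {T = T} {u} p np

-- Agreement with the definitions by subsets

∈⇒lookup : ∀ {n} {S : Subset n} {x} → x ∈ S → lookup S x ≡ true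
∈⇒lookup = []=⇒lookup

lookup⇒∈ : ∀ {n} {S : Subset n} {x} → lookup S x ≡ true → x ∈ S
lookup⇒∈ {S = S} {x} = lookup⇒[]= x S

lookup-false⇒∉ : ∀ {n} {S : Subset n} {x} → lookup S x ≡ false → x ∉ S
lookup-false⇒∉ p q = true≢false (∈⇒lookup q) p

∉⇒lookup-false : ∀ {n} {S : Subset n} {x} → x ∉ S → lookup S x ≡ false
∉⇒lookup-false {S = S} {x} p with bool-case (lookup S x)
... | inj₁ q = ⊥-elim (p (lookup⇒∈ q))
... | inj₂ q = q

nonempty-card : ∀ {n} {S : Subset n} {x} → lookup S x ≡ true → 1 ≤ ∣ S ∣
nonempty-card {S = true ∷ S} {zero} _ = s≤s z≤n
nonempty-card {S = true ∷ S} {suc x} p = s≤s z≤n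
nonempty-card {S = false ∷ S} {suc x} p = nonempty-card {S = S} {x} p

card≤1⇒unique : ∀ {n} {S : Subset n} → ∣ S ∣ ≤ 1 → ∀ {x y} → lookup S x ≡ true → lookup S y ≡ true → x ≡ y
card≤1⇒unique {S = b ∷ S} le {zero} {zero} p q = refl
card≤1⇒unique {S = true ∷ S} (s≤s le) {zero} {suc y} p q with () ← ≤-trans (nonempty-card {S = S} q) le
card≤1⇒unique {S = true ∷ S} (s≤s le) {suc x} {_} p q with () ← ≤-trans (nonempty-card {S = S} p) le
card≤1⇒unique {S = false ∷ S} le {suc x} {suc y} p q = cong suc (card≤1⇒unique {S = S} le p q)

card-view : ∀ {n} (S : Subset n) →
  ∣ S ∣ ≡ 0 ⊎ ∣ S ∣ ≡ 1 ⊎ (∃₂ λ x y → x ≢ y × lookup S x ≡ true × lookup S y ≡ true)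
card-view [] = inj₁ refl
card-view (false ∷ S) with card-view S
... | inj₁ p = inj₁ p
... | inj₂ (inj₁ p) = inj₂ (inj₁ p)
... | inj₂ (inj₂ (x , y , x≢y , p , q)) =
  inj₂ (inj₂ (suc x , suc y , (λ e → x≢y (suc-injective e)) , p , q))
card-view (true ∷ S) with any? (λ x → lookup S x ≟ᴮ true)
... | yes (x , p) = inj₂ (inj₂ (zero , suc x , (λ ()) , refl , p))
... | no none with card-view S
...   | inj₁ p = inj₂ (inj₁ (cong suc p))
...   | inj₂ (inj₁ p) = inj₂ (inj₁ (cong suc (⊥-elim (zero≢ S p none))))
  where
  zero≢ : ∀ {m} (S : Subset m) → ∣ S ∣ ≡ 1 → ¬ (∃ λ x → lookup S x ≡ true) → ⊥
  zero≢ (true ∷ S) _ no' = no' (zero , refl)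
  zero≢ (false ∷ S) e no' = zero≢ S e λ (x , p) → no' (suc x , p)
...   | inj₂ (inj₂ (x , _ , _ , p , _)) = ⊥-elim (none (x , p))

Indec⇒Prime : ∀ {n} {T : Tournament n} {U : Subset n} {u : VSet n} →
  (∀ x → lookup U x ≡ u x) → Indec T U → Prime T u
Indec⇒Prime {n} {T} {U} {u} U≗u ind f (f⊆ , unif) x y x≢y fx fy z uz
  with ind (tabulate f) (sub , int)
  where
  fᵗ : ∀ {v} → v ∈ tabulate f → f v ≡ true
  fᵗ {v} p = trans (sym (lookup∘tabulate f v)) (∈⇒lookup p)
  fᶠ : ∀ {v} → v ∉ tabulate f → f v ≡ false
  fᶠ {v} p = trans (sym (lookup∘tabulate f v)) (∉⇒lookup-false p)
  sub : ∀ v → v ∈ tabulate f → v ∈ U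
  sub v p = lookup⇒∈ (trans (U≗u v) (f⊆ v (fᵗ p)))
  int : ∀ v → v ∈ U → v ∉ tabulate f →
    (∀ w → w ∈ tabulate f → T ∶ v ⟶ w) ⊎ (∀ w → w ∈ tabulate f → T ∶ w ⟶ v)
  int v vU vf with bool-case (arc T v x)
  ... | inj₁ p = inj₁ λ w wf → trans (unif v w x (trans (sym (U≗u v)) (∈⇒lookup vU)) (fᶠ vf) (fᵗ wf) fx) p
  ... | inj₂ p = inj₂ λ w wf → trans (flip-arc T (λ e → vf (subst (_∈ _) (sym e) wf)))
    (cong not (trans (unif v w x (trans (sym (U≗u v)) (∈⇒lookup vU)) (fᶠ vf) (fᵗ wf) fx) p))
... | inj₁ le = ⊥-elim (x≢y (card≤1⇒unique {S = tabulate f} le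
    (trans (lookup∘tabulate f x) fx) (trans (lookup∘tabulate f y) fy)))
... | inj₂ refl = trans (sym (lookup∘tabulate f z)) (trans (U≗u z) uz)

Prime⇒Indec : ∀ {n} {T : Tournament n} {U : Subset n} {u : VSet n} →
  (∀ x → lookup U x ≡ u x) → Prime T u → Indec T U
Prime⇒Indec {n} {T} {U} {u} U≗u pr I (sub , int) with card-view I
... | inj₁ p = inj₁ (subst (_≤ 1) (sym p) z≤n)
... | inj₂ (inj₁ p) = inj₁ (subst (_≤ 1) (sym p) ≤-refl)
... | inj₂ (inj₂ (x , y , x≢y , p , q)) = inj₂ (ext (λ v → eq v))
  where
  ext : ∀ {m} {A B : Subset m} → (∀ v → lookup A v ≡ lookup B v) → A ≡ B
  ext {A = A} {B} h = trans (sym (tabulate∘lookup A)) (trans (tabulate-cong h) (tabulate∘lookup B))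
  full : u ⊆ᵛ lookup I
  full = pr (lookup I)
    ( (λ v r → trans (sym (U≗u v)) (∈⇒lookup (sub v (lookup⇒∈ r))))
    , unif) x y x≢y p q
    where
    unif : ∀ a b c → u a ≡ true → lookup I a ≡ false → lookup I b ≡ true → lookup I c ≡ true → arc T a b ≡ arc T a c
    unif a b c ua fa fb fc with int a (lookup⇒∈ (trans (U≗u a) ua)) (lookup-false⇒∉ fa)
    ... | inj₁ h = trans (h b (lookup⇒∈ fb)) (sym (h c (lookup⇒∈ fc)))
    ... | inj₂ h = trans (asym T b a (h b (lookup⇒∈ fb))) (sym (asym T c a (h c (lookup⇒∈ fc))))
  eq : ∀ v → lookup I v ≡ lookup U v
  eq v with bool-case (lookup I v)
  ... | inj₁ r = trans r (sym (∈⇒lookup (sub v (lookup⇒∈ r))))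
  ... | inj₂ r with bool-case (lookup U v)
  ...   | inj₁ s = true≢false (full v (trans (sym (U≗u v)) s)) r
  ...   | inj₂ s = trans r (sym s)

-- Counting and extremal choices

count : ∀ {n} → VSet n → ℕ
count {zero} f = 0
count {suc n} f = (if f zero then 1 else 0) + count (f ∘ suc)

count-cong : ∀ {n} {f g : VSet n} → (∀ x → f x ≡ g x) → count f ≡ count g
count-cong {zero} h = refl
count-cong {suc n} h rewrite h zero = cong (_ +_) (count-cong (h ∘ suc))

count-mono : ∀ {n} {f g : VSet n} → f ⊆ᵛ g → count f ≤ count g
count-mono {zero} h = z≤n
count-mono {suc n} {f} {g} h with f zero in p | g zero in q
... | false | false = count-mono (h ∘ suc)
... | false | true = m≤n⇒m≤1+n (count-mono (h ∘ suc))
... | true | true = s≤s (count-mono (h ∘ suc))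
... | true | false = true≢false (h zero p) q

count-strict : ∀ {n} {f g : VSet n} → f ⊆ᵛ g → ∀ x → f x ≡ false → g x ≡ true → count f < count g
count-strict {suc n} {f} {g} h zero p q rewrite p | q = s≤s (count-mono (h ∘ suc))
count-strict {suc n} {f} {g} h (suc x) p q with f zero in p₀ | g zero in q₀
... | false | false = count-strict (h ∘ suc) x p q
... | false | true = m≤n⇒m≤1+n (count-strict (h ∘ suc) x p q)
... | true | true = s≤s (count-strict (h ∘ suc) x p q)
... | true | false = true≢false (h zero p₀) q₀

==-suc : ∀ {n} (v x : Fin n) → (suc v == suc x) ≡ (v == x)
==-suc v x with v ≟ x
... | yes _ = refl
... | no _ = refl

count-⊕ : ∀ {n} {u : VSet n} {x} → u x ≡ false → count (u ⊕ x) ≡ suc (count u)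
count-⊕ {suc n} {u} {zero} p rewrite p = cong suc (count-cong λ v → ∨f (u (suc v)))
  where
  ∨f : ∀ b → b ∨ false ≡ b
  ∨f true = refl
  ∨f false = refl
count-⊕ {suc n} {u} {suc x} p with u zero
... | true = cong suc (trans (count-cong λ v → cong (u (suc v) ∨_) (==-suc v x)) (count-⊕ {u = u ∘ suc} p))
... | false = trans (count-cong λ v → cong (u (suc v) ∨_) (==-suc v x)) (count-⊕ {u = u ∘ suc} p)

count-all : ∀ {n} {u : VSet n} → (∀ v → u v ≡ true) → count u ≡ n
count-all {zero} h = refl
count-all {suc n} h rewrite h zero = cong suc (count-all (h ∘ suc))

count≤ : ∀ {n} (u : VSet n) → count u ≤ n
count≤ {zero} u = z≤n
count≤ {suc n} u with u zero
... | true = s≤s (count≤ (u ∘ suc))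
... | false = m≤n⇒m≤1+n (count≤ (u ∘ suc))

argmin : ∀ {n} (P : VSet n) (f : Fin n → ℕ) → (∃ λ x → P x ≡ true) →
  ∃ λ x → P x ≡ true × (∀ y → P y ≡ true → f x ≤ f y)
argmin {n} P f (x , px) = go (f x) x px ≤-refl
  where
  go : ∀ k x → P x ≡ true → f x ≤ k → ∃ λ x → P x ≡ true × (∀ y → P y ≡ true → f x ≤ f y)
  go k x px le with any? (λ y → (P y ≟ᴮ true) ×-dec (suc (f y) ≤? f x))
  ... | no none = x , px , λ y py → ≮⇒≥ λ lt → none (y , py , lt)
  go zero x px le | yes (y , py , lt) with () ← ≤-trans lt le
  go (suc k) x px le | yes (y , py , lt) = go k y py (≤-pred (≤-trans lt le))

-- Enlarging indecomposable sets by two vertices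

-- The Ehrenfeucht–Rozenberg partition of the vertices outside an indecomposable set u:
-- extensions, twins of a vertex of u, and vertices that do not separate u.

module Upward {n : ℕ} (T : Tournament n) (u : VSet n) (pr : Prime T u)
  (a b c : Fin n) (ua : u a ≡ true) (ub : u b ≡ true) (uc : u c ≡ true)
  (a≢b : a ≢ b) (a≢c : a ≢ c) (b≢c : b ≢ c) where

  Twin : Fin n → Fin n → Set
  Twin s x = u s ≡ true × (∀ v → u v ≡ true → v ≢ s → arc T v s ≡ arc T v x)

  Out : Fin n → Set
  Out x = ∀ v w → u v ≡ true → u w ≡ true → arc T x v ≡ arc T x w

  twin? : ∀ s x → Dec (Twin s x)
  twin? s x = (u s ≟ᴮ true) ×-dec all? λ v → (u v ≟ᴮ true) →-dec (¬? (v ≟ s) →-dec (arc T v s ≟ᴮ arc T v x))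

  out? : ∀ x → Dec (Out x)
  out? x = all? λ v → all? λ w → (u v ≟ᴮ true) →-dec ((u w ≟ᴮ true) →-dec (arc T x v ≟ᴮ arc T x w))

  third : ∀ s t → ∃ λ r → u r ≡ true × r ≢ s × r ≢ t
  third s t with a ≟ s | a ≟ t | b ≟ s | b ≟ t
  ... | no p | no q | _ | _ = a , ua , p , q
  ... | _ | _ | no p | no q = b , ub , p , q
  ... | yes refl | _ | yes refl | _ = ⊥-elim (a≢b refl)
  ... | _ | yes refl | _ | yes refl = ⊥-elim (a≢b refl)
  ... | yes refl | _ | no p | yes refl = c , uc , (λ e → a≢c (sym e)) , (λ e → b≢c (sym e))
  ... | no p | yes refl | yes refl | _ = c , uc , (λ e → b≢c (sym e)) , (λ e → a≢c (sym e))

  ∉⇒≢ : ∀ {x v} → u x ≡ false → u v ≡ true → v ≢ x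
  ∉⇒≢ p q refl = true≢false q p

  -- Every other vertex of `u` treats `s` and `t` as it treats `x`, so two different such vertices
  -- would form an interval of T[u]; `third` supplies a vertex that it misses.
  twin-unique : ∀ {s t x} → Twin s x → Twin t x → s ≡ t
  twin-unique {s} {t} {x} (us , p) (ut , q) with s ≟ t
  ... | yes e = e
  ... | no s≢t with third s t
  ...   | r , ur , r≢s , r≢t = true≢false
    (pr f (sub , unif) s t s≢t (∨⁺ˡ (==-refl s)) (∨⁺ʳ {t == s} (==-refl t)) r ur) (∨-false⁺ (≢⇒==false r≢s) (≢⇒==false r≢t))
    where
    f : VSet n
    f v = (v == s) ∨ (v == t)
    sub : f ⊆ᵛ u
    sub v e with ∨⁻ {v == s} e
    ... | inj₁ e' = subst (λ z → u z ≡ true) (sym (==⁻ v s e')) us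
    ... | inj₂ e' = subst (λ z → u z ≡ true) (sym (==⁻ v t e')) ut
    val : ∀ v w → u v ≡ true → f v ≡ false → f w ≡ true → arc T v w ≡ arc T v x
    val v w uv fv fw with ∨-false⁻ {v == s} fv | ∨⁻ {w == s} fw
    ... | v≢s , v≢t | inj₁ e with refl ← ==⁻ w s e = p v uv (undoes⁻ (v ≟ s) v≢s)
    ... | v≢s , v≢t | inj₂ e with refl ← ==⁻ w t e = q v uv (undoes⁻ (v ≟ t) v≢t)
    unif : ∀ v w w' → u v ≡ true → f v ≡ false → f w ≡ true → f w' ≡ true → arc T v w ≡ arc T v w'
    unif v w w' uv fv fw fw' = trans (val v w uv fv fw) (sym (val v w' uv fv fw'))

  -- A twin of `s` that sees all of `u` alike makes `s` see the rest of `u` alike. That rest is then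
  -- an interval with at least two vertices that misses `s`.
  twin-not-out : ∀ {s x} → u x ≡ false → Twin s x → Out x → ⊥
  twin-not-out {s} {x} ux (us , p) o with third s s
  ... | r , ur , r≢s , _ with third s r
  ...   | r' , ur' , r'≢s , r'≢r = true≢false
    (pr f (sub , unif) r r' (λ e → r'≢r (sym e)) (mem ur r≢s) (mem ur' r'≢s) s us)
    (cong₂ _∧_ us (cong not (==-refl s)))
    where
    f : VSet n
    f v = u v ∧ not (v == s)
    mem : ∀ {v} → u v ≡ true → v ≢ s → f v ≡ true
    mem uv ne = ∧⁺ uv (not⁺ (≢⇒==false ne))
    sub : f ⊆ᵛ u
    sub v e = proj₁ (∧⁻ e)
    unmem : ∀ {v} → f v ≡ true → u v ≡ true × v ≢ s
    unmem {v} e with ∧⁻ {u v} e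
    ... | uv , ne = uv , λ where refl → true≢false ne (cong not (==-refl s))
    unif : ∀ v w w' → u v ≡ true → f v ≡ false → f w ≡ true → f w' ≡ true → arc T v w ≡ arc T v w'
    unif v w w' uv fv fw fw' = at (v ≟ s)
      where
      val : v ≡ s → ∀ w → f w ≡ true → arc T v w ≡ arc T x w
      val refl w fw with unmem fw
      ... | uw , w≢s = flip-cong T w≢s (∉⇒≢ ux uw) (p w uw w≢s)
      at : Dec (v ≡ s) → arc T v w ≡ arc T v w'
      at (no v≢s) = true≢false (mem uv v≢s) fv
      at (yes e) = trans (val e w fw) (trans (o w w' (proj₁ (unmem fw)) (proj₁ (unmem fw'))) (sym (val e w' fw')))

  ext-not-twin : ∀ {s x} → u x ≡ false → Prime T (u ⊕ x) → Twin s x → ⊥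
  ext-not-twin {s} {x} ux prx (us , p) with third s s
  ... | r , ur , r≢s , _ = true≢false
    (prx f (sub , unif) s x (∉⇒≢ ux us) (∨⁺ˡ (==-refl s)) (∨⁺ʳ {x == s} (==-refl x)) r (⊕-old {u = u} ur))
    (∨-false⁺ (≢⇒==false r≢s) (≢⇒==false (∉⇒≢ ux ur)))
    where
    f : VSet n
    f v = (v == s) ∨ (v == x)
    sub : f ⊆ᵛ (u ⊕ x)
    sub v e with ∨⁻ {v == s} e
    ... | inj₁ e' = ⊕-old {u = u} (subst (λ z → u z ≡ true) (sym (==⁻ v s e')) us)
    ... | inj₂ e' = subst (λ z → (u ⊕ x) z ≡ true) (sym (==⁻ v x e')) (⊕-new u x)
    val : ∀ v w → (u ⊕ x) v ≡ true → f v ≡ false → f w ≡ true → arc T v w ≡ arc T v x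
    val v w uv fv fw with ∨-false⁻ {v == s} fv | ∨⁻ {w == s} fw | ⊕⁻ u uv
    ... | v≢s , v≢x | inj₁ e | inj₁ uv' with refl ← ==⁻ w s e = p v uv' (undoes⁻ (v ≟ s) v≢s)
    ... | v≢s , v≢x | inj₁ e | inj₂ e' = ⊥-elim (undoes⁻ (v ≟ x) v≢x e')
    ... | v≢s , v≢x | inj₂ e | _ with refl ← ==⁻ w x e = refl
    unif : ∀ v w w' → (u ⊕ x) v ≡ true → f v ≡ false → f w ≡ true → f w' ≡ true → arc T v w ≡ arc T v w'
    unif v w w' uv fv fw fw' = trans (val v w uv fv fw) (sym (val v w' uv fv fw'))

  ext-not-out : ∀ {x} → u x ≡ false → Prime T (u ⊕ x) → Out x → ⊥
  ext-not-out {x} ux prx o = true≢false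
    (prx u ((λ v → ⊕-old {u = u}) , unif) a b a≢b ua ub x (⊕-new u x)) ux
    where
    unif : ∀ v w w' → (u ⊕ x) v ≡ true → u v ≡ false → u w ≡ true → u w' ≡ true → arc T v w ≡ arc T v w'
    unif v w w' uv fv uw uw' with ⊕⁻ u uv
    ... | inj₁ e = true≢false e fv
    ... | inj₂ refl = o w w' uw uw'

  data Trace (f : VSet n) : Set where
    full  : u ⊆ᵛ f → Trace f
    point : ∀ s → u s ≡ true → f s ≡ true → (∀ v → u v ≡ true → f v ≡ true → v ≡ s) → Trace f
    empty : (∀ v → u v ≡ true → f v ≡ false) → Trace f

  -- The part inside `u` of an interval of T[w] is an interval of T[u], so the primality of `u`
  -- leaves three possibilities.
  trace : ∀ f {w} → u ⊆ᵛ w → Module T w f → Trace f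
  trace f u⊆w (_ , unif) with any? (λ s → (u s ≟ᴮ true) ×-dec (f s ≟ᴮ true))
  ... | no none = empty λ v uv → refute (λ fv → none (v , uv , fv))
  ... | yes (s , us , fs) with any? (λ t → (u t ≟ᴮ true) ×-dec ((f t ≟ᴮ true) ×-dec ¬? (t ≟ s)))
  ...   | no none = point s us fs λ v uv fv → case v ≟ s of λ where
            (yes e) → e
            (no ne) → ⊥-elim (none (v , uv , fv , ne))
  ...   | yes (t , ut , ft , t≢s) = full λ v uv → proj₁ (∧⁻ (pr g ((λ v e → proj₂ (∧⁻ {f v} e)) , unif') t s t≢s (∧⁺ ft ut) (∧⁺ fs us) v uv))
    where
    g : VSet n
    g v = f v ∧ u v
    unif' : ∀ x y z → u x ≡ true → g x ≡ false → g y ≡ true → g z ≡ true → arc T x y ≡ arc T x z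
    unif' x y z ux gx gy gz = unif x y z (u⊆w x ux) (fx x ux gx) (proj₁ (∧⁻ gy)) (proj₁ (∧⁻ gz))
      where
      fx : ∀ x → u x ≡ true → g x ≡ false → f x ≡ false
      fx x ux gx with f x
      ... | false = refl
      ... | true = true≢false ux gx

  classify : ∀ x → u x ≡ false → Prime T (u ⊕ x) ⊎ (∃ λ s → Twin s x) ⊎ Out x
  classify x ux with prime-dec T (u ⊕ x)
  ... | inj₁ p = inj₁ p
  ... | inj₂ (f , md@(f⊆ , unif) , (p , q , p≢q , fp , fq) , (r , ur , fr))
    with trace f (λ v → ⊕-old {u = u}) md | bool-case (f x)
  ... | full h | inj₂ fx = inj₂ (inj₂ λ v w uv uw → unif x v w (⊕-new u x) fx (h v uv) (h w uw))
  ... | full h | inj₁ fx with ⊕⁻ u ur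
  ...   | inj₁ e = true≢false (h r e) fr
  ...   | inj₂ refl = true≢false fx fr
  classify x ux | inj₂ (f , md@(f⊆ , unif) , (p , q , p≢q , fp , fq) , (r , ur , fr)) | point s us fs uniq | inj₁ fx =
    inj₂ (inj₁ (s , us , λ v uv v≢s → unif v s x (⊕-old {u = u} uv) (refute (λ fv → v≢s (uniq v uv fv))) fs fx))
  classify x ux | inj₂ (f , md@(f⊆ , unif) , (p , q , p≢q , fp , fq) , (r , ur , fr)) | point s us fs uniq | inj₂ fx
    = ⊥-elim (p≢q (trans (is p fp) (sym (is q fq))))
    where
    is : ∀ v → f v ≡ true → v ≡ s
    is v fv with ⊕⁻ u (f⊆ v fv)
    ... | inj₁ e = uniq v e fv
    ... | inj₂ refl = true≢false fv fx
  classify x ux | inj₂ (f , md@(f⊆ , unif) , (p , q , p≢q , fp , fq) , (r , ur , fr)) | empty h | _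
    = ⊥-elim (p≢q (trans (is p fp) (sym (is q fq))))
    where
    is : ∀ v → f v ≡ true → v ≡ x
    is v fv with ⊕⁻ u (f⊆ v fv)
    ... | inj₁ e = true≢false fv (h v e)
    ... | inj₂ e = e

  -- The possible traces on u of a nontrivial interval of T[u ∪ {x , y}].
  data PairView (x y : Fin n) : Set where
    u∪x    : (∀ v → u v ≡ true → arc T y v ≡ arc T y x) → PairView x y
    u∪y    : (∀ v → u v ≡ true → arc T x v ≡ arc T x y) → PairView x y
    justu  : Out x → Out y → PairView x y
    s∪x    : ∀ s → Twin s x → arc T y s ≡ arc T y x → PairView x y
    s∪y    : ∀ s → Twin s y → arc T x s ≡ arc T x y → PairView x y
    s∪x∪y  : ∀ s → Twin s x → Twin s y → PairView x y
    x∪y    : (∀ v → u v ≡ true → arc T v x ≡ arc T v y) → PairView x y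

  pairView : ∀ {x y} → u x ≡ false → u y ≡ false → NonPrime T (u ⊕ x ⊕ y) → PairView x y
  pairView {x} {y} ux uy (f , md@(f⊆ , unif) , (p , q , p≢q , fp , fq) , (r , ur , fr)) =
    view (trace f u⊆ md) (bool-case (f x)) (bool-case (f y))
    where
    w : VSet n
    w = u ⊕ x ⊕ y
    u⊆ : u ⊆ᵛ w
    u⊆ v e = ⊕-old {u = u ⊕ x} (⊕-old {u = u} e)
    wx : w x ≡ true
    wx = ⊕-old {u = u ⊕ x} (⊕-new u x)
    wy : w y ≡ true
    wy = ⊕-new (u ⊕ x) y
    w⁻ : ∀ v → w v ≡ true → u v ≡ true ⊎ v ≡ x ⊎ v ≡ y
    w⁻ v e with ⊕⁻ (u ⊕ x) e
    ... | inj₂ e' = inj₂ (inj₂ e')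
    ... | inj₁ e' with ⊕⁻ u e'
    ...   | inj₁ e'' = inj₁ e''
    ...   | inj₂ e'' = inj₂ (inj₁ e'')
    atMost : ∀ {z} → (∀ v → f v ≡ true → v ≡ z) → ⊥
    atMost h = p≢q (trans (h p fp) (sym (h q fq)))
    view : Trace f → f x ≡ true ⊎ f x ≡ false → f y ≡ true ⊎ f y ≡ false → PairView x y
    view (full h) (inj₁ fx) (inj₁ fy) with w⁻ r ur
    ... | inj₁ e = true≢false (h r e) fr
    ... | inj₂ (inj₁ refl) = true≢false fx fr
    ... | inj₂ (inj₂ refl) = true≢false fy fr
    view (full h) (inj₁ fx) (inj₂ fy) = u∪x λ v uv → unif y v x wy fy (h v uv) fx
    view (full h) (inj₂ fx) (inj₁ fy) = u∪y λ v uv → unif x v y wx fx (h v uv) fy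
    view (full h) (inj₂ fx) (inj₂ fy) =
      justu (λ v v' uv uv' → unif x v v' wx fx (h v uv) (h v' uv')) (λ v v' uv uv' → unif y v v' wy fy (h v uv) (h v' uv'))
    view (point s us fs uniq) fx? fy? = pt fx? fy?
      where
      off : ∀ v → u v ≡ true → v ≢ s → f v ≡ false
      off v uv v≢s = refute (λ fv → v≢s (uniq v uv fv))
      tw : ∀ {z} → f z ≡ true → Twin s z
      tw fz = us , λ v uv v≢s → unif v s _ (u⊆ v uv) (off v uv v≢s) fs fz
      pt : f x ≡ true ⊎ f x ≡ false → f y ≡ true ⊎ f y ≡ false → PairView x y
      pt (inj₁ fx) (inj₁ fy) = s∪x∪y s (tw fx) (tw fy)
      pt (inj₁ fx) (inj₂ fy) = s∪x s (tw fx) (unif y s x wy fy fs fx)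
      pt (inj₂ fx) (inj₁ fy) = s∪y s (tw fy) (unif x s y wx fx fs fy)
      pt (inj₂ fx) (inj₂ fy) = ⊥-elim (atMost is)
        where
        is : ∀ v → f v ≡ true → v ≡ s
        is v fv with w⁻ v (f⊆ v fv)
        ... | inj₁ e = uniq v e fv
        ... | inj₂ (inj₁ refl) = true≢false fv fx
        ... | inj₂ (inj₂ refl) = true≢false fv fy
    view (empty h) (inj₁ fx) (inj₁ fy) = x∪y λ v uv → unif v x y (u⊆ v uv) (h v uv) fx fy
    view (empty h) (inj₂ fx) _ = ⊥-elim (atMost is)
      where
      is : ∀ v → f v ≡ true → v ≡ y
      is v fv with w⁻ v (f⊆ v fv)
      ... | inj₁ e = true≢false fv (h v e)
      ... | inj₂ (inj₁ refl) = true≢false fv fx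
      ... | inj₂ (inj₂ e) = e
    view (empty h) (inj₁ _) (inj₂ fy) = ⊥-elim (atMost is)
      where
      is : ∀ v → f v ≡ true → v ≡ x
      is v fv with w⁻ v (f⊆ v fv)
      ... | inj₁ e = true≢false fv (h v e)
      ... | inj₂ (inj₁ e) = e
      ... | inj₂ (inj₂ refl) = true≢false fv fy

  twin-pair : ∀ {s x y} → u x ≡ false → u y ≡ false → x ≢ y → NonPrime T (u ⊕ x ⊕ y) →
    Twin s x → ¬ Twin s y → arc T y s ≡ arc T y x
  twin-pair {s} {x} {y} ux uy x≢y np tx@(us , hx) ¬ty with pairView ux uy np
  ... | u∪x h = h s us
  ... | u∪y h = ⊥-elim (twin-not-out ux tx λ v w uv uw → trans (h v uv) (sym (h w uw)))
  ... | justu ox _ = ⊥-elim (twin-not-out ux tx ox)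
  ... | s∪x t tx' e = subst (λ z → arc T y z ≡ arc T y x) (twin-unique tx' tx) e
  ... | s∪x∪y t tx' ty = ⊥-elim (¬ty (subst (λ z → Twin z y) (twin-unique tx' tx) ty))
  ... | x∪y h = ⊥-elim (¬ty (us , λ v uv v≢s → trans (hx v uv v≢s) (h v uv)))
  ... | s∪y t ty@(ut , hy) e with s ≟ t
  ...   | yes refl = ⊥-elim (¬ty ty)
  -- `y` is a twin of a second vertex `t`: the arcs from `y` to `s` and to `x` are compared through
  -- those from `t`.
  ...   | no s≢t = trans (sym (flip-cong T s≢t (∉⇒≢ uy us) (hy s us s≢t)))
                    (trans (hx t ut (λ e' → s≢t (sym e')))
                    (flip-cong T (≢-sym (∉⇒≢ ux ut)) x≢y e))

  out-pair : ∀ {x y v} → u x ≡ false → u y ≡ false → NonPrime T (u ⊕ x ⊕ y) →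
    Out x → ¬ Out y → u v ≡ true → arc T x y ≡ arc T x v
  out-pair {x} {y} {v} ux uy np ox ¬oy uv with pairView ux uy np
  ... | u∪x h = ⊥-elim (¬oy λ v w uv uw → trans (h v uv) (sym (h w uw)))
  ... | u∪y h = sym (h v uv)
  ... | justu _ oy = ⊥-elim (¬oy oy)
  ... | s∪x t tx _ = ⊥-elim (twin-not-out ux tx ox)
  ... | s∪y t (ut , _) e = trans (sym e) (ox t v ut uv)
  ... | s∪x∪y t tx _ = ⊥-elim (twin-not-out ux tx ox)
  ... | x∪y h = ⊥-elim (¬oy λ v w uv uw →
    trans (sym (flip-cong T (∉⇒≢ ux uv) (∉⇒≢ uy uv) (h v uv)))
      (trans (ox v w uv uw) (flip-cong T (∉⇒≢ ux uw) (∉⇒≢ uy uw) (h w uw))))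

  ext-pair : ∀ {x y v} → u x ≡ false → u y ≡ false → NonPrime T (u ⊕ x ⊕ y) →
    Prime T (u ⊕ x) → Prime T (u ⊕ y) → u v ≡ true → arc T v x ≡ arc T v y
  ext-pair {x} {y} {v} ux uy np ex ey uv with pairView ux uy np
  ... | u∪x h = ⊥-elim (ext-not-out uy ey λ v w uv uw → trans (h v uv) (sym (h w uw)))
  ... | u∪y h = ⊥-elim (ext-not-out ux ex λ v w uv uw → trans (h v uv) (sym (h w uw)))
  ... | justu ox _ = ⊥-elim (ext-not-out ux ex ox)
  ... | s∪x t tx _ = ⊥-elim (ext-not-twin ux ex tx)
  ... | s∪y t ty e = ⊥-elim (ext-not-twin uy ey ty)
  ... | s∪x∪y t tx _ = ⊥-elim (ext-not-twin ux ex tx)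
  ... | x∪y h = h v uv

  -- The hypotheses make three sets intervals of T: `s` with its twins, `u` with the vertices that
  -- separate it, and, once twins and non-separating vertices are thereby excluded, the complement
  -- of `u`. The hypotheses are abstract because they arise in two ways: from the failure of all
  -- enlargements by two vertices, and from forbidden copies of W5 in `AvoidingW5`.
  stuck : Prime T allᵛ →
    (∀ {s x y} → u x ≡ false → u y ≡ false → x ≢ y → Twin s x → ¬ Twin s y → arc T y s ≡ arc T y x) →
    (∀ {x y v} → u x ≡ false → u y ≡ false → x ≢ y → Out x → ¬ Out y → u v ≡ true → arc T x y ≡ arc T x v) →
    (∀ {x y v} → u x ≡ false → u y ≡ false → x ≢ y → Prime T (u ⊕ x) → Prime T (u ⊕ y) → u v ≡ true → arc T v x ≡ arc T v y) →
    ∀ x y → u x ≡ false → u y ≡ false → x ≡ y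
  stuck prT twin-pair′ out-pair′ ext-pair′ x y ux uy = two
    where
    no-twin : ∀ s x → u x ≡ false → ¬ Twin s x
    no-twin s x ux tx@(us , _) with third s s
    ... | r , ur , r≢s , _ = true≢false (prT f ((λ _ _ → refl) , unif) s x (∉⇒≢ ux us)
            (∨⁺ˡ (==-refl s)) (∨⁺ʳ {x == s} (∧⁺ (not⁺ ux) (does⁺ (twin? s x) tx))) r refl)
            (∨-false⁺ (≢⇒==false r≢s) (cong (λ b → not b ∧ does (twin? s r)) ur))
      where
      f : VSet n
      f v = (v == s) ∨ (not (u v) ∧ does (twin? s v))
      val : ∀ v w → f v ≡ false → f w ≡ true → arc T v w ≡ arc T v s
      val v w fv fw with ∨-false⁻ {v == s} fv | ∨⁻ {w == s} fw
      ... | _ | inj₁ e with refl ← ==⁻ w s e = refl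
      ... | v≢s , fv' | inj₂ e with ∧⁻ {not (u w)} e
      ...   | uw , tw with bool-case (u v)
      ...     | inj₁ uv = sym (proj₂ (does⁻ (twin? s w) tw) v uv (undoes⁻ (v ≟ s) v≢s))
      ...     | inj₂ uv = sym (twin-pair′ (not-true⁻ uw) uv w≢v (does⁻ (twin? s w) tw) ¬tv)
        where
        ¬tv : ¬ Twin s v
        ¬tv t = true≢false (∧⁺ (not⁺ uv) (does⁺ (twin? s v) t)) fv'
        w≢v : w ≢ v
        w≢v refl = ¬tv (does⁻ (twin? s w) tw)
      unif : ∀ v w w' → true ≡ true → f v ≡ false → f w ≡ true → f w' ≡ true → arc T v w ≡ arc T v w'
      unif v w w' _ fv fw fw' = trans (val v w fv fw) (sym (val v w' fv fw'))
    no-out : ∀ x → u x ≡ false → ¬ Out x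
    no-out x ux ox = true≢false (prT f ((λ _ _ → refl) , unif) a b a≢b (∨⁺ˡ ua) (∨⁺ˡ ub) x refl)
        (∨-false⁺ ux (cong not (does⁺ (out? x) ox)))
      where
      f : VSet n
      f v = u v ∨ not (does (out? v))
      val : ∀ v w → f v ≡ false → f w ≡ true → arc T v w ≡ arc T v a
      val v w fv fw with ∨-false⁻ {u v} fv
      ... | uv , ov' = go (∨⁻ {u w} fw)
        where
        not⁻ : ∀ {b} → not b ≡ false → b ≡ true
        not⁻ {true} _ = refl
        ov : Out v
        ov = does⁻ (out? v) (not⁻ ov')
        go : u w ≡ true ⊎ not (does (out? w)) ≡ true → arc T v w ≡ arc T v a
        go (inj₁ uw) = ov w a uw ua
        go (inj₂ ow) with bool-case (u w)
        ... | inj₁ uw = ov w a uw ua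
        ... | inj₂ uw = out-pair′ uv uw (λ e → ¬ow (subst Out e ov)) ov ¬ow ua
          where
          ¬ow : ¬ Out w
          ¬ow o = true≢false ow (cong not (does⁺ (out? w) o))
      unif : ∀ v w w' → true ≡ true → f v ≡ false → f w ≡ true → f w' ≡ true → arc T v w ≡ arc T v w'
      unif v w w' _ fv fw fw' = trans (val v w fv fw) (sym (val v w' fv fw'))
    ext : ∀ x → u x ≡ false → Prime T (u ⊕ x)
    ext x ux with classify x ux
    ... | inj₁ e = e
    ... | inj₂ (inj₁ (s , t)) = ⊥-elim (no-twin s x ux t)
    ... | inj₂ (inj₂ o) = ⊥-elim (no-out x ux o)
    two : x ≡ y
    two with x ≟ y
    ... | yes e = e
    ... | no x≢y = true≢false (prT (not ∘ u) ((λ _ _ → refl) , unif) x y x≢y (not⁺ ux) (not⁺ uy) a refl) (cong not ua)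
      where
      unif : ∀ v w w' → true ≡ true → not (u v) ≡ false → not (u w) ≡ true → not (u w') ≡ true → arc T v w ≡ arc T v w'
      unif v w w' _ fv fw fw' with w ≟ w'
      ... | yes refl = refl
      ... | no w≢w' = ext-pair′ {v = v} (not-cong⁻ fw) (not-cong⁻ fw') w≢w'
              (ext w (not-cong⁻ fw)) (ext w' (not-cong⁻ fw')) (not-cong⁻ fv)

  -- The Ehrenfeucht-Rozenberg theorem: if no pair enlarges `u`, the intervals witnessing this give
  -- the hypotheses of `stuck`.
  upward : Prime T allᵛ →
    (∃₂ λ x y → u x ≡ false × u y ≡ false × x ≢ y × Prime T (u ⊕ x ⊕ y)) ⊎
    (∀ x y → u x ≡ false → u y ≡ false → x ≡ y)
  upward prT with any? (λ x → any? λ y → (u x ≟ᴮ false) ×-dec ((u y ≟ᴮ false) ×-dec (¬? (x ≟ y) ×-dec prime? T (u ⊕ x ⊕ y))))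
  ... | yes (x , y , h) = inj₁ (x , y , h)
  ... | no none = inj₂ (stuck prT
      (λ ux uy x≢y → twin-pair ux uy x≢y (np ux uy x≢y)) (λ ux uy x≢y → out-pair ux uy (np ux uy x≢y)) (λ ux uy x≢y → ext-pair ux uy (np ux uy x≢y)))
    where
    np : ∀ {x y} → u x ≡ false → u y ≡ false → x ≢ y → NonPrime T (u ⊕ x ⊕ y)
    np {x} {y} ux uy x≢y = [ (λ p → ⊥-elim (none (x , y , ux , uy , x≢y , p))) , id ]′ (prime-dec T (u ⊕ x ⊕ y))

-- Only the parity of the complement is recorded; the primality of the intermediate sets is consumed
-- in `climb`.
data EvenGap {n : ℕ} (u : VSet n) : Set where
  done : (∀ v → u v ≡ true) → EvenGap u
  add  : ∀ {x y} → u x ≡ false → u y ≡ false → x ≢ y → EvenGap (u ⊕ x ⊕ y) → EvenGap u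

count-⊕⊕ : ∀ {n} {u : VSet n} {x y} → u x ≡ false → u y ≡ false → x ≢ y → count (u ⊕ x ⊕ y) ≡ suc (suc (count u))
count-⊕⊕ {u = u} {x} {y} ux uy x≢y =
  trans (count-⊕ {u = u ⊕ x} (⊕-false {u = u} uy (≢-sym x≢y))) (cong suc (count-⊕ {u = u} ux))

double : ℕ → ℕ
double zero = 0
double (suc k) = suc (suc (double k))

evenGap-count : ∀ {n} {u : VSet n} → EvenGap u → ∃ λ k → double k + count u ≡ n
evenGap-count (done h) = 0 , count-all h
evenGap-count {u = u} (add ux uy x≢y g) with evenGap-count g
... | k , e = suc k , trans (sym (trans (+-suc (double k) (suc (count u))) (cong suc (+-suc (double k) (count u)))))
                       (trans (cong (double k +_) (sym (count-⊕⊕ ux uy x≢y))) e)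

_∖_ : ∀ {n} → VSet n → Fin n → VSet n
(u ∖ x) v = u v ∧ not (v == x)

-- Iterated `upward` ends at V or one vertex short of it, and in the second case that vertex is
-- non-critical. When all vertices outside `u` are critical only the first end remains, which opens
-- the way to parity arguments.
climb : ∀ {n} (T : Tournament n) → Prime T allᵛ → ∀ u → Prime T u → ∀ a b c →
  u a ≡ true → u b ≡ true → u c ≡ true → a ≢ b → a ≢ c → b ≢ c →
  EvenGap u ⊎ (∃ λ x → u x ≡ false × Prime T (allᵛ ∖ x))
climb {n} T prT u pr a b c ua ub uc a≢b a≢c b≢c = go n u pr ua ub uc (m≤m+n n (count u))
  where
  -- The fuel `k` bounds the number of missing vertices; a round adds two vertices and spends one
  -- unit.
  go : ∀ k u → Prime T u → u a ≡ true → u b ≡ true → u c ≡ true → n ≤ k + count u →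
    EvenGap u ⊎ (∃ λ x → u x ≡ false × Prime T (allᵛ ∖ x))
  go k u pr ua ub uc le with Upward.upward T u pr a b c ua ub uc a≢b a≢c b≢c prT
  ... | inj₂ uniq with any? (λ x → u x ≟ᴮ false)
  ...   | no none = inj₁ (done λ v → [ id , (λ e → ⊥-elim (none (v , e))) ]′ (bool-case (u v)))
  ...   | yes (x , ux) = inj₂ (x , ux , Prime-cong {T = T} {u} sub sup pr)
    where
    sub : u ⊆ᵛ (allᵛ ∖ x)
    sub v uv = not⁺ (≢⇒==false {x = v} {x} λ where refl → true≢false uv ux)
    sup : (allᵛ ∖ x) ⊆ᵛ u
    sup v e = [ id , (λ uv → true≢false e (cong not (does⁺ (v ≟ x) (uniq v x uv ux)))) ]′ (bool-case (u v))
  go zero u pr ua ub uc le | inj₁ (x , y , ux , uy , x≢y , pr') =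
    ⊥-elim (<-irrefl refl (≤-trans (count-strict {f = u} {allᵛ} (λ _ _ → refl) x ux refl)
      (≤-trans (subst (_≤ n) refl (count≤ {n} allᵛ)) le)))
  go (suc k) u pr ua ub uc le | inj₁ (x , y , ux , uy , x≢y , pr')
    with go k (u ⊕ x ⊕ y) pr' (old ua) (old ub) (old uc)
      (≤-trans le (≤-trans (m≤n⇒m≤1+n ≤-refl) (subst (λ z → suc (suc (k + count u)) ≤ z)
        (sym (trans (cong (k +_) (count-⊕⊕ {u = u} ux uy x≢y)) (trans (+-suc k _) (cong suc (+-suc k _))))) ≤-refl)))
    where
    old : ∀ {v} → u v ≡ true → (u ⊕ x ⊕ y) v ≡ true
    old p = ⊕-old {u = u ⊕ x} (⊕-old {u = u} p)
  ... | inj₁ g = inj₁ (add ux uy x≢y g)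
  ... | inj₂ (z , uz , p) = inj₂ (z , proj₁ (∨-false⁻ {u z} (proj₁ (∨-false⁻ {(u ⊕ x) z} uz))) , p)

-- Finite configurations and tests on them

-- Finite configurations: a tournament on m vertices is given by its rows, newest vertex first.

infixl 5 _▷_
data Rows : ℕ → Set where
  []  : Rows 0
  _▷_ : ∀ {m} → Rows m → Vec Bool m → Rows (suc m)

mat : ∀ {m} → Rows m → Fin m → Fin m → Bool
mat (R ▷ r) zero zero = false
mat (R ▷ r) zero (suc j) = lookup r j
mat (R ▷ r) (suc i) zero = not (lookup r i)
mat (R ▷ r) (suc i) (suc j) = mat R i j

rowsOf : ∀ {n m} → Tournament n → Vec (Fin n) m → Rows m
rowsOf T [] = []
rowsOf T (x ∷ xs) = rowsOf T xs ▷ map (arc T x) xs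

Distinct : ∀ {n m} → Vec (Fin n) m → Set
Distinct xs = AllPairs _≢_ xs

mat-rowsOf : ∀ {n m} (T : Tournament n) {vs : Vec (Fin n) m} → Distinct vs → ∀ i j →
  mat (rowsOf T vs) i j ≡ arc T (lookup vs i) (lookup vs j)
mat-rowsOf T {x ∷ xs} (p ∷ ps) zero zero = sym (irrefl T x)
mat-rowsOf T {x ∷ xs} (p ∷ ps) zero (suc j) = lookup-map j (arc T x) xs
mat-rowsOf T {x ∷ xs} (p ∷ ps) (suc i) zero =
  trans (cong not (lookup-map i (arc T x) xs)) (sym (flip-arc T (lookup⁺ p i)))
mat-rowsOf T {x ∷ xs} (p ∷ ps) (suc i) (suc j) = mat-rowsOf T ps i j

lookup-injective : ∀ {n m} {vs : Vec (Fin n) m} → Distinct vs → ∀ i j → lookup vs i ≡ lookup vs j → i ≡ j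
lookup-injective (p ∷ ps) zero zero e = refl
lookup-injective (p ∷ ps) zero (suc j) e = ⊥-elim (lookup⁺ p j e)
lookup-injective (p ∷ ps) (suc i) zero e = ⊥-elim (lookup⁺ p i (sym e))
lookup-injective (p ∷ ps) (suc i) (suc j) e = cong suc (lookup-injective ps i j e)

setOf : ∀ {n m} → Vec (Fin n) m → VSet n
setOf [] _ = false
setOf (x ∷ xs) = setOf xs ⊕ x

setOf⁺ : ∀ {n m} (vs : Vec (Fin n) m) i → setOf vs (lookup vs i) ≡ true
setOf⁺ (x ∷ xs) zero = ⊕-new (setOf xs) x
setOf⁺ (x ∷ xs) (suc i) = ⊕-old {u = setOf xs} (setOf⁺ xs i)

setOf⁻ : ∀ {n m} (vs : Vec (Fin n) m) {v} → setOf vs v ≡ true → ∃ λ i → lookup vs i ≡ v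
setOf⁻ (x ∷ xs) e with ⊕⁻ (setOf xs) e
... | inj₂ e' = zero , sym e'
... | inj₁ e' with setOf⁻ xs e'
...   | i , q = suc i , q

setOf-∉ : ∀ {n m} (vs : Vec (Fin n) m) {v} → All (v ≢_) vs → setOf vs v ≡ false
setOf-∉ [] [] = refl
setOf-∉ (x ∷ xs) (p ∷ ps) = ⊕-false {u = setOf xs} (setOf-∉ xs ps) p

setOf-∉⁻ : ∀ {n m} (vs : Vec (Fin n) m) {v} → setOf vs v ≡ false → All (v ≢_) vs
setOf-∉⁻ [] e = []
setOf-∉⁻ (x ∷ xs) {v} e with ∨-false⁻ {setOf xs v} e
... | p , q = undoes⁻ (v ≟ x) q ∷ setOf-∉⁻ xs p

allF anyF : ∀ {m} → (Fin m → Bool) → Bool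
allF {zero} f = true
allF {suc m} f = f zero ∧ allF (f ∘ suc)
anyF {zero} f = false
anyF {suc m} f = f zero ∨ anyF (f ∘ suc)

allF⁻ : ∀ {m} {f : Fin m → Bool} → allF f ≡ true → ∀ i → f i ≡ true
allF⁻ {suc m} p zero = proj₁ (∧⁻ p)
allF⁻ {suc m} {f} p (suc i) = allF⁻ (proj₂ (∧⁻ {f zero} p)) i

allF⁺ : ∀ {m} {f : Fin m → Bool} → (∀ i → f i ≡ true) → allF f ≡ true
allF⁺ {zero} h = refl
allF⁺ {suc m} h = ∧⁺ (h zero) (allF⁺ (h ∘ suc))

anyF⁻ : ∀ {m} {f : Fin m → Bool} → anyF f ≡ true → ∃ λ i → f i ≡ true
anyF⁻ {suc m} {f} p with ∨⁻ {f zero} p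
... | inj₁ q = zero , q
... | inj₂ q with anyF⁻ q
...   | i , r = suc i , r

anyF⁺ : ∀ {m} {f : Fin m → Bool} i → f i ≡ true → anyF f ≡ true
anyF⁺ zero p = ∨⁺ˡ p
anyF⁺ {f = f} (suc i) p = ∨⁺ʳ {f zero} (anyF⁺ i p)

allVec : ∀ m → (Vec Bool m → Bool) → Bool
allVec zero f = f []
allVec (suc m) f = allVec m (λ v → f (true ∷ v)) ∧ allVec m (λ v → f (false ∷ v))

allVec⁻ : ∀ m {f : Vec Bool m → Bool} → allVec m f ≡ true → ∀ v → f v ≡ true
allVec⁻ zero p [] = p
allVec⁻ (suc m) p (true ∷ v) = allVec⁻ m (proj₁ (∧⁻ p)) v
allVec⁻ (suc m) {f} p (false ∷ v) = allVec⁻ m (proj₂ (∧⁻ {allVec m (λ v → f (true ∷ v))} p)) v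

infixr 4 _⇒_
_⇒_ : Bool → Bool → Bool
true ⇒ b = b
false ⇒ b = true

⇒⁻ : ∀ {a b} → (a ⇒ b) ≡ true → a ≡ true → b ≡ true
⇒⁻ p refl = p

opaque
  -- The copy has transitive part `p`, `q`, `r`, `s` and fifth vertex `t`, and must meet `root`.
  -- Arcs are tested as soon as both ends are chosen, which cuts the search.
  w5on : ∀ {m} → (Fin m → Fin m → Bool) → (Fin m → Bool) → Bool
  w5on M root = anyF λ p → anyF λ q → M p q ∧ anyF λ r → M p r ∧ M q r ∧ anyF λ s → M p s ∧ M q s ∧ M r s ∧
    anyF λ t → M t p ∧ M q t ∧ M t r ∧ M s t ∧ (root p ∨ root q ∨ root r ∨ root s ∨ root t)

module _ {n : ℕ} (T : Tournament n) where

  -- Injectivity comes for free: two different vertices of W5 are joined by an arc, and T has no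
  -- loops.
  inW5 : (f : Fin 5 → Fin n) → (∀ i j → arc T (f i) (f j) ≡ arcW5 i j) → ∀ i → InW5 T (f i)
  inW5 f h i = f , inj , h , i , refl
    where
    apart : ∀ i j → (arcW5 i j ∨ arcW5 j i ∨ (i == j)) ≡ true
    apart i = allF⁻ (allF⁻ {f = λ i → allF λ j → arcW5 i j ∨ arcW5 j i ∨ (i == j)} refl i)
    loop : ∀ {x y} → f x ≡ f y → arcW5 x y ≡ false
    loop {x} {y} e = trans (sym (h x y)) (trans (cong (λ z → arc T z (f y)) e) (irrefl T (f y)))
    inj : ∀ {x y} → f x ≡ f y → x ≡ y
    inj {x} {y} e with ∨⁻ {arcW5 x y} (apart x y)
    ... | inj₁ p = true≢false p (loop e)
    ... | inj₂ p with ∨⁻ {arcW5 y x} p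
    ...   | inj₁ q = true≢false q (loop (sym e))
    ...   | inj₂ q = ==⁻ x y q

  arcs⇒W5 : ∀ {p q r s t} → T ∶ p ⟶ q → T ∶ p ⟶ r → T ∶ p ⟶ s → T ∶ q ⟶ r → T ∶ q ⟶ s → T ∶ q ⟶ t → T ∶ r ⟶ s → T ∶ s ⟶ t → T ∶ t ⟶ p → T ∶ t ⟶ r →
    ∀ i → InW5 T (lookup (p ∷ q ∷ r ∷ s ∷ t ∷ []) i)
  arcs⇒W5 {p} {q} {r} {s} {t} pq pr ps qr qs qt rs st tp tr = inW5 (lookup (p ∷ q ∷ r ∷ s ∷ t ∷ [])) h
    where
    h : ∀ i j → arc T (lookup (p ∷ q ∷ r ∷ s ∷ t ∷ []) i) (lookup (p ∷ q ∷ r ∷ s ∷ t ∷ []) j) ≡ arcW5 i j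
    h 0F 0F = irrefl T p
    h 0F 1F = pq
    h 0F 2F = pr
    h 0F 3F = ps
    h 0F 4F = asym T t p tp
    h 1F 0F = asym T p q pq
    h 1F 1F = irrefl T q
    h 1F 2F = qr
    h 1F 3F = qs
    h 1F 4F = qt
    h 2F 0F = asym T p r pr
    h 2F 1F = asym T q r qr
    h 2F 2F = irrefl T r
    h 2F 3F = rs
    h 2F 4F = asym T t r tr
    h 3F 0F = asym T p s ps
    h 3F 1F = asym T q s qs
    h 3F 2F = asym T r s rs
    h 3F 3F = irrefl T s
    h 3F 4F = st
    h 4F 0F = tp
    h 4F 1F = asym T q t qt
    h 4F 2F = tr
    h 4F 3F = asym T s t st
    h 4F 4F = irrefl T t

  opaque
    unfolding w5on

    w5on-sound : ∀ {m} {vs : Vec (Fin n) m} → Distinct vs → ∀ root → w5on (mat (rowsOf T vs)) root ≡ true →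
      ∃ λ i → root i ≡ true × InW5 T (lookup vs i)
    w5on-sound {m} {vs} dis root e with anyF⁻ e
    ... | p , e₁ with anyF⁻ e₁
    ... | q , e₂ with ∧⁻ {mat (rowsOf T vs) p q} e₂
    ... | pq , e₃ with anyF⁻ e₃
    ... | r , e₄ with ∧⁻ {mat (rowsOf T vs) p r} e₄
    ... | pr , e₅ with ∧⁻ {mat (rowsOf T vs) q r} e₅
    ... | qr , e₆ with anyF⁻ e₆
    ... | s , e₇ with ∧⁻ {mat (rowsOf T vs) p s} e₇
    ... | ps , e₈ with ∧⁻ {mat (rowsOf T vs) q s} e₈
    ... | qs , e₉ with ∧⁻ {mat (rowsOf T vs) r s} e₉
    ... | rs , f₁ with anyF⁻ f₁
    ... | t , f₂ with ∧⁻ {mat (rowsOf T vs) t p} f₂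
    ... | tp , f₃ with ∧⁻ {mat (rowsOf T vs) q t} f₃
    ... | qt , f₄ with ∧⁻ {mat (rowsOf T vs) t r} f₄
    ... | tr , f₅ with ∧⁻ {mat (rowsOf T vs) s t} f₅
    ... | st , f₆ = pick (∨⁻ {root p} f₆)
      where
      real : ∀ {i j} → mat (rowsOf T vs) i j ≡ true → T ∶ lookup vs i ⟶ lookup vs j
      real {i} {j} h = trans (sym (mat-rowsOf T dis i j)) h
      W : ∀ i → InW5 T (lookup (lookup vs p ∷ lookup vs q ∷ lookup vs r ∷ lookup vs s ∷ lookup vs t ∷ []) i)
      W = arcs⇒W5 (real pq) (real pr) (real ps) (real qr) (real qs) (real qt) (real rs) (real st) (real tp) (real tr)
      Goal : Set
      Goal = ∃ λ i → root i ≡ true × InW5 T (lookup vs i)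
      pick : root p ≡ true ⊎ (root q ∨ root r ∨ root s ∨ root t) ≡ true → Goal
      pick (inj₁ h) = p , h , W 0F
      pick (inj₂ h) with ∨⁻ {root q} h
      ... | inj₁ h₁ = q , h₁ , W 1F
      ... | inj₂ h₁ with ∨⁻ {root r} h₁
      ...   | inj₁ h₂ = r , h₂ , W 2F
      ...   | inj₂ h₂ with ∨⁻ {root s} h₂
      ...     | inj₁ h₃ = s , h₃ , W 3F
      ...     | inj₂ h₃ = t , h₃ , W 4F

moduleB : ∀ {m} → (Fin m → Fin m → Bool) → Vec Bool m → Bool
moduleB M I = allF λ i → lookup I i ∨ (allF λ j → lookup I j ⇒ M i j) ∨ (allF λ j → lookup I j ⇒ not (M i j))

noneB fewB fullB : ∀ {m} → Vec Bool m → Bool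
noneB [] = true
noneB (b ∷ v) = not b ∧ noneB v
fewB [] = true
fewB (true ∷ v) = noneB v
fewB (false ∷ v) = fewB v
fullB [] = true
fullB (b ∷ v) = b ∧ fullB v

noneB⁻ : ∀ {m} (v : Vec Bool m) → noneB v ≡ true → ∀ i → lookup v i ≡ true → ⊥
noneB⁻ (true ∷ v) () i p
noneB⁻ (false ∷ v) h (suc i) p = noneB⁻ v h i p

fewB⁻ : ∀ {m} (v : Vec Bool m) → fewB v ≡ true → ∀ i j → lookup v i ≡ true → lookup v j ≡ true → i ≡ j
fewB⁻ (b ∷ v) h zero zero p q = refl
fewB⁻ (true ∷ v) h zero (suc j) p q = ⊥-elim (noneB⁻ v h j q)
fewB⁻ (true ∷ v) h (suc i) _ p q = ⊥-elim (noneB⁻ v h i p)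
fewB⁻ (false ∷ v) h (suc i) (suc j) p q = cong suc (fewB⁻ v h i j p q)

fullB⁻ : ∀ {m} (v : Vec Bool m) → fullB v ≡ true → ∀ i → lookup v i ≡ true
fullB⁻ (b ∷ v) h zero = proj₁ (∧⁻ h)
fullB⁻ (b ∷ v) h (suc i) = fullB⁻ v (proj₂ (∧⁻ {b} h)) i

opaque
  indecB : ∀ {m} → Rows m → Bool
  indecB {m} R = allVec m λ I → fewB I ∨ fullB I ∨ not (moduleB (mat R) I)

  indecB-sound : ∀ {n m} (T : Tournament n) {vs : Vec (Fin n) m} → Distinct vs →
    indecB (rowsOf T vs) ≡ true → Prime T (setOf vs)
  indecB-sound {n} {m} T {vs} dis e f (f⊆ , unif) x y x≢y fx fy z uz with setOf⁻ vs (f⊆ x fx) | setOf⁻ vs (f⊆ y fy)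
  ... | i , refl | j , refl = triv (∨⁻ {fewB I} (allVec⁻ m e I))
    where
    I : Vec Bool m
    I = map f vs
    I≡ : ∀ k → lookup I k ≡ f (lookup vs k)
    I≡ k = lookup-map k f vs
    isModule : moduleB (mat (rowsOf T vs)) I ≡ true
    isModule = allF⁺ one
      where
      one : ∀ k → (lookup I k ∨ (allF λ l → lookup I l ⇒ mat (rowsOf T vs) k l) ∨ (allF λ l → lookup I l ⇒ not (mat (rowsOf T vs) k l))) ≡ true
      one k with bool-case (lookup I k) | bool-case (arc T (lookup vs k) (lookup vs i))
      ... | inj₁ p | _ = ∨⁺ˡ p
      ... | inj₂ p | inj₁ q = ∨⁺ʳ {lookup I k} (∨⁺ˡ (allF⁺ λ l → imp l))
        where
        imp : ∀ l → (lookup I l ⇒ mat (rowsOf T vs) k l) ≡ true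
        imp l with lookup I l in eq
        ... | false = refl
        ... | true = trans (mat-rowsOf T dis k l) (trans (unif (lookup vs k) (lookup vs l) (lookup vs i) (setOf⁺ vs k) (trans (sym (I≡ k)) p) (trans (sym (I≡ l)) eq) fx) q)
      ... | inj₂ p | inj₂ q = ∨⁺ʳ {lookup I k} (∨⁺ʳ {allF λ l → lookup I l ⇒ mat (rowsOf T vs) k l} (allF⁺ λ l → imp l))
        where
        imp : ∀ l → (lookup I l ⇒ not (mat (rowsOf T vs) k l)) ≡ true
        imp l with lookup I l in eq
        ... | false = refl
        ... | true = cong not (trans (mat-rowsOf T dis k l) (trans (unif (lookup vs k) (lookup vs l) (lookup vs i) (setOf⁺ vs k) (trans (sym (I≡ k)) p) (trans (sym (I≡ l)) eq) fx) q))
    triv : fewB I ≡ true ⊎ (fullB I ∨ not (moduleB (mat (rowsOf T vs)) I)) ≡ true → f z ≡ true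
    triv (inj₁ h) = ⊥-elim (x≢y (cong (lookup vs) (fewB⁻ I h i j (trans (I≡ i) fx) (trans (I≡ j) fy))))
    triv (inj₂ h) with ∨⁻ {fullB I} h
    ... | inj₂ h' = true≢false h' (cong not isModule)
    ... | inj₁ h' with setOf⁻ vs uz
    ...   | k , refl = trans (sym (I≡ k)) (fullB⁻ I h' k)

indecB-complete : ∀ {n m} (T : Tournament n) {vs : Vec (Fin n) m} → Distinct vs → Prime T (setOf vs) →
  ∀ I → moduleB (mat (rowsOf T vs)) I ≡ true → ∀ i j → i ≢ j → lookup I i ≡ true → lookup I j ≡ true →
  ∀ k → lookup I k ≡ true
indecB-complete {n} {m} T {vs} dis pr I md i j i≢j pi pj k =
  f⁻ k (pr f (sub , unif) (lookup vs i) (lookup vs j) (λ e → i≢j (lookup-injective dis i j e)) (f⁺ i pi) (f⁺ j pj) (lookup vs k) (setOf⁺ vs k))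
  where
  f : VSet n
  f v = anyF λ l → lookup I l ∧ (v == lookup vs l)
  f⁺ : ∀ l → lookup I l ≡ true → f (lookup vs l) ≡ true
  f⁺ l p = anyF⁺ l (∧⁺ p (==-refl (lookup vs l)))
  index : ∀ v → f v ≡ true → ∃ λ l → lookup I l ≡ true × v ≡ lookup vs l
  index v h with anyF⁻ h
  ... | l , h' with ∧⁻ {lookup I l} h'
  ...   | p , q = l , p , ==⁻ v (lookup vs l) q
  f⁻ : ∀ l → f (lookup vs l) ≡ true → lookup I l ≡ true
  f⁻ l h with index (lookup vs l) h
  ... | l' , p , e rewrite lookup-injective dis l l' e = p
  sub : f ⊆ᵛ setOf vs
  sub v h with index v h
  ... | l , _ , refl = setOf⁺ vs l
  unif : ∀ x y z → setOf vs x ≡ true → f x ≡ false → f y ≡ true → f z ≡ true → arc T x y ≡ arc T x z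
  unif x y z ux fx fy fz with setOf⁻ vs ux | index y fy | index z fz
  ... | l , refl | l₁ , p₁ , refl | l₂ , p₂ , refl with ∨⁻ {lookup I l} (allF⁻ md l)
  ...   | inj₁ q = true≢false (f⁺ l q) fx
  ...   | inj₂ q with ∨⁻ {allF λ j → lookup I j ⇒ mat (rowsOf T vs) l j} q
  ...     | inj₁ h = trans (sym (mat-rowsOf T dis l l₁)) (trans (trans (⇒⁻ (allF⁻ h l₁) p₁) (sym (⇒⁻ (allF⁻ h l₂) p₂))) (mat-rowsOf T dis l l₂))
  ...     | inj₂ h = trans (sym (mat-rowsOf T dis l l₁)) (trans (not-cong⁻ (trans (⇒⁻ (allF⁻ h l₁) p₁) (sym (⇒⁻ (allF⁻ h l₂) p₂)))) (mat-rowsOf T dis l l₂))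

-- Types of vertices outside a 3-cycle and the outside graph

-- Vertices outside the 3-cycle a → b → c → a are typed by their arcs to (a , b , c).

Ty : Set
Ty = Vec Bool 3

-- `out` stands for X⁻ ∪ X⁺ and `at u` for X(u). There is no block of extensions of X because no
-- tournament on four vertices is indecomposable; accordingly `block` covers all eight types.
data Block : Set where
  out : Block
  at  : Fin 3 → Block

block : Ty → Block
block (false ∷ false ∷ false ∷ []) = out
block (true ∷ true ∷ true ∷ []) = out
block (false ∷ true ∷ false ∷ []) = at 0F
block (true ∷ true ∷ false ∷ []) = at 0F
block (false ∷ false ∷ true ∷ []) = at 1F
block (false ∷ true ∷ true ∷ []) = at 1F
block (true ∷ false ∷ false ∷ []) = at 2F
block (true ∷ false ∷ true ∷ []) = at 2F

-- def s t: an s-vertex that behaves towards a t-vertex like its twin in the cycle does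
-- (or, for vertices of X⁻ and X⁺, like they do towards the cycle) points to it.
def : Ty → Ty → Bool
def s t with block s
... | out = lookup s 0F
... | at u = not (lookup t u)

_≡ᴮ_ : Block → Block → Bool
out ≡ᴮ out = true
out ≡ᴮ at _ = false
at _ ≡ᴮ out = false
at u ≡ᴮ at v = u == v

_xor_ : Bool → Bool → Bool
true xor b = not b
false xor b = b

-- The outside graph read off from types: different blocks and an arc against the default. That this
-- agrees with `OEdge` is shown by `five-check` in one direction and by `OEdge⇒~` in the other.
adj : Ty → Ty → Bool → Bool
adj s t b = not (block s ≡ᴮ block t) ∧ (b xor def s t)

_≡ᵗ_ : ∀ {m} → Vec Bool m → Vec Bool m → Bool
[] ≡ᵗ [] = true
(a ∷ s) ≡ᵗ (b ∷ t) = not (a xor b) ∧ (s ≡ᵗ t)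

base : Rows 3
base = [] ▷ [] ▷ (true ∷ []) ▷ (true ∷ false ∷ [])

allTy : (Ty → Bool) → Bool
allTy = allVec 3

allBool : (Bool → Bool) → Bool
allBool f = f true ∧ f false

allBool⁻ : ∀ {f} → allBool f ≡ true → ∀ b → f b ≡ true
allBool⁻ p true = proj₁ (∧⁻ p)
allBool⁻ {f} p false = proj₂ (∧⁻ {f true} p)

-- `sound` applied to `refl` turns an exhaustive evaluation by the type checker into a universally
-- quantified fact.
record Finite (A : Set) : Set where
  field
    every : (A → Bool) → Bool
    sound : ∀ f → every f ≡ true → ∀ x → f x ≡ true

open Finite public

bits : ∀ m → Finite (Vec Bool m)
bits m = record { every = allVec m ; sound = λ f → allVec⁻ m {f} }

bit : Finite Bool
bit = record { every = allBool ; sound = λ f → allBool⁻ {f} }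

index : ∀ m → Finite (Fin m)
index m = record { every = allF ; sound = λ f → allF⁻ {m} {f} }

infixr 4 _⊗_
_⊗_ : ∀ {A B} → Finite A → Finite B → Finite (A × B)
A ⊗ B = record
  { every = λ f → every A λ x → every B λ y → f (x , y)
  ; sound = λ f p (x , y) → sound B (λ y → f (x , y)) (sound A (λ x → every B λ y → f (x , y)) p x) y }

ty : Finite Ty
ty = bits 3

-- The vertices x, y, z have types `s`, `t`, `r`. If x has neighbours y and z of different types,
-- then X with the three vertices is indecomposable, whatever the arc between y and z.
L1-body : Ty × Ty × Ty × Bool × Bool × Bool → Bool
L1-body (s , t , r , xy , xz , yz) = not (t ≡ᵗ r) ⇒ adj s t xy ⇒ adj s r xz ⇒
  indecB (base ▷ s ▷ (not xy ∷ t) ▷ (not yz ∷ not xz ∷ r))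

opaque
  unfolding indecB

  L1-check : ∀ p → L1-body p ≡ true
  L1-check = sound (ty ⊗ ty ⊗ ty ⊗ bit ⊗ bit ⊗ bit) L1-body refl

-- Here z is adjacent neither to x nor to y, and its arc to x is not the default one, which is
-- possible only inside a block. The edge between x and y then makes the six vertices
-- indecomposable.
L2-body : Ty × Ty × Ty × Bool × Bool × Bool → Bool
L2-body (s , t , r , xy , zy , zx) = adj s t xy ⇒ not (adj r t zy) ⇒ not (adj r s zx) ⇒ (zx xor def r s) ⇒
  indecB (base ▷ s ▷ (not xy ∷ t) ▷ (zy ∷ zx ∷ r))

opaque
  unfolding indecB

  L2-check : ∀ p → L2-body p ≡ true
  L2-check = sound (ty ⊗ ty ⊗ ty ⊗ bit ⊗ bit ⊗ bit) L2-body refl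

≡ᵗ⁻ : ∀ {m} (s t : Vec Bool m) → (s ≡ᵗ t) ≡ true → s ≡ t
≡ᵗ⁻ [] [] _ = refl
≡ᵗ⁻ (true ∷ s) (true ∷ t) p = cong (true ∷_) (≡ᵗ⁻ s t p)
≡ᵗ⁻ (false ∷ s) (false ∷ t) p = cong (false ∷_) (≡ᵗ⁻ s t p)

≡ᵗ-refl : ∀ {m} (s : Vec Bool m) → (s ≡ᵗ s) ≡ true
≡ᵗ-refl [] = refl
≡ᵗ-refl (true ∷ s) = ≡ᵗ-refl s
≡ᵗ-refl (false ∷ s) = ≡ᵗ-refl s

xor-false : ∀ {a b} → (a xor b) ≡ false → a ≡ b
xor-false {true} {true} _ = refl
xor-false {false} {false} _ = refl

xor-≡ : ∀ {a b} → a ≡ b → (a xor b) ≡ false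
xor-≡ {true} refl = refl
xor-≡ {false} refl = refl

xor-true : ∀ {a b} → (a xor b) ≡ true → not a ≡ b
xor-true {true} {false} _ = refl
xor-true {false} {true} _ = refl

≡ᴮ-refl : ∀ s → (s ≡ᴮ s) ≡ true
≡ᴮ-refl out = refl
≡ᴮ-refl (at u) = ==-refl u

≡ᴮ⁻ : ∀ s t → (s ≡ᴮ t) ≡ true → s ≡ t
≡ᴮ⁻ out out _ = refl
≡ᴮ⁻ (at u) (at v) p = cong at (==⁻ u v p)

def-at : ∀ s t {u} → block s ≡ at u → def s t ≡ not (lookup t u)
def-at s t e with block s
def-at s t refl | at u = refl

def-out : ∀ s t → block s ≡ out → def s t ≡ lookup s 0F
def-out s t e with block s
def-out s t refl | out = refl

at-row : ∀ s u i → block s ≡ at u → i ≢ u → lookup s i ≡ mat base u i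
at-row s u i e i≢u = xor-false (not-true⁻ (⇒⁻ (⇒⁻ (sound (ty ⊗ index 3 ⊗ index 3)
    (λ (s , u , i) → block s ≡ᴮ at u ⇒ not (i == u) ⇒ not (lookup s i xor mat base u i)) refl (s , u , i))
    (subst (λ z → (z ≡ᴮ at u) ≡ true) (sym e) (==-refl u))) (not⁺ (≢⇒==false i≢u))))

out-row : ∀ s i → block s ≡ out → lookup s i ≡ lookup s 0F
out-row s i e = xor-false (not-true⁻ (⇒⁻ (sound (ty ⊗ index 3)
    (λ (s , i) → block s ≡ᴮ out ⇒ not (lookup s i xor lookup s 0F)) refl (s , i))
    (subst (λ z → (z ≡ᴮ out) ≡ true) (sym e) refl)))

adj-sym : ∀ s t b → adj s t b ≡ adj t s (not b)
adj-sym s t b = xor-false (not-true⁻ (sound (ty ⊗ ty ⊗ bit) (λ (s , t , b) → not (adj s t b xor adj t s (not b))) refl (s , t , b)))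

adj-diff : ∀ s t b → adj s t b ≡ true → (block s ≡ᴮ block t) ≡ false
adj-diff s t b e with block s ≡ᴮ block t
... | false = refl

adj-false : ∀ s t b → (block s ≡ᴮ block t) ≡ false → adj s t b ≡ false → b ≡ def s t
adj-false s t b d e rewrite d = xor-false e

adj-same : ∀ s t b → (block s ≡ᴮ block t) ≡ true → adj s t b ≡ false
adj-same s t b e rewrite e = refl

module Cycle {n : ℕ} (T : Tournament n) (a b c : Fin n)
  (ab : T ∶ a ⟶ b) (bc : T ∶ b ⟶ c) (ca : T ∶ c ⟶ a) where

  X : Vec (Fin n) 3
  X = a ∷ b ∷ c ∷ []

  Xˢ : VSet n
  Xˢ = setOf X

  a≢b : a ≢ b
  a≢b = arc⇒≢ T ab
  b≢c : b ≢ c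
  b≢c = arc⇒≢ T bc
  a≢c : a ≢ c
  a≢c = ≢-sym (arc⇒≢ T ca)

  X-distinct : Distinct X
  X-distinct = (a≢b ∷ a≢c ∷ []) ∷ (b≢c ∷ []) ∷ [] ∷ []

  X-rows : rowsOf T X ≡ base
  X-rows = cong₂ _▷_ (cong ([] ▷ [] ▷_) (cong (_∷ []) bc)) (cong₂ (λ p q → p ∷ q ∷ []) ab (asym T c a ca))

  X-arc : ∀ i j → arc T (lookup X i) (lookup X j) ≡ mat base i j
  X-arc i j = trans (sym (mat-rowsOf T X-distinct i j)) (cong (λ R → mat R i j) X-rows)

  Outside : Fin n → Set
  Outside x = All (x ≢_) X

  outᵇ : VSet n
  outᵇ x = not (Xˢ x)

  outside⁻ : ∀ x → outᵇ x ≡ true → Outside x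
  outside⁻ x p = setOf-∉⁻ X (not-cong⁻ p)

  outside⁺ : ∀ {x} → Outside x → outᵇ x ≡ true
  outside⁺ o = cong not (setOf-∉ X o)

  in-or-out : ∀ x → (∃ λ i → lookup X i ≡ x) ⊎ Outside x
  in-or-out x with bool-case (Xˢ x)
  ... | inj₁ p = inj₁ (setOf⁻ X p)
  ... | inj₂ p = inj₂ (setOf-∉⁻ X p)

  τ : Fin n → Ty
  τ x = map (arc T x) X

  τ-lookup : ∀ x i → lookup (τ x) i ≡ arc T x (lookup X i)
  τ-lookup x i = lookup-map i (arc T x) X

  infix 5 _~_
  _~_ : Fin n → Fin n → Bool
  x ~ y = adj (τ x) (τ y) (arc T x y)

  ~⇒≢ : ∀ {x y} → x ~ y ≡ true → x ≢ y
  ~⇒≢ {x} p refl = true≢false (≡ᴮ-refl (block (τ x))) (adj-diff (τ x) (τ x) (arc T x x) p)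

  ~-sym : ∀ x y → x ~ y ≡ y ~ x
  ~-sym x y with x ≟ y
  ... | yes refl = refl
  ... | no x≢y = trans (adj-sym (τ x) (τ y) (arc T x y)) (cong (adj (τ y) (τ x)) (sym (flip-arc T x≢y)))

  ~-sym⁺ : ∀ {x y r} → x ~ y ≡ r → y ~ x ≡ r
  ~-sym⁺ {x} {y} e = trans (~-sym y x) e

  ~-same : ∀ {x y} → block (τ x) ≡ block (τ y) → x ~ y ≡ false
  ~-same {x} {y} e = adj-same (τ x) (τ y) (arc T x y) (subst (λ z → (z ≡ᴮ block (τ y)) ≡ true) (sym e) (≡ᴮ-refl (block (τ y))))

  block-dec : ∀ x y → block (τ x) ≡ block (τ y) ⊎ (block (τ x) ≡ᴮ block (τ y)) ≡ false
  block-dec x y with bool-case (block (τ x) ≡ᴮ block (τ y))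
  ... | inj₁ p = inj₁ (≡ᴮ⁻ _ _ p)
  ... | inj₂ p = inj₂ p

  distinct₆ : ∀ {x y z} → Outside x → Outside y → Outside z → x ≢ y → x ≢ z → y ≢ z → Distinct (z ∷ y ∷ x ∷ X)
  distinct₆ ox oy oz xy xz yz = (≢-sym yz ∷ ≢-sym xz ∷ oz) ∷ (≢-sym xy ∷ oy) ∷ ox ∷ X-distinct

  NoSix : Set
  NoSix = ∀ x y z → Outside x → Outside y → Outside z → x ≢ y → x ≢ z → y ≢ z → ¬ Prime T (setOf (z ∷ y ∷ x ∷ X))

  -- All that the structure theory takes from `NoSix`. The second rule has content when `z` and `x`
  -- share a block, where non-adjacency alone leaves their arc open.
  record Local : Set where
    field
      l1 : ∀ {x y z} → Outside x → Outside y → Outside z → x ~ y ≡ true → x ~ z ≡ true → τ y ≡ τ z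
      l2 : ∀ {x y z} → Outside x → Outside y → Outside z → x ~ y ≡ true → z ~ y ≡ false → z ~ x ≡ false → z ≢ x →
        arc T z x ≡ def (τ z) (τ x)

  six-rows : ∀ x y z → rowsOf T (z ∷ y ∷ x ∷ X) ≡ base ▷ τ x ▷ (arc T y x ∷ τ y) ▷ (arc T z y ∷ arc T z x ∷ τ z)
  six-rows x y z = cong (λ R → R ▷ τ x ▷ (arc T y x ∷ τ y) ▷ (arc T z y ∷ arc T z x ∷ τ z)) X-rows

  noSix⇒Local : NoSix → Local
  noSix⇒Local no6 = record { l1 = l1 ; l2 = l2 }
    where
    l1 : ∀ {x y z} → Outside x → Outside y → Outside z → x ~ y ≡ true → x ~ z ≡ true → τ y ≡ τ z
    l1 {x} {y} {z} ox oy oz xy xz with bool-case (τ y ≡ᵗ τ z)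
    ... | inj₁ p = ≡ᵗ⁻ (τ y) (τ z) p
    ... | inj₂ p = ⊥-elim (no6 x y z ox oy oz (~⇒≢ xy) (~⇒≢ xz) y≢z
        (indecB-sound T (distinct₆ ox oy oz (~⇒≢ xy) (~⇒≢ xz) y≢z)
          (trans (cong indecB (trans (six-rows x y z) rows)) chk)))
      where
      y≢z : y ≢ z
      y≢z refl = true≢false (≡ᵗ-refl (τ y)) p
      rows : base ▷ τ x ▷ (arc T y x ∷ τ y) ▷ (arc T z y ∷ arc T z x ∷ τ z) ≡
             base ▷ τ x ▷ (not (arc T x y) ∷ τ y) ▷ (not (arc T y z) ∷ not (arc T x z) ∷ τ z)
      rows rewrite flip-arc T (~⇒≢ xy) | flip-arc T (~⇒≢ xz) | flip-arc T y≢z = refl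
      chk : indecB (base ▷ τ x ▷ (not (arc T x y) ∷ τ y) ▷ (not (arc T y z) ∷ not (arc T x z) ∷ τ z)) ≡ true
      chk = ⇒⁻ {x ~ z} (⇒⁻ {x ~ y} (⇒⁻ {not (τ y ≡ᵗ τ z)} (L1-check (τ x , τ y , τ z , arc T x y , arc T x z , arc T y z)) (cong not p)) xy) xz
    l2 : ∀ {x y z} → Outside x → Outside y → Outside z → x ~ y ≡ true → z ~ y ≡ false → z ~ x ≡ false → z ≢ x →
      arc T z x ≡ def (τ z) (τ x)
    l2 {x} {y} {z} ox oy oz xy zy zx z≢x with bool-case (arc T z x xor def (τ z) (τ x))
    ... | inj₂ p = xor-false p
    ... | inj₁ p = ⊥-elim (no6 x y z ox oy oz (~⇒≢ xy) (≢-sym z≢x) y≢z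
        (indecB-sound T (distinct₆ ox oy oz (~⇒≢ xy) (≢-sym z≢x) y≢z)
          (trans (cong indecB (trans (six-rows x y z) rows)) chk)))
      where
      y≢z : y ≢ z
      y≢z refl = true≢false (~-sym⁺ {x} {y} xy) zx
      rows : base ▷ τ x ▷ (arc T y x ∷ τ y) ▷ (arc T z y ∷ arc T z x ∷ τ z) ≡
             base ▷ τ x ▷ (not (arc T x y) ∷ τ y) ▷ (arc T z y ∷ arc T z x ∷ τ z)
      rows rewrite flip-arc T (~⇒≢ xy) = refl
      chk : indecB (base ▷ τ x ▷ (not (arc T x y) ∷ τ y) ▷ (arc T z y ∷ arc T z x ∷ τ z)) ≡ true
      chk = ⇒⁻ {arc T z x xor def (τ z) (τ x)} (⇒⁻ {not (z ~ x)} (⇒⁻ {not (z ~ y)} (⇒⁻ {x ~ y} (L2-check (τ x , τ y , τ z , arc T x y , arc T z y , arc T z x)) xy) (not⁺ zy)) (not⁺ zx)) p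

-- Nested neighbourhoods, no isolated vertices, no two vertices alike

module Structure {n : ℕ} (T : Tournament n) (a b c : Fin n)
  (ab : T ∶ a ⟶ b) (bc : T ∶ b ⟶ c) (ca : T ∶ c ⟶ a) (loc : Cycle.Local T a b c ab bc ca) where

  open Cycle T a b c ab bc ca
  open Local loc

  -- If each of `x`, `x'` had a neighbour that the other lacks, `l2` would apply along both edges
  -- and give the arcs `x' → x` and `x → x'` the same truth value.
  nested : ∀ {x x' y y'} → Outside x → Outside x' → Outside y → Outside y' → τ x ≡ τ x' →
    x ~ y ≡ true → x' ~ y ≡ false → x' ~ y' ≡ true → x ~ y' ≡ true
  nested {x} {x'} {y} {y'} ox ox' oy oy' e xy x'y x'y' with bool-case (x ~ y')
  ... | inj₁ p = p
  ... | inj₂ p = ⊥-elim (loop (arc T x x') (def (τ x) (τ x)) eq₂ (trans (sym (flip-arc T x≢x')) eq₁))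
    where
    x≢x' : x ≢ x'
    x≢x' refl = true≢false xy x'y
    eq₁ : arc T x' x ≡ def (τ x) (τ x)
    eq₁ = trans (l2 ox oy ox' xy x'y (~-same {x'} {x} (cong block (sym e))) (≢-sym x≢x')) (cong (λ t → def t (τ x)) (sym e))
    eq₂ : arc T x x' ≡ def (τ x) (τ x)
    eq₂ = trans (l2 ox' oy' ox x'y' p (~-same {x} {x'} (cong block e)) x≢x') (cong (def (τ x)) (sym e))
    loop : ∀ p q → p ≡ q → not p ≡ q → ⊥
    loop true true _ ()
    loop false false _ ()

  -- By nestedness one of the two vertices is adjacent to both `y` and `y'`, and `l1` applies there.
  -- Hence the edges of the outside graph define a matching on types.
  partner-type : ∀ {x x' y y'} → Outside x → Outside x' → Outside y → Outside y' → τ x ≡ τ x' →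
    x ~ y ≡ true → x' ~ y' ≡ true → τ y ≡ τ y'
  partner-type {x} {x'} {y} {y'} ox ox' oy oy' e xy x'y' with bool-case (x' ~ y)
  ... | inj₁ p = l1 ox' oy oy' p x'y'
  ... | inj₂ p = l1 ox oy oy' xy (nested ox ox' oy oy' e xy p x'y')

  -- The set `W` is V for T itself, V without a vertex in `outside-critical`, and X with two
  -- vertices in `OEdge⇒~`.
  module Within (W : VSet n) (X⊆W : ∀ i → W (lookup X i) ≡ true) (prW : Prime T W) where

    Nbr : Fin n → Fin n → Set
    Nbr x y = W y ≡ true × outᵇ y ≡ true × x ~ y ≡ true

    nbr? : ∀ x → Dec (∃ (Nbr x))
    nbr? x = any? λ y → (W y ≟ᴮ true) ×-dec ((outᵇ y ≟ᴮ true) ×-dec (x ~ y ≟ᴮ true))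

    isoᵇ : VSet n
    isoᵇ x = (outᵇ x ∧ W x) ∧ not (does (nbr? x))

    isoᵇ⁻ : ∀ x → isoᵇ x ≡ true → Outside x × W x ≡ true × ¬ ∃ (Nbr x)
    isoᵇ⁻ x p with ∧⁻ {outᵇ x ∧ W x} p
    ... | q , r with ∧⁻ {outᵇ x} q
    ...   | o , w = outside⁻ x o , w , undoes⁻ (nbr? x) (not-true⁻ r)

    iso-def : ∀ {z w} → isoᵇ z ≡ true → Outside w → W w ≡ true → z ≢ w →
      (block (τ z) ≡ block (τ w) → ∃ (Nbr w)) → arc T z w ≡ def (τ z) (τ w)
    iso-def {z} {w} iz ow Ww z≢w h with isoᵇ⁻ z iz
    ... | oz , Wz , none = go (block-dec z w)
      where
      z≁ : ∀ y → Outside y → W y ≡ true → z ~ y ≡ false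
      z≁ y oy Wy = refute (λ p → none (y , Wy , outside⁺ oy , p))
      go : block (τ z) ≡ block (τ w) ⊎ (block (τ z) ≡ᴮ block (τ w)) ≡ false → arc T z w ≡ def (τ z) (τ w)
      go (inj₂ d) = adj-false (τ z) (τ w) (arc T z w) d (z≁ w ow Ww)
      go (inj₁ e) with h e
      ... | y , Wy , oy , wy = l2 ow (outside⁻ y oy) oz wy (z≁ y (outside⁻ y oy) Wy) (z≁ w ow Ww) z≢w

    -- An isolated vertex follows the default towards everything except possibly other isolated
    -- vertices of its block. So the isolated vertices in block `at u` together with the cycle
    -- vertex `u` form an interval of T[W], and so does `W` without its isolated vertices in block
    -- `out`.
    not-isolated : ∀ x → Outside x → W x ≡ true → ∃ (Nbr x)
    not-isolated x ox Wx with nbr? x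
    ... | yes p = p
    ... | no none = ⊥-elim (by-block (block (τ x)) refl)
      where
      ix : isoᵇ x ≡ true
      ix = ∧⁺ (∧⁺ (outside⁺ ox) Wx) (cong not (dec-false (nbr? x) none))
      has-nbr : ∀ v → Outside v → W v ≡ true → isoᵇ v ≡ false → ∃ (Nbr v)
      has-nbr v ov Wv q with nbr? v
      ... | yes p = p
      ... | no none' = true≢false (∧⁺ {outᵇ v ∧ W v} (∧⁺ (outside⁺ ov) Wv) refl) q
      by-block : ∀ k → block (τ x) ≡ k → ⊥
      by-block out e = true≢false (prW f (sub , unif) a b a≢b (mem 0F) (mem 1F) x Wx)
          (cong₂ _∧_ Wx (cong not (∧⁺ ix (subst (λ k → (k ≡ᴮ out) ≡ true) (sym e) refl))))
        where
        g f : VSet n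
        g v = isoᵇ v ∧ (block (τ v) ≡ᴮ out)
        f v = W v ∧ not (g v)
        sub : f ⊆ᵛ W
        sub v p = proj₁ (∧⁻ p)
        mem : ∀ i → f (lookup X i) ≡ true
        mem i = ∧⁺ (X⊆W i) (cong not (cong (λ p → ((not p ∧ W (lookup X i)) ∧ not (does (nbr? (lookup X i)))) ∧ (block (τ (lookup X i)) ≡ᴮ out)) (setOf⁺ X i)))
        val : ∀ v w → W v ≡ true → f v ≡ false → f w ≡ true → arc T v w ≡ lookup (τ v) 0F
        val v w Wv fv fw with ∧⁻ {W w} fw
        ... | Ww , gw with ∧⁻ {isoᵇ v} (not-cong⁻ (trans (sym (cong (_∧ not (g v)) Wv)) fv))
        ...   | iv , bv with in-or-out w
        ...     | inj₁ (i , refl) = trans (sym (τ-lookup v i)) (out-row (τ v) i (≡ᴮ⁻ _ _ bv))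
        ...     | inj₂ ow = trans (iso-def iv ow Ww v≢w nb) (def-out (τ v) (τ w) (≡ᴮ⁻ _ _ bv))
          where
          v≢w : v ≢ w
          v≢w refl = true≢false (∧⁺ iv bv) (not-true⁻ gw)
          nb : block (τ v) ≡ block (τ w) → ∃ (Nbr w)
          nb e' = has-nbr w ow Ww ([ (λ iw → true≢false (∧⁺ {isoᵇ w} iw (subst (λ k → (k ≡ᴮ out) ≡ true) e' bv)) (not-true⁻ gw)) , id ]′ (bool-case (isoᵇ w)))
        unif : ∀ v w w' → W v ≡ true → f v ≡ false → f w ≡ true → f w' ≡ true → arc T v w ≡ arc T v w'
        unif v w w' Wv fv fw fw' = trans (val v w Wv fv fw) (sym (val v w' Wv fv fw'))
      by-block (at u) e = true≢false (prW f (sub , unif) (lookup X u) x (≢-sym (lookup⁺ ox u))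
            (∨⁺ˡ (==-refl (lookup X u))) (∨⁺ʳ {x == lookup X u} (∧⁺ ix (subst (λ k → (k ≡ᴮ at u) ≡ true) (sym e) (==-refl u))))
            (lookup X (other u)) (X⊆W (other u))) (∨-false⁺ (≢⇒==false λ e' → other≢ u (lookup-injective X-distinct _ _ e')) (g-X (other u)))
        where
        other : Fin 3 → Fin 3
        other zero = 1F
        other (suc _) = 0F
        other≢ : ∀ u → other u ≢ u
        other≢ zero ()
        other≢ (suc _) ()
        g f : VSet n
        g v = isoᵇ v ∧ (block (τ v) ≡ᴮ at u)
        f v = (v == lookup X u) ∨ g v
        g-X : ∀ i → g (lookup X i) ≡ false
        g-X i = cong (λ p → ((not p ∧ W (lookup X i)) ∧ not (does (nbr? (lookup X i)))) ∧ (block (τ (lookup X i)) ≡ᴮ at u)) (setOf⁺ X i)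
        sub : f ⊆ᵛ W
        sub v p with ∨⁻ {v == lookup X u} p
        ... | inj₁ q = subst (λ z → W z ≡ true) (sym (==⁻ v (lookup X u) q)) (X⊆W u)
        ... | inj₂ q = proj₁ (proj₂ (isoᵇ⁻ v (proj₁ (∧⁻ q))))
        val : ∀ v w → W v ≡ true → f v ≡ false → f w ≡ true → arc T v w ≡ arc T v (lookup X u)
        val v w Wv fv fw with ∨-false⁻ {v == lookup X u} fv | ∨⁻ {w == lookup X u} fw
        ... | _ | inj₁ q = cong (arc T v) (==⁻ w (lookup X u) q)
        ... | v≢u , gv | inj₂ gw with ∧⁻ {isoᵇ w} gw
        ...   | iw , bw with in-or-out v
        ...     | inj₁ (i , refl) = flip-cong T (lookup⁺ (proj₁ (isoᵇ⁻ w iw)) i) (≢-sym i≢u)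
                    (trans (sym (τ-lookup w i)) (trans (at-row (τ w) u i (≡ᴮ⁻ _ _ bw) (λ e' → i≢u (cong (lookup X) e'))) (sym (X-arc u i))))
          where
          i≢u : lookup X i ≢ lookup X u
          i≢u = undoes⁻ (lookup X i ≟ lookup X u) v≢u
        ...     | inj₂ ov = trans (flip-arc T w≢v) (trans (cong not (trans (iso-def iw ov Wv w≢v nb) (def-at (τ w) (τ v) (≡ᴮ⁻ _ _ bw))))
                    (trans (not-involutive _) (τ-lookup v u)))
          where
          w≢v : w ≢ v
          w≢v refl = true≢false gw gv
          nb : block (τ w) ≡ block (τ v) → ∃ (Nbr v)
          nb e' = has-nbr v ov Wv ([ (λ iv → true≢false (∧⁺ {isoᵇ v} iv (subst (λ k → (k ≡ᴮ at u) ≡ true) e' bw)) gv) , id ]′ (bool-case (isoᵇ v)))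
        unif : ∀ v w w' → W v ≡ true → f v ≡ false → f w ≡ true → f w' ≡ true → arc T v w ≡ arc T v w'
        unif v w w' Wv fv fw fw' = trans (val v w Wv fv fw) (sym (val v w' Wv fv fw'))

    -- Otherwise the vertices with the type and the neighbourhood of x would form an interval.
    distinguished : ∀ {x x'} → Outside x → Outside x' → W x ≡ true → W x' ≡ true → τ x ≡ τ x' → x ≢ x' →
      ∃ λ y → W y ≡ true × Outside y × x ~ y ≢ x' ~ y
    distinguished {x} {x'} ox ox' Wx Wx' e x≢x' with any? (λ y → (W y ≟ᴮ true) ×-dec ((outᵇ y ≟ᴮ true) ×-dec ¬? (x ~ y ≟ᴮ x' ~ y)))
    ... | yes (y , Wy , oy , h) = y , Wy , outside⁻ y oy , h
    ... | no none = ⊥-elim (true≢false (prW f (sub , unif) x x' x≢x' fx fx' a (X⊆W 0F)) fa)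
      where
      sameN? : ∀ v → Dec (∀ y → W y ≡ true → outᵇ y ≡ true → v ~ y ≡ x ~ y)
      sameN? v = all? λ y → (W y ≟ᴮ true) →-dec ((outᵇ y ≟ᴮ true) →-dec (v ~ y ≟ᴮ x ~ y))
      f : VSet n
      f v = ((W v ∧ outᵇ v) ∧ (τ v ≡ᵗ τ x)) ∧ does (sameN? v)
      f⁻ : ∀ v → f v ≡ true → W v ≡ true × Outside v × τ v ≡ τ x × (∀ y → W y ≡ true → outᵇ y ≡ true → v ~ y ≡ x ~ y)
      f⁻ v p with ∧⁻ {(W v ∧ outᵇ v) ∧ (τ v ≡ᵗ τ x)} p
      ... | p₁ , q with ∧⁻ {W v ∧ outᵇ v} p₁
      ...   | p₂ , r with ∧⁻ {W v} p₂
      ...     | s , t = s , outside⁻ v t , ≡ᵗ⁻ (τ v) (τ x) r , does⁻ (sameN? v) q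
      f⁺ : ∀ {v} → W v ≡ true → Outside v → τ v ≡ τ x → (∀ y → W y ≡ true → outᵇ y ≡ true → v ~ y ≡ x ~ y) → f v ≡ true
      f⁺ {v} p o e' h = ∧⁺ (∧⁺ (∧⁺ p (outside⁺ o)) (subst (λ t → (t ≡ᵗ τ x) ≡ true) (sym e') (≡ᵗ-refl (τ x)))) (does⁺ (sameN? v) h)
      fx : f x ≡ true
      fx = f⁺ Wx ox refl λ _ _ _ → refl
      fx' : f x' ≡ true
      fx' = f⁺ Wx' ox' (sym e) λ y Wy oy → case x ~ y ≟ᴮ x' ~ y of λ where
        (yes h) → sym h
        (no h) → ⊥-elim (none (y , Wy , oy , h))
      fa : f a ≡ false
      fa = cong (λ p → (p ∧ (τ a ≡ᵗ τ x)) ∧ does (sameN? a)) (trans (cong (λ p → W a ∧ not p) (setOf⁺ X 0F)) (cong (_∧ false) (X⊆W 0F)))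
      sub : f ⊆ᵛ W
      sub v p = proj₁ (f⁻ v p)
      val : ∀ v → W v ≡ true → f v ≡ false → ∃ λ r → ∀ w → f w ≡ true → arc T v w ≡ r
      val v Wv fv with in-or-out v
      ... | inj₁ (i , refl) = not (lookup (τ x) i) , λ w fw →
        trans (flip-arc T (lookup⁺ (proj₁ (proj₂ (f⁻ w fw))) i)) (cong not (trans (sym (τ-lookup w i)) (cong (λ t → lookup t i) (proj₁ (proj₂ (proj₂ (f⁻ w fw)))))))
      ... | inj₂ ov = by (block-dec x v)
        where
        w≢v : ∀ {w} → f w ≡ true → w ≢ v
        w≢v fw refl = true≢false fw fv
        -- `y` is adjacent either to `v` or to all vertices of `f`, not both; `l2` along such an
        -- edge makes the arcs between `v` and `f` default ones, which depend on types only.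
        split : ∀ y → W y ≡ true → Outside y → v ~ y ≢ x ~ y → block (τ x) ≡ block (τ v) → ∃ λ r → ∀ w → f w ≡ true → arc T v w ≡ r
        split y Wy oy ne be with bool-case (v ~ y)
        ... | inj₁ vy = not (def (τ x) (τ v)) , λ w fw → let (Ww , ow , te , h) = f⁻ w fw in
          trans (flip-arc T (w≢v fw)) (cong not (trans (l2 ov oy ow vy (trans (h y Wy (outside⁺ oy)) (¬-not λ p → ne (trans vy (sym p)))) (~-same {w} {v} (trans (cong block te) be)) (w≢v fw)) (cong (λ t → def t (τ v)) te)))
        ... | inj₂ vy = def (τ v) (τ x) , λ w fw → let (Ww , ow , te , h) = f⁻ w fw in
          trans (l2 ow oy ov (trans (h y Wy (outside⁺ oy)) ([ id , (λ p → ⊥-elim (ne (trans vy (sym p)))) ]′ (bool-case (x ~ y)))) vy (~-same {v} {w} (trans (sym be) (cong block (sym te)))) (≢-sym (w≢v fw))) (cong (def (τ v)) te)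
        by : block (τ x) ≡ block (τ v) ⊎ (block (τ x) ≡ᴮ block (τ v)) ≡ false → ∃ λ r → ∀ w → f w ≡ true → arc T v w ≡ r
        by (inj₂ d) = arc T v x , λ w fw → let (Ww , ow , te , h) = f⁻ w fw in
          flip-cong T (w≢v fw) (w≢v fx) (adj-inj (τ w) (τ x) (τ v) te d (h v Wv (outside⁺ ov)))
          where
          xor-cancel : ∀ p q r → (p xor r) ≡ (q xor r) → p ≡ q
          xor-cancel true true r _ = refl
          xor-cancel false false r _ = refl
          xor-cancel true false true ()
          xor-cancel true false false ()
          xor-cancel false true true ()
          xor-cancel false true false ()
          adj-inj : ∀ s s' t {p q} → s ≡ s' → (block s' ≡ᴮ block t) ≡ false → adj s t p ≡ adj s' t q → p ≡ q
          adj-inj s .s t {p} {q} refl d h rewrite d = xor-cancel p q (def s t) h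
        by (inj₁ be) with bool-case (τ v ≡ᵗ τ x)
        -- The types of `v` and `x` differ, so by `l1` a neighbour of `v` is not adjacent to `x` and
        -- serves as separating vertex.
        ... | inj₂ te with not-isolated v ov Wv
        ...   | y , Wy , oy , vy = split y Wy (outside⁻ y oy) (λ p → true≢false (subst (λ t → (t ≡ᵗ τ x) ≡ true)
                  (l1 (outside⁻ y oy) ox ov (~-sym⁺ {x} {y} (trans (sym p) vy)) (~-sym⁺ {v} {y} vy)) (≡ᵗ-refl (τ x))) te) be
        by (inj₁ be) | inj₁ te with any? (λ y → (W y ≟ᴮ true) ×-dec ((outᵇ y ≟ᴮ true) ×-dec ¬? (v ~ y ≟ᴮ x ~ y)))
        ...   | yes (y , Wy , oy , ne) = split y Wy (outside⁻ y oy) ne be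
        ...   | no none' = true≢false (f⁺ Wv ov (≡ᵗ⁻ (τ v) (τ x) te) λ y Wy oy → case v ~ y ≟ᴮ x ~ y of λ where
                  (yes h) → h
                  (no h) → ⊥-elim (none' (y , Wy , oy , h))) fv
      unif : ∀ v w w' → W v ≡ true → f v ≡ false → f w ≡ true → f w' ≡ true → arc T v w ≡ arc T v w'
      unif v w w' Wv fv fw fw' with val v Wv fv
      ... | r , h = trans (h w fw) (sym (h w' fw'))

-- Every vertex outside the cycle is critical

module Critical {n : ℕ} (T : Tournament n) (a b c : Fin n)
  (ab : T ∶ a ⟶ b) (bc : T ∶ b ⟶ c) (ca : T ∶ c ⟶ a) (loc : Cycle.Local T a b c ab bc ca) (prT : Prime T allᵛ) where

  open Cycle T a b c ab bc ca
  open Local loc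
  open Structure T a b c ab bc ca loc

  private
    module Whole = Within allᵛ (λ _ → refl) prT

  partner : ∀ x → Outside x → ∃ λ y → Outside y × x ~ y ≡ true
  partner x ox with Whole.not-isolated x ox refl
  ... | y , _ , oy , h = y , outside⁻ y oy , h

  nbrs non-nbrs : Fin n → VSet n
  nbrs y v = outᵇ v ∧ (y ~ v)
  non-nbrs y v = outᵇ v ∧ not (y ~ v)

  private
    nbrs-⊂ : ∀ {y y' x} → Outside y → Outside y' → Outside x → τ y ≡ τ y' → y ~ x ≡ true → y' ~ x ≡ false → count (nbrs y') < count (nbrs y)
    nbrs-⊂ {y} {y'} {x} oy oy' ox e yx y'x = count-strict
      (λ v p → let (ov , q) = ∧⁻ {outᵇ v} p in ∧⁺ ov (nested oy oy' ox (outside⁻ v ov) e yx y'x q)) x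
      (trans (cong (outᵇ x ∧_) y'x) (∧-zeroʳ (outᵇ x))) (∧⁺ (outside⁺ ox) yx)
    non-nbrs-⊂ : ∀ {y y' x} → Outside y → Outside y' → Outside x → τ y ≡ τ y' → y ~ x ≡ true → y' ~ x ≡ false → count (non-nbrs y) < count (non-nbrs y')
    non-nbrs-⊂ {y} {y'} {x} oy oy' ox e yx y'x = count-strict
      (λ v p → let (ov , q) = ∧⁻ {outᵇ v} p in ∧⁺ ov (not⁺ ([ (λ h → true≢false (nested oy oy' ox (outside⁻ v ov) e yx y'x h) (not-true⁻ q)) , id ]′ (bool-case (y' ~ v))))) x
      (trans (cong (λ p → outᵇ x ∧ not p) yx) (∧-zeroʳ (outᵇ x))) (∧⁺ (outside⁺ ox) (not⁺ y'x))

  -- If y is the neighbour of x with the smallest neighbourhood, then N(y) ∖ {x} is empty or the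
  -- neighbourhood of another vertex of the type of y, so y violates one of the conditions in T − x.
  outside-critical : ∀ x → Outside x → ¬ Prime T (allᵛ ∖ x)
  outside-critical x ox prx = start (partner x ox)
    where
    W : VSet n
    W = allᵛ ∖ x
    ≢⇒W : ∀ {v} → v ≢ x → W v ≡ true
    ≢⇒W {v} ne = not⁺ (≢⇒==false {x = v} {x} ne)
    W⇒≢ : ∀ {v} → W v ≡ true → v ≢ x
    W⇒≢ {v} p e = true≢false p (cong not (does⁺ (v ≟ x) e))
    module Rest = Within W (λ i → ≢⇒W (≢-sym (lookup⁺ ox i))) prx
    module Least (y : Fin n) (oy : Outside y) (xy : x ~ y ≡ true)
      (least : ∀ z → Outside z → x ~ z ≡ true → count (nbrs y) ≤ count (nbrs z)) where
      yx : y ~ x ≡ true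
      yx = ~-sym⁺ {x} {y} xy
      -- By the choice of `y` and nestedness, every neighbour of `x` has a neighbourhood containing
      -- that of `y`, hence `v`; so a vertex that tells `v` from `x` is adjacent to `v`.
      larger : ∀ v → Outside v → v ≢ x → y ~ v ≡ true → ∃ λ z → Outside z × v ~ z ≡ true × x ~ z ≡ false × τ z ≡ τ y
      larger v ov v≢x yv with Whole.distinguished ox ov refl refl (l1 oy ox ov yx yv) (≢-sym v≢x)
      ... | z , _ , oz , ne with bool-case (x ~ z) | bool-case (v ~ z)
      ...   | inj₁ xz | inj₁ vz = ⊥-elim (ne (trans xz (sym vz)))
      ...   | inj₂ xz | inj₂ vz = ⊥-elim (ne (trans xz (sym vz)))
      ...   | inj₂ xz | inj₁ vz = z , oz , vz , xz , l1 ov oz oy vz (~-sym⁺ {y} {v} yv)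
      ...   | inj₁ xz | inj₂ vz = ⊥-elim (<-irrefl refl (≤-trans
                (nbrs-⊂ oy oz ov (l1 ox oy oz xy xz) yv (~-sym⁺ {v} {z} vz)) (least z oz xz)))
      Cand : VSet n
      Cand z = (outᵇ z ∧ not (x ~ z)) ∧ (τ z ≡ᵗ τ y)
      cand⁺ : ∀ {z} → Outside z → x ~ z ≡ false → τ z ≡ τ y → Cand z ≡ true
      cand⁺ {z} oz xz e = ∧⁺ (∧⁺ (outside⁺ oz) (not⁺ xz)) (subst (λ t → (t ≡ᵗ τ y) ≡ true) (sym e) (≡ᵗ-refl (τ y)))
      -- `z` has the largest neighbourhood among the vertices of the type of `y` not adjacent to
      -- `x`; counting non-neighbours turns this into a minimum for `argmin`. Together with
      -- `larger`, no vertex but `x` tells `z` from `y`.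
      module Most (z : Fin n) (oz : Outside z) (xz : x ~ z ≡ false) (e : τ z ≡ τ y)
        (most : ∀ w → Cand w ≡ true → count (non-nbrs z) ≤ count (non-nbrs w)) where
        z≢y : z ≢ y
        z≢y p = true≢false (trans (cong (x ~_) p) xy) xz
        z≢x : z ≢ x
        z≢x p = true≢false (trans (cong (y ~_) p) yx) (~-same {y} {z} (cong block (sym e)))
        contra : (∃ λ v → W v ≡ true × Outside v × z ~ v ≢ y ~ v) → ⊥
        contra (v , Wv , ov , ne) with bool-case (z ~ v) | bool-case (y ~ v)
        ... | inj₁ p | inj₁ q = ne (trans p (sym q))
        ... | inj₂ p | inj₂ q = ne (trans p (sym q))
        ... | inj₁ p | inj₂ q = true≢false (nested oy oz ox ov (sym e) yx (~-sym⁺ {x} {z} xz) p) q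
        ... | inj₂ p | inj₁ q with larger v ov (W⇒≢ Wv) q
        ...   | w , ow , vw , xw , e' = <-irrefl refl (≤-trans
                  (non-nbrs-⊂ ow oz ov (trans e' (sym e)) (~-sym⁺ {v} {w} vw) p) (most w (cand⁺ ow xw e')))
        twins : ⊥
        twins = contra (Rest.distinguished oz oy (≢⇒W z≢x) (≢⇒W (≢-sym (~⇒≢ xy))) e z≢y)
      absurd : ⊥
      absurd with Rest.not-isolated y oy (≢⇒W (≢-sym (~⇒≢ xy)))
      ... | x' , Wx' , ox' , yx' with larger x' (outside⁻ x' ox') (W⇒≢ Wx') yx'
      ... | z₀ , oz₀ , _ , xz₀ , e₀ with argmin Cand (count ∘ non-nbrs) (z₀ , cand⁺ oz₀ xz₀ e₀)
      ... | z , cz , most with ∧⁻ {outᵇ z ∧ not (x ~ z)} cz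
      ... | cz₁ , cz₂ with ∧⁻ {outᵇ z} cz₁
      ... | oz' , xz' = Most.twins z (outside⁻ z oz') (not-true⁻ xz') (≡ᵗ⁻ (τ z) (τ y) cz₂) most
    start : (∃ λ y → Outside y × x ~ y ≡ true) → ⊥
    start (y , oy , xy) with argmin (nbrs x) (count ∘ nbrs) (y , ∧⁺ (outside⁺ oy) xy)
    ... | y' , p , least with ∧⁻ {outᵇ y'} p
    ...   | oy' , xy' = Least.absurd y' (outside⁻ y' oy') xy' λ z oz xz → least z (∧⁺ (outside⁺ oz) xz)

  -- The smaller of two nested neighbourhoods is nonempty. This is what connects the vertices of one
  -- type.
  common : ∀ {x x'} → Outside x → Outside x' → τ x ≡ τ x' → ∃ λ y → Outside y × x ~ y ≡ true × x' ~ y ≡ true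
  common {x} {x'} ox ox' e with partner x ox | partner x' ox'
  ... | y , oy , xy | y' , oy' , x'y' with bool-case (x' ~ y)
  ...   | inj₁ p = y , oy , xy , p
  ...   | inj₂ p = y' , oy' , nested ox ox' oy oy' e xy p x'y' , x'y'

-- Completeness of the finite tests and pruned enumeration

few-or-two : ∀ {m} (v : Vec Bool m) → fewB v ≡ true ⊎ (∃₂ λ i j → i ≢ j × lookup v i ≡ true × lookup v j ≡ true)
few-or-two [] = inj₁ refl
few-or-two (false ∷ v) with few-or-two v
... | inj₁ p = inj₁ p
... | inj₂ (i , j , i≢j , p , q) = inj₂ (suc i , suc j , (λ e → i≢j (suc-injective e)) , p , q)
few-or-two (true ∷ v) with none-or-one v
  where
  none-or-one : ∀ {m} (v : Vec Bool m) → noneB v ≡ true ⊎ (∃ λ i → lookup v i ≡ true)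
  none-or-one [] = inj₁ refl
  none-or-one (true ∷ v) = inj₂ (zero , refl)
  none-or-one (false ∷ v) with none-or-one v
  ... | inj₁ p = inj₁ p
  ... | inj₂ (i , p) = inj₂ (suc i , p)
... | inj₁ p = inj₁ p
... | inj₂ (i , p) = inj₂ (zero , suc i , (λ ()) , refl , p)

fullB⁺ : ∀ {m} (v : Vec Bool m) → (∀ i → lookup v i ≡ true) → fullB v ≡ true
fullB⁺ [] h = refl
fullB⁺ (b ∷ v) h = ∧⁺ (h zero) (fullB⁺ v (h ∘ suc))

module-trivial : ∀ {n m} (T : Tournament n) {vs : Vec (Fin n) m} → Distinct vs → Prime T (setOf vs) →
  ∀ I → moduleB (mat (rowsOf T vs)) I ≡ true → (fewB I ∨ fullB I) ≡ true
module-trivial T dis pr I md with few-or-two I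
... | inj₁ p = ∨⁺ˡ p
... | inj₂ (i , j , i≢j , p , q) = ∨⁺ʳ {fewB I} (fullB⁺ I (indecB-complete T dis pr I md i j i≢j p q))

allVec⁺ : ∀ m {f : Vec Bool m → Bool} → (∀ v → f v ≡ true) → allVec m f ≡ true
allVec⁺ zero h = h []
allVec⁺ (suc m) h = ∧⁺ (allVec⁺ m λ v → h (true ∷ v)) (allVec⁺ m λ v → h (false ∷ v))

opaque
  unfolding indecB

  Prime⇒indecB : ∀ {n m} (T : Tournament n) {vs : Vec (Fin n) m} → Distinct vs → Prime T (setOf vs) → indecB (rowsOf T vs) ≡ true
  Prime⇒indecB {m = m} T {vs} dis pr = allVec⁺ m λ I → one I (bool-case (moduleB (mat (rowsOf T vs)) I))
    where
    one : ∀ I → moduleB (mat (rowsOf T vs)) I ≡ true ⊎ moduleB (mat (rowsOf T vs)) I ≡ false →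
      (fewB I ∨ fullB I ∨ not (moduleB (mat (rowsOf T vs)) I)) ≡ true
    one I (inj₂ p) = ∨⁺ʳ {fewB I} (∨⁺ʳ {fullB I} (not⁺ p))
    one I (inj₁ p) with ∨⁻ {fewB I} (module-trivial T dis pr I p)
    ... | inj₁ q = ∨⁺ˡ q
    ... | inj₂ q = ∨⁺ʳ {fewB I} (∨⁺ˡ q)

opaque
  unfolding w5on

  w5on-complete : ∀ {n m} (T : Tournament n) {vs : Vec (Fin n) m} → Distinct vs → (g : Fin 5 → Fin m) →
    (∀ i j → arc T (lookup vs (g i)) (lookup vs (g j)) ≡ arcW5 i j) → w5on (mat (rowsOf T vs)) (λ _ → true) ≡ true
  w5on-complete T {vs} dis g h =
    anyF⁺ (g 0F) (anyF⁺ (g 1F) (∧⁺ (m 0F 1F refl) (anyF⁺ (g 2F) (∧⁺ (m 0F 2F refl) (∧⁺ (m 1F 2F refl)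
      (anyF⁺ (g 3F) (∧⁺ (m 0F 3F refl) (∧⁺ (m 1F 3F refl) (∧⁺ (m 2F 3F refl)
      (anyF⁺ (g 4F) (∧⁺ (m 4F 0F refl) (∧⁺ (m 1F 4F refl) (∧⁺ (m 4F 2F refl) (∧⁺ (m 3F 4F refl) refl))))))))))))))
    where
    m : ∀ i j → arcW5 i j ≡ true → mat (rowsOf T vs) (g i) (g j) ≡ true
    m i j e = trans (mat-rowsOf T dis (g i) (g j)) (trans (h i j) e)

-- The survivors of a test are listed once, so that a later test on pairs runs over few vectors.
filterVec : ∀ m → (Vec Bool m → Bool) → List (Vec Bool m)
filterVec zero f = if f [] then [] ∷ [] else []
filterVec (suc m) f = List.map (true ∷_) (filterVec m (λ v → f (true ∷ v))) List.++ List.map (false ∷_) (filterVec m (λ v → f (false ∷ v)))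

allL : ∀ {A : Set} → (A → Bool) → List A → Bool
allL f [] = true
allL f (x ∷ xs) = f x ∧ allL f xs

allL-++ : ∀ {A : Set} {f : A → Bool} xs {ys} → allL f (xs List.++ ys) ≡ true → allL f xs ≡ true × allL f ys ≡ true
allL-++ [] p = refl , p
allL-++ {f = f} (x ∷ xs) p with ∧⁻ {f x} p
... | q , r with allL-++ xs r
...   | s , t = ∧⁺ q s , t

allL-map : ∀ {A B : Set} {f : B → Bool} (h : A → B) xs → allL f (List.map h xs) ≡ true → allL (f ∘ h) xs ≡ true
allL-map h [] p = refl
allL-map {f = f} h (x ∷ xs) p with ∧⁻ {f (h x)} p
... | q , r = ∧⁺ q (allL-map h xs r)

filterVec⁻ : ∀ m {f g : Vec Bool m → Bool} → allL g (filterVec m f) ≡ true → ∀ v → f v ≡ true → g v ≡ true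
filterVec⁻ zero {f} p [] q with f []
filterVec⁻ zero p [] q | true = proj₁ (∧⁻ p)
filterVec⁻ (suc m) {f} {g} p (true ∷ v) q = filterVec⁻ m (allL-map (true ∷_) (filterVec m (λ v → f (true ∷ v))) (proj₁ (allL-++ (List.map (true ∷_) (filterVec m (λ v → f (true ∷ v)))) p))) v q
filterVec⁻ (suc m) {f} {g} p (false ∷ v) q = filterVec⁻ m (allL-map (false ∷_) (filterVec m (λ v → f (false ∷ v))) (proj₂ (allL-++ (List.map (true ∷_) (filterVec m (λ v → f (true ∷ v)))) p))) v q

-- Excluding indecomposable six-vertex supersets of the cycle

-- Vertices are listed newest first, so a and b are the third and second last ones.
ab-root : ∀ k → Fin (k + 3) → Bool
ab-root zero zero = true
ab-root zero (suc zero) = true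
ab-root zero (suc (suc _)) = false
ab-root (suc k) zero = false
ab-root (suc k) (suc i) = ab-root k i

w5ab : ∀ k → Rows (k + 3) → Bool
w5ab k R = w5on (mat R) (ab-root k)

-- Any linear order on types would do: it lets `six-check` treat three outside vertices in one order
-- only, and `sort₃` restores generality.
code : Ty → ℕ
code (p ∷ q ∷ r ∷ []) = bit' 4 p + bit' 2 q + bit' 1 r
  where
  bit' : ℕ → Bool → ℕ
  bit' k true = k
  bit' k false = 0

_≤ᵗ_ : Ty → Ty → Bool
s ≤ᵗ t = code s ≤ᵇ code t

-- An indecomposable 6-vertex set in which a and b avoid W5 is isomorphic to the Paley tournament
-- P7 minus a vertex; it extends only to P7, and P7 does not extend.
module _ (R : Rows 6) where

  rows₇ : List (Vec Bool 6)
  rows₇ = filterVec 6 λ w → not (w5ab 4 (R ▷ w))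

  twinB : Fin 6 → Vec Bool 6 → Bool
  twinB s w = allF λ i → (i == s) ∨ not (mat R s i xor lookup w i)

  outB extB : Vec Bool 6 → Bool
  outB w = allF λ i → not (lookup w i xor lookup w 0F)
  extB w = not (outB w) ∧ allF λ s → not (twinB s w)

  -- With `good-out` and `good-ext`, these are the hypotheses of `stuck` for two further vertices
  -- with rows `w` and `w'`. The entry put in front of `w'` is the arc that would violate the
  -- hypothesis; it has to create a W5 through a or b. For two extensions the rows have to coincide.
  good-twin : Fin 6 → Vec Bool 6 → Vec Bool 6 → Bool
  good-twin s w w' = twinB s w ⇒ not (twinB s w') ⇒ w5ab 5 (R ▷ w ▷ (not (lookup w' s) ∷ w'))

  good-out good-ext good₈ : Vec Bool 6 → Vec Bool 6 → Bool
  good-out w w' = outB w ⇒ not (outB w') ⇒ w5ab 5 (R ▷ w ▷ (lookup w 0F ∷ w'))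
  good-ext w w' = extB w ⇒ extB w' ⇒ (w ≡ᵗ w')
  good₈ w w' = (allF λ s → good-twin s w w') ∧ good-out w w' ∧ good-ext w w'

  good₇ : List (Vec Bool 6) → Vec Bool 6 → Bool
  good₇ rows w = not (w5on (mat (R ▷ w)) (λ _ → true)) ∧ allL (good₈ w) rows

  good₆ : List (Vec Bool 6) → Bool
  good₆ rows = not (w5on (mat R) (λ _ → true)) ∧ allL (good₇ rows) rows

  six-rest : Bool
  six-rest = good₆ rows₇

  private
    free₇ : Vec Bool 6 → Bool
    free₇ w = not (w5ab 4 (R ▷ w))

  six-rest⁻₆ : six-rest ≡ true → w5on (mat R) (λ _ → true) ≡ false
  six-rest⁻₆ p = not-true⁻ (proj₁ (∧⁻ {not (w5on (mat R) (λ _ → true))} {allL (good₇ rows₇) rows₇} p))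

  private
    good₇-holds : six-rest ≡ true → ∀ w → w5ab 4 (R ▷ w) ≡ false → good₇ rows₇ w ≡ true
    good₇-holds p w h = filterVec⁻ 6 {free₇} {good₇ rows₇}
      (proj₂ (∧⁻ {not (w5on (mat R) (λ _ → true))} {allL (good₇ rows₇) rows₇} p)) w (not⁺ h)

  six-rest⁻₇ : six-rest ≡ true → ∀ w → w5ab 4 (R ▷ w) ≡ false → w5on (mat (R ▷ w)) (λ _ → true) ≡ false
  six-rest⁻₇ p w h = not-true⁻ (proj₁ (∧⁻ {not (w5on (mat (R ▷ w)) (λ _ → true))} {allL (good₈ w) rows₇} (good₇-holds p w h)))

  six-rest⁻₈ : six-rest ≡ true → ∀ w w' → w5ab 4 (R ▷ w) ≡ false → w5ab 4 (R ▷ w') ≡ false → good₈ w w' ≡ true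
  six-rest⁻₈ p w w' h h' = filterVec⁻ 6 {free₇} {good₈ w}
    (proj₂ (∧⁻ {not (w5on (mat (R ▷ w)) (λ _ → true))} {allL (good₈ w) rows₇} (good₇-holds p w h))) w' (not⁺ h')

-- The tests go from cheap to costly: order of types, W5 on five and on six vertices,
-- indecomposability, and only for the survivors the search over further vertices.
six-body : Ty × Ty × Ty × Bool × Bool × Bool → Bool
six-body (s , t , r , yx , zy , zx) = (s ≤ᵗ t) ⇒ (t ≤ᵗ r) ⇒ not (w5ab 2 (base ▷ s ▷ (yx ∷ t))) ⇒
  not (w5ab 3 (base ▷ s ▷ (yx ∷ t) ▷ (zy ∷ zx ∷ r))) ⇒ indecB (base ▷ s ▷ (yx ∷ t) ▷ (zy ∷ zx ∷ r)) ⇒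
  six-rest (base ▷ s ▷ (yx ∷ t) ▷ (zy ∷ zx ∷ r))

opaque
  unfolding w5on indecB

  six-check : ∀ p → six-body p ≡ true
  six-check = sound (ty ⊗ ty ⊗ ty ⊗ bit ⊗ bit ⊗ bit) six-body refl

module AvoidingW5 {n : ℕ} (T : Tournament n) (a b : Fin n) (na : ¬ InW5 T a) (nb : ¬ InW5 T b)
  (c : Fin n) (ab : T ∶ a ⟶ b) (bc : T ∶ b ⟶ c) (ca : T ∶ c ⟶ a) where

  open Cycle T a b c ab bc ca

  ab-root-lookup : ∀ {k} (ws : Vec (Fin n) k) i → ab-root k i ≡ true → lookup (ws ++ X) i ≡ a ⊎ lookup (ws ++ X) i ≡ b
  ab-root-lookup [] zero _ = inj₁ refl
  ab-root-lookup [] (suc zero) _ = inj₂ refl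
  ab-root-lookup (w ∷ ws) (suc i) p = ab-root-lookup ws i p

  no-w5ab : ∀ {k} (ws : Vec (Fin n) k) → Distinct (ws ++ X) → w5ab k (rowsOf T (ws ++ X)) ≡ false
  no-w5ab {k} ws dis with bool-case (w5ab k (rowsOf T (ws ++ X)))
  ... | inj₂ p = p
  ... | inj₁ p with w5on-sound T {vs = ws ++ X} dis (ab-root k) p
  ...   | i , r , w with ab-root-lookup ws i r
  ...     | inj₁ e = ⊥-elim (na (subst (InW5 T) e w))
  ...     | inj₂ e = ⊥-elim (nb (subst (InW5 T) e w))

  record Six (x y z : Fin n) : Set where
    constructor six
    field
      ox  : Outside x
      oy  : Outside y
      oz  : Outside z
      x≢y : x ≢ y
      x≢z : x ≢ z
      y≢z : y ≢ z
      prime₆ : Prime T (setOf (z ∷ y ∷ x ∷ X))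

  swap₁ : ∀ {x y z} → Six x y z → Six y x z
  swap₁ {x} {y} {z} (six ox oy oz xy xz yz pr) = six oy ox oz (≢-sym xy) yz xz
    (Prime-cong {T = T} {setOf (z ∷ y ∷ x ∷ X)} (λ v → move (Xˢ v)) (λ v → move (Xˢ v)) pr)
    where
    move : ∀ p {q r s} → ((p ∨ q) ∨ r) ∨ s ≡ true → ((p ∨ r) ∨ q) ∨ s ≡ true
    move true _ = refl
    move false {true} {true} _ = refl
    move false {true} {false} _ = refl
    move false {false} {true} _ = refl
    move false {false} {false} h = h

  swap₂ : ∀ {x y z} → Six x y z → Six x z y
  swap₂ {x} {y} {z} (six ox oy oz xy xz yz pr) = six ox oz oy xz xy (≢-sym yz)
    (Prime-cong {T = T} {setOf (z ∷ y ∷ x ∷ X)} (λ v → move ((Xˢ ⊕ x) v)) (λ v → move ((Xˢ ⊕ x) v)) pr)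
    where
    move : ∀ p {q r} → (p ∨ q) ∨ r ≡ true → (p ∨ r) ∨ q ≡ true
    move true _ = refl
    move false {true} {true} _ = refl
    move false {true} {false} _ = refl
    move false {false} {true} _ = refl

  ≤ᵗ-total : ∀ s t → (s ≤ᵗ t) ≡ true ⊎ (t ≤ᵗ s) ≡ true
  ≤ᵗ-total s t = ∨⁻ (sound (ty ⊗ ty) (λ (s , t) → (s ≤ᵗ t) ∨ (t ≤ᵗ s)) refl (s , t))

  sort₃ : ∀ {x y z} → Six x y z → ∃ λ x' → ∃₂ λ y' z' → Six x' y' z' × (τ x' ≤ᵗ τ y') ≡ true × (τ y' ≤ᵗ τ z') ≡ true
  sort₃ {x} {y} {z} s with ≤ᵗ-total (τ x) (τ y) | ≤ᵗ-total (τ y) (τ z) | ≤ᵗ-total (τ x) (τ z)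
  ... | inj₁ p | inj₁ q | _ = x , y , z , s , p , q
  ... | inj₁ p | inj₂ q | inj₁ r = x , z , y , swap₂ s , r , q
  ... | inj₁ p | inj₂ q | inj₂ r = z , x , y , swap₁ (swap₂ s) , r , p
  ... | inj₂ p | inj₁ q | inj₁ r = y , x , z , swap₁ s , p , r
  ... | inj₂ p | inj₁ q | inj₂ r = y , z , x , swap₂ (swap₁ s) , q , r
  ... | inj₂ p | inj₂ q | _ = z , y , x , swap₁ (swap₂ (swap₁ s)) , q , p

  -- Given such a six-vertex set, `six-check` supplies the hypotheses of `stuck`, so T has at most
  -- seven vertices. The same check says that these contain no W5, contrary to the copy through `c`.
  noSix : Prime T allᵛ → (∀ v → v ≢ a → v ≢ b → InW5 T v) → NoSix
  noSix prT cov x₀ y₀ z₀ ox₀ oy₀ oz₀ xy₀ xz₀ yz₀ pr₀ with sort₃ (six ox₀ oy₀ oz₀ xy₀ xz₀ yz₀ pr₀)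
  ... | x , y , z , six ox oy oz x≢y x≢z y≢z pr₆ , le₁ , le₂ = absurd
    where
    vs : Vec (Fin n) 6
    vs = z ∷ y ∷ x ∷ X
    dis : Distinct vs
    dis = distinct₆ ox oy oz x≢y x≢z y≢z
    R : Rows 6
    R = rowsOf T vs
    chk : six-rest (rowsOf T vs) ≡ true
    chk = trans (cong six-rest (six-rows x y z))
      (⇒⁻ {indecB R'} (⇒⁻ {not (w5ab 3 R')} (⇒⁻ {not (w5ab 2 R″)} (⇒⁻ {τ y ≤ᵗ τ z} (⇒⁻ {τ x ≤ᵗ τ y}
        (six-check (τ x , τ y , τ z , arc T y x , arc T z y , arc T z x)) le₁) le₂)
        (not⁺ (trans (cong (w5ab 2) (cong (λ B → B ▷ τ x ▷ (arc T y x ∷ τ y)) (sym X-rows))) (no-w5ab (y ∷ x ∷ []) ((≢-sym x≢y ∷ oy) ∷ ox ∷ X-distinct)))))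
        (not⁺ (trans (cong (w5ab 3) (sym (six-rows x y z))) (no-w5ab (z ∷ y ∷ x ∷ []) dis))))
        (trans (cong indecB (sym (six-rows x y z))) (Prime⇒indecB T dis pr₆)))
      where
      R″ : Rows 5
      R″ = base ▷ τ x ▷ (arc T y x ∷ τ y)
      R' : Rows 6
      R' = R″ ▷ (arc T z y ∷ arc T z x ∷ τ z)
    new-distinct : ∀ {w} → setOf vs w ≡ false → Distinct (w ∷ vs)
    new-distinct p = setOf-∉⁻ vs p ∷ dis
    row : Fin n → Vec Bool 6
    row w = map (arc T w) vs
    row-lookup : ∀ w i → lookup (row w) i ≡ arc T w (lookup vs i)
    row-lookup w i = lookup-map i (arc T w) vs
    seven : ∀ {w} → setOf vs w ≡ false → w5ab 4 (R ▷ row w) ≡ false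
    seven {w} p = no-w5ab (w ∷ z ∷ y ∷ x ∷ []) (new-distinct p)
    eight : ∀ {w w'} → setOf vs w ≡ false → setOf vs w' ≡ false → w ≢ w' → ∀ {d} → d ≡ arc T w' w →
      w5ab 5 (R ▷ row w ▷ (d ∷ row w')) ≡ true → ⊥
    eight {w} {w'} p p' w≢w' refl h = true≢false h
      (no-w5ab (w' ∷ w ∷ z ∷ y ∷ x ∷ []) ((≢-sym w≢w' ∷ setOf-∉⁻ vs p') ∷ new-distinct p))
    good : ∀ {w w'} → setOf vs w ≡ false → setOf vs w' ≡ false → good₈ R (row w) (row w') ≡ true
    good {w} {w'} p p' = six-rest⁻₈ R chk (row w) (row w') (seven p) (seven p')
    open Upward T (setOf vs) pr₆ a b c (setOf⁺ vs 3F) (setOf⁺ vs 4F) (setOf⁺ vs 5F) a≢b a≢c b≢c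
    new≢ : ∀ {w} → setOf vs w ≡ false → ∀ i → w ≢ lookup vs i
    new≢ p i = lookup⁺ (setOf-∉⁻ vs p) i
    twinB⁺ : ∀ k {w} → setOf vs w ≡ false → Twin (lookup vs k) w → twinB R k (row w) ≡ true
    twinB⁺ k {w} p (_ , h) = allF⁺ λ i → one i (i ≟ k)
      where
      one : ∀ i → Dec (i ≡ k) → ((i == k) ∨ not (mat R k i xor lookup (row w) i)) ≡ true
      one i (yes e) = ∨⁺ˡ (does⁺ (i ≟ k) e)
      one i (no ne) = ∨⁺ʳ {i == k} (not⁺ (xor-≡ (trans (mat-rowsOf T dis k i) (trans
        (flip-cong T v≢ (≢-sym (new≢ p i)) (h (lookup vs i) (setOf⁺ vs i) v≢)) (sym (row-lookup w i))))))
        where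
        v≢ : lookup vs i ≢ lookup vs k
        v≢ e = ne (lookup-injective dis i k e)
    twinB⁻ : ∀ k {w} → setOf vs w ≡ false → twinB R k (row w) ≡ true → Twin (lookup vs k) w
    twinB⁻ k {w} p h = setOf⁺ vs k , λ v uv v≢ → one v v≢ (setOf⁻ vs uv)
      where
      one : ∀ v → v ≢ lookup vs k → (∃ λ i → lookup vs i ≡ v) → arc T v (lookup vs k) ≡ arc T v w
      one v v≢ (i , refl) = [ (λ e → ⊥-elim (v≢ (cong (lookup vs) (==⁻ i k e)))) ,
        (λ e → flip-cong T (≢-sym v≢) (new≢ p i) (trans (sym (mat-rowsOf T dis k i)) (trans (xor-false (not-true⁻ e)) (row-lookup w i)))) ]′
        (∨⁻ {i == k} (allF⁻ {f = λ i → (i == k) ∨ not (mat R k i xor lookup (row w) i)} h i))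
    outB⁺ : ∀ {w} → Out w → outB R (row w) ≡ true
    outB⁺ {w} o = allF⁺ λ i → not⁺ (xor-≡ (trans (row-lookup w i) (trans (o (lookup vs i) (lookup vs 0F) (setOf⁺ vs i) (setOf⁺ vs 0F)) (sym (row-lookup w 0F)))))
    outB⁻ : ∀ {w} → outB R (row w) ≡ true → Out w
    outB⁻ {w} h v v' uv uv' = trans (to v (setOf⁻ vs uv)) (sym (to v' (setOf⁻ vs uv')))
      where
      to : ∀ v → (∃ λ i → lookup vs i ≡ v) → arc T w v ≡ lookup (row w) 0F
      to v (i , refl) = trans (sym (row-lookup w i)) (xor-false (not-true⁻ (allF⁻ {f = λ i → not (lookup (row w) i xor lookup (row w) 0F)} h i)))
    h₁ : ∀ {s w w'} → setOf vs w ≡ false → setOf vs w' ≡ false → w ≢ w' → Twin s w → ¬ Twin s w' → arc T w' s ≡ arc T w' w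
    h₁ {s} {w} {w'} p p' w≢w' tw@(us , _) ¬tw = at-index (setOf⁻ vs us)
      where
      at-index : (∃ λ k → lookup vs k ≡ s) → arc T w' s ≡ arc T w' w
      at-index (k , refl) = [ (λ e → ⊥-elim (eight p p' w≢w' (xor-true (trans (cong (_xor arc T w' w) (row-lookup w' k)) e)) w5)) , xor-false ]′
        (bool-case (arc T w' (lookup vs k) xor arc T w' w))
        where
        w5 : w5ab 5 (R ▷ row w ▷ (not (lookup (row w') k) ∷ row w')) ≡ true
        w5 = ⇒⁻ {not (twinB R k (row w'))} (⇒⁻ {twinB R k (row w)} (allF⁻ {f = λ s → good-twin R s (row w) (row w')}
          (proj₁ (∧⁻ {allF λ s → good-twin R s (row w) (row w')} {good-out R (row w) (row w') ∧ good-ext R (row w) (row w')} (good p p'))) k) (twinB⁺ k p tw))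
          (not⁺ (refute (λ e → ¬tw (twinB⁻ k p' e))))
    good-rest : ∀ {w w'} → setOf vs w ≡ false → setOf vs w' ≡ false → good-out R (row w) (row w') ≡ true × good-ext R (row w) (row w') ≡ true
    good-rest {w} {w'} p p' = ∧⁻ {good-out R (row w) (row w')} {good-ext R (row w) (row w')}
      (proj₂ (∧⁻ {allF λ s → good-twin R s (row w) (row w')} {good-out R (row w) (row w') ∧ good-ext R (row w) (row w')} (good p p')))
    h₂ : ∀ {w w' v} → setOf vs w ≡ false → setOf vs w' ≡ false → w ≢ w' → Out w → ¬ Out w' → setOf vs v ≡ true → arc T w w' ≡ arc T w v
    h₂ {w} {w'} {v} p p' w≢w' ow ¬ow uv = [ (λ e → ⊥-elim (eight p p' w≢w' (trans (row-lookup w 0F) (trans (ow _ _ (setOf⁺ vs 0F) uv) (trans (not-swap (sym (xor-true e))) (sym (flip-arc T w≢w'))))) w5)) , (λ e → sym (xor-false e)) ]′ (bool-case (arc T w v xor arc T w w'))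
      where
      w5 : w5ab 5 (R ▷ row w ▷ (lookup (row w) 0F ∷ row w')) ≡ true
      w5 = ⇒⁻ {not (outB R (row w'))} (⇒⁻ {outB R (row w)} (proj₁ (good-rest p p')) (outB⁺ ow))
        (not⁺ (refute (λ e → ¬ow (outB⁻ e))))
    h₃ : ∀ {w w' v} → setOf vs w ≡ false → setOf vs w' ≡ false → w ≢ w' → Prime T (setOf vs ⊕ w) → Prime T (setOf vs ⊕ w') →
      setOf vs v ≡ true → arc T v w ≡ arc T v w'
    h₃ {w} {w'} {v} p p' w≢w' e e' uv = at-index (setOf⁻ vs uv)
      where
      ext : ∀ {w} → setOf vs w ≡ false → Prime T (setOf vs ⊕ w) → extB R (row w) ≡ true
      ext {w} p e = ∧⁺ (not⁺ (refute (λ h → ext-not-out p e (outB⁻ h))))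
        (allF⁺ λ s → not⁺ (refute (λ h → ext-not-twin p e (twinB⁻ s p h))))
      same : row w ≡ row w'
      same = ≡ᵗ⁻ (row w) (row w') (⇒⁻ {extB R (row w')} (⇒⁻ {extB R (row w)} (proj₂ (good-rest p p')) (ext p e)) (ext p' e'))
      at-index : (∃ λ k → lookup vs k ≡ v) → arc T v w ≡ arc T v w'
      at-index (k , refl) = flip-cong T (new≢ p k) (new≢ p' k) (trans (sym (row-lookup w k)) (trans (cong (λ r → lookup r k) same) (row-lookup w' k)))
    uniq : ∀ w w' → setOf vs w ≡ false → setOf vs w' ≡ false → w ≡ w'
    uniq = stuck prT h₁ h₂ h₃
    absurd : ⊥
    absurd with cov c (≢-sym a≢c) (≢-sym b≢c) | any? (λ w → setOf vs w ≟ᴮ false)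
    ... | f , _ , arcs , _ | no none = true≢false
              (w5on-complete T dis (λ i → proj₁ (loc i)) (λ i j → trans (cong₂ (arc T) (proj₂ (loc i)) (proj₂ (loc j))) (arcs i j)))
              (six-rest⁻₆ R chk)
      where
      loc : ∀ i → ∃ λ k → lookup vs k ≡ f i
      loc i = setOf⁻ vs ([ id , (λ q → ⊥-elim (none (f i , q))) ]′ (bool-case (setOf vs (f i))))
    ... | f , _ , arcs , _ | yes (w , p) = true≢false
              (w5on-complete T (new-distinct p) (λ i → proj₁ (loc i)) (λ i j → trans (cong₂ (arc T) (proj₂ (loc i)) (proj₂ (loc j))) (arcs i j)))
              (six-rest⁻₇ R chk (row w) (seven p))
      where
      loc : ∀ i → ∃ λ k → lookup (w ∷ vs) k ≡ f i
      loc i with bool-case (setOf vs (f i))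
      ... | inj₁ q = let (k , e) = setOf⁻ vs q in suc k , e
      ... | inj₂ q = zero , uniq w (f i) p q

-- Matchings of types forced by a copy of W5 through c

anyL : ∀ {A : Set} → (A → Bool) → List A → Bool
anyL f [] = false
anyL f (x ∷ xs) = f x ∨ anyL f xs

anyL⁻ : ∀ {A : Set} {f : A → Bool} xs → anyL f xs ≡ true → ∃ λ x → f x ≡ true
anyL⁻ {f = f} (x ∷ xs) h with ∨⁻ {f x} h
... | inj₁ q = x , q
... | inj₂ q = anyL⁻ xs q

-- m∅ and p∅ are the sets X⁻ and X⁺, mᵢ and pᵢ are X⁻(i) and X⁺(i).
m∅ p∅ m0 p0 m1 p1 m2 p2 : Ty
m∅  = true ∷ true ∷ true ∷ []
p∅  = false ∷ false ∷ false ∷ []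
m0 = true ∷ true ∷ false ∷ []
p0 = false ∷ true ∷ false ∷ []
m1 = false ∷ true ∷ true ∷ []
p1 = false ∷ false ∷ true ∷ []
m2 = true ∷ false ∷ true ∷ []
p2 = true ∷ false ∷ false ∷ []

Matching : Set
Matching = List (Ty × Ty)

-- The components of each class as matched pairs of types. A star marks the dual class, in which a
-- and b are exchanged besides (see `dualᵗ`). `famF` is the one possible outcome that belongs to no
-- class; another choice of c removes it.
famH famI famJ famK famL famJ* famK* famL* famF : Matching
famH  = (p0 , m∅) ∷ (p∅ , m1) ∷ []
famI  = (p0 , p2) ∷ (p1 , m0) ∷ []
famJ  = (p1 , m∅) ∷ (m1 , m0) ∷ []
famK  = (p1 , m∅) ∷ (p0 , m2) ∷ []
famL  = (p1 , m∅) ∷ (p0 , m2) ∷ (p∅ , m0) ∷ []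
famJ* = (m0 , p∅) ∷ (p0 , p1) ∷ []
famK* = (m0 , p∅) ∷ (m1 , p2) ∷ []
famL* = (m0 , p∅) ∷ (m1 , p2) ∷ (m∅ , p1) ∷ []
famF  = (p1 , m∅) ∷ (m1 , p2) ∷ []

pairᵇ : Ty → Ty → Ty × Ty → Bool
pairᵇ s t (s' , t') = ((s ≡ᵗ s') ∧ (t ≡ᵗ t')) ∨ ((s ≡ᵗ t') ∧ (t ≡ᵗ s'))

matched : Matching → Ty → Ty → Bool
matched l s t = anyL (pairᵇ s t) l

-- The nine pairs of edges that a copy of W5 through c can induce.
two-edges : Fin 9 → (Ty × Ty) × (Ty × Ty)
two-edges 0F = (p0 , m∅) , (p∅ , m1)
two-edges 1F = (p0 , p2) , (p1 , m0)
two-edges 2F = (p1 , m∅) , (m1 , m0)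
two-edges 3F = (m0 , p∅) , (p0 , p1)
two-edges 4F = (m0 , p∅) , (m1 , p2)
two-edges 5F = (p1 , m∅) , (m1 , p2)
two-edges 6F = (p1 , m∅) , (p0 , m2)
two-edges 7F = (p∅ , m0) , (p0 , m2)
two-edges (suc (suc (suc (suc (suc (suc (suc (suc _)))))))) = (p1 , m0) , (m1 , m2)

w5rows : Rows 5
w5rows = [] ▷ [] ▷ (true ∷ []) ▷ (true ∷ false ∷ []) ▷ (true ∷ true ∷ true ∷ []) ▷ (true ∷ true ∷ true ∷ false ∷ [])

first-one first-two : ∀ {k} → Fin k → Bool
first-one zero = true
first-one (suc _) = false
first-two zero = true
first-two (suc zero) = true
first-two (suc (suc _)) = false

module _ (i₀ : Fin 5) (rb ra : Vec Bool 5) where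

  -- `i₀` is the place of c in the copy, and `rb`, `ra` are the rows of b and a towards it; the
  -- negations turn them into arcs towards b and a.
  w5-type : Fin 5 → Ty
  w5-type j = not (lookup ra j) ∷ not (lookup rb j) ∷ arcW5 j i₀ ∷ []

  w5-end : Ty → Fin 5 → Fin 5 → Bool
  w5-end t j k = not (k == i₀) ∧ (w5-type k ≡ᵗ t) ∧ adj (w5-type j) (w5-type k) (arcW5 j k)

  w5-start : Ty → Ty → Fin 5 → Bool
  w5-start s t j = not (j == i₀) ∧ (w5-type j ≡ᵗ s) ∧ anyF (w5-end t j)

  w5-edge : Ty × Ty → Bool
  w5-edge (s , t) = anyF (w5-start s t)

  w5-m2 : Fin 5 → Bool
  w5-m2 j = not (j == i₀) ∧ (w5-type j ≡ᵗ m2)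

  w5-pair : Fin 9 → Bool
  w5-pair i = w5-edge (proj₁ (two-edges i)) ∧ w5-edge (proj₂ (two-edges i))

  w5-two : Bool
  w5-two = anyF w5-m2 ∨ anyF w5-pair

-- Seven vertices are enough: a copy of W5 through c, extended by b and then by a. The test for W5
-- through b alone comes before that for both.
w5-two-body : Fin 5 × Vec Bool 5 × Vec Bool 5 → Bool
w5-two-body (i₀ , rb , ra) = lookup rb i₀ ⇒ not (lookup ra i₀) ⇒ not (w5on (mat (w5rows ▷ rb)) first-one) ⇒
    not (w5on (mat (w5rows ▷ rb ▷ (true ∷ ra))) first-two) ⇒ w5-two i₀ rb ra

-- The tournament induced on X and two edges x ~ y, x' ~ y' of types (s , t), (s' , t') in different components.
rows-two : Ty → Ty → Ty → Ty → Rows 7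
rows-two s t s' t' = base ▷ s ▷ (not (def t s) ∷ t) ▷ (def s' t ∷ def s' s ∷ s') ▷ (not (def t' s') ∷ def t' t ∷ def t' s ∷ t')

compatible : Ty × Ty → Ty × Ty → Bool
compatible (s , t) (s' , t') = pairᵇ s t (s' , t') ∨
  (not (s ≡ᵗ s') ∧ not (s ≡ᵗ t') ∧ not (t ≡ᵗ s') ∧ not (t ≡ᵗ t') ∧ not (w5ab 4 (rows-two s t s' t')))

allowed : Ty × Ty → Bool
allowed (s , t) = not (block s ≡ᴮ block t) ∧ not (w5ab 2 (base ▷ s ▷ (not (def t s) ∷ t)))

-- Contains every allowed edge without the type `m2` that is compatible with both edges of the pair.
-- Pairs 4 and 5 lead to the same matching because each consists of two of the three edges of
-- `famL*`.
closed-under : Fin 9 → Matching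
closed-under 0F = famH
closed-under 1F = famI
closed-under 2F = famJ
closed-under 3F = famJ*
closed-under _ = famL*

closed-body : Fin 9 × Ty × Ty → Bool
closed-body (i , s , t) = not (i ≡8) ⇒ not (s ≡ᵗ m2) ⇒ not (t ≡ᵗ m2) ⇒ allowed (s , t) ⇒ compatible (s , t) (proj₁ (two-edges i)) ⇒
    compatible (s , t) (proj₂ (two-edges i)) ⇒ matched (closed-under i) s t
  where
  -- From index 6 on the pairs contain the type `m2`, which the choice of c excludes.
  _≡8 : Fin 9 → Bool
  i ≡8 = 6 ≤ᵇ toℕ i

opaque
  unfolding w5on

  w5-two-check : ∀ q → w5-two-body q ≡ true
  w5-two-check = sound (index 5 ⊗ bits 5 ⊗ bits 5) w5-two-body refl

  closed-check : ∀ q → closed-body q ≡ true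
  closed-check = sound (index 9 ⊗ ty ⊗ ty) closed-body refl

module Families {n : ℕ} (T : Tournament n) (a b c : Fin n)
  (ab : T ∶ a ⟶ b) (bc : T ∶ b ⟶ c) (ca : T ∶ c ⟶ a) where

  open Cycle T a b c ab bc ca

  HasEdge : Ty × Ty → Set
  HasEdge (s , t) = ∃₂ λ x y → Outside x × Outside y × x ~ y ≡ true × τ x ≡ s × τ y ≡ t

  record Family (l : Matching) : Set where
    field
      edge : ∀ {x y} → Outside x → Outside y → x ~ y ≡ true → matched l (τ x) (τ y) ≡ true
      real : ∀ s t → matched l s t ≡ true → HasEdge (s , t)

  open Family public

  hasEdge-sym : ∀ {s t} → HasEdge (s , t) → HasEdge (t , s)
  hasEdge-sym (x , y , ox , oy , h , e , e') = y , x , oy , ox , ~-sym⁺ {x} {y} h , e' , e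

  hasEdge? : ∀ e → Dec (HasEdge e)
  hasEdge? (s , t) with any? (λ x → any? λ y → (outᵇ x ≟ᴮ true) ×-dec ((outᵇ y ≟ᴮ true) ×-dec ((x ~ y ≟ᴮ true) ×-dec
    (((τ x ≡ᵗ s) ≟ᴮ true) ×-dec ((τ y ≡ᵗ t) ≟ᴮ true)))))
  ... | yes (x , y , ox , oy , h , e , e') = yes (x , y , outside⁻ x ox , outside⁻ y oy , h , ≡ᵗ⁻ (τ x) s e , ≡ᵗ⁻ (τ y) t e')
  ... | no none = no λ where
    (x , y , ox , oy , h , refl , refl) → none (x , y , outside⁺ ox , outside⁺ oy , h , ≡ᵗ-refl (τ x) , ≡ᵗ-refl (τ y))

pair⁻ : ∀ s t e → pairᵇ s t e ≡ true → (s , t) ≡ e ⊎ (t , s) ≡ e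
pair⁻ s t (s' , t') h with ∨⁻ {(s ≡ᵗ s') ∧ (t ≡ᵗ t')} h
... | inj₁ q = let (q₁ , q₂) = ∧⁻ {s ≡ᵗ s'} q in inj₁ (cong₂ _,_ (≡ᵗ⁻ s s' q₁) (≡ᵗ⁻ t t' q₂))
... | inj₂ q = let (q₁ , q₂) = ∧⁻ {s ≡ᵗ t'} q in inj₂ (cong₂ _,_ (≡ᵗ⁻ t s' q₂) (≡ᵗ⁻ s t' q₁))

module W5Copy {n : ℕ} (T : Tournament n) (a b : Fin n) (na : ¬ InW5 T a) (nb : ¬ InW5 T b) (a⟶b : T ∶ a ⟶ b)
  (f : Fin 5 → Fin n) (f-inj : ∀ {i j} → f i ≡ f j → i ≡ j) (arcs : ∀ i j → arc T (f i) (f j) ≡ arcW5 i j) where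

  fs : Vec (Fin n) 5
  fs = f 0F ∷ f 1F ∷ f 2F ∷ f 3F ∷ f 4F ∷ []

  fs-lookup : ∀ j → lookup fs j ≡ f j
  fs-lookup 0F = refl
  fs-lookup 1F = refl
  fs-lookup 2F = refl
  fs-lookup 3F = refl
  fs-lookup 4F = refl

  f≢ : ∀ {i j} → i ≢ j → f i ≢ f j
  f≢ ne e = ne (f-inj e)

  fs-distinct : Distinct fs
  fs-distinct = (f≢ (λ ()) ∷ f≢ (λ ()) ∷ f≢ (λ ()) ∷ f≢ (λ ()) ∷ []) ∷ (f≢ (λ ()) ∷ f≢ (λ ()) ∷ f≢ (λ ()) ∷ []) ∷
    (f≢ (λ ()) ∷ f≢ (λ ()) ∷ []) ∷ (f≢ (λ ()) ∷ []) ∷ [] ∷ []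

  fs-rows : rowsOf T fs ≡ w5rows
  fs-rows rewrite arcs 0F 1F | arcs 0F 2F | arcs 0F 3F | arcs 0F 4F | arcs 1F 2F | arcs 1F 3F | arcs 1F 4F | arcs 2F 3F | arcs 2F 4F | arcs 3F 4F = refl

  a≢f : ∀ j → a ≢ f j
  a≢f j e = na (f , (λ {i} {j} → f-inj {i} {j}) , arcs , j , sym e)

  b≢f : ∀ j → b ≢ f j
  b≢f j e = nb (f , (λ {i} {j} → f-inj {i} {j}) , arcs , j , sym e)

  bfs-distinct : Distinct (b ∷ fs)
  bfs-distinct = (b≢f 0F ∷ b≢f 1F ∷ b≢f 2F ∷ b≢f 3F ∷ b≢f 4F ∷ []) ∷ fs-distinct

  abfs-distinct : Distinct (a ∷ b ∷ fs)
  abfs-distinct = (arc⇒≢ T a⟶b ∷ a≢f 0F ∷ a≢f 1F ∷ a≢f 2F ∷ a≢f 3F ∷ a≢f 4F ∷ []) ∷ bfs-distinct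

  row : Fin n → Vec Bool 5
  row v = map (arc T v) fs

  row-lookup : ∀ v j → lookup (row v) j ≡ arc T v (f j)
  row-lookup v j = trans (lookup-map j (arc T v) fs) (cong (arc T v) (fs-lookup j))

  no₆ : w5on (mat (w5rows ▷ row b)) first-one ≡ false
  no₆ = refute λ h → contra (w5on-sound T {vs = b ∷ fs} bfs-distinct first-one (trans (cong (λ R → w5on (mat (R ▷ row b)) first-one) fs-rows) h))
    where
    contra : (∃ λ i → first-one i ≡ true × InW5 T (lookup (b ∷ fs) i)) → ⊥
    contra (zero , _ , w) = nb w

  no₇ : w5on (mat (w5rows ▷ row b ▷ (true ∷ row a))) first-two ≡ false
  no₇ = refute λ h → contra (w5on-sound T {vs = a ∷ b ∷ fs} abfs-distinct first-two (trans (cong₂ (λ R r → w5on (mat (R ▷ row b ▷ (r ∷ row a))) first-two) fs-rows a⟶b) h))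
    where
    contra : (∃ λ i → first-two i ≡ true × InW5 T (lookup (a ∷ b ∷ fs) i)) → ⊥
    contra (zero , _ , w) = na w
    contra (suc zero , _ , w) = nb w

module TwoEdges {n : ℕ} (T : Tournament n) (a b c : Fin n)
  (ab : T ∶ a ⟶ b) (bc : T ∶ b ⟶ c) (ca : T ∶ c ⟶ a) (loc : Cycle.Local T a b c ab bc ca) where

  open Cycle T a b c ab bc ca
  open Local loc

  adj-true : ∀ {x y} → x ~ y ≡ true → arc T y x ≡ not (def (τ y) (τ x))
  adj-true {x} {y} h = go (arc T y x) (def (τ y) (τ x)) (proj₂ (∧⁻ {not (block (τ y) ≡ᴮ block (τ x))} (~-sym⁺ {x} {y} h)))
    where
    go : ∀ r s → (r xor s) ≡ true → r ≡ not s
    go true false _ = refl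
    go false true _ = refl

  -- As the types differ, `l1` forbids adjacency between the two edges, and `l2` then makes all four
  -- arcs between them default ones: the seven vertices are determined by the four types alone.
  module Apart {x y x' y' : Fin n} (ox : Outside x) (oy : Outside y) (ox' : Outside x') (oy' : Outside y')
    (xy : x ~ y ≡ true) (x'y' : x' ~ y' ≡ true) (e₁ : (τ x ≡ᵗ τ x') ≡ false) (e₂ : (τ x ≡ᵗ τ y') ≡ false)
    (e₃ : (τ y ≡ᵗ τ x') ≡ false) (e₄ : (τ y ≡ᵗ τ y') ≡ false) where

    private
      yx : y ~ x ≡ true
      yx = ~-sym⁺ {x} {y} xy
      ne : ∀ {u v} → (τ u ≡ᵗ τ v) ≡ false → v ≢ u
      ne {u} e refl = true≢false (≡ᵗ-refl (τ u)) e
      non : ∀ {u v w} → Outside u → Outside v → Outside w → w ~ u ≡ true → (τ u ≡ᵗ τ v) ≡ false → v ~ w ≡ false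
      non {u} {v} {w} ou ov ow wu e = refute (λ h → true≢false (subst (λ t → (τ u ≡ᵗ t) ≡ true) (l1 ow ou ov wu (~-sym⁺ {v} {w} h)) (≡ᵗ-refl (τ u))) e)
      x'~x : x' ~ x ≡ false
      x'~x = non oy ox' ox xy e₃
      x'~y : x' ~ y ≡ false
      x'~y = non ox ox' oy yx e₁
      y'~x : y' ~ x ≡ false
      y'~x = non oy oy' ox xy e₄
      y'~y : y' ~ y ≡ false
      y'~y = non ox oy' oy yx e₂

    outer-distinct : ∀ {k} {vs : Vec (Fin n) k} → All (y' ≢_) vs → All (x' ≢_) vs → All (y ≢_) vs → All (x ≢_) vs → Distinct vs →
      Distinct (y' ∷ x' ∷ y ∷ x ∷ vs)
    outer-distinct p q r s d = (≢-sym (~⇒≢ x'y') ∷ ne e₄ ∷ ne e₂ ∷ p) ∷ (ne e₃ ∷ ne e₁ ∷ q) ∷ (≢-sym (~⇒≢ xy) ∷ r) ∷ s ∷ d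

    dis : Distinct (y' ∷ x' ∷ y ∷ x ∷ X)
    dis = outer-distinct oy' ox' oy ox X-distinct

    outer-rows : ∀ {k} (vs : Vec (Fin n) k) → let row = λ v → map (arc T v) vs in
      rowsOf T (y' ∷ x' ∷ y ∷ x ∷ vs) ≡ rowsOf T vs ▷ row x ▷ (not (def (τ y) (τ x)) ∷ row y) ▷
        (def (τ x') (τ y) ∷ def (τ x') (τ x) ∷ row x') ▷ (not (def (τ y') (τ x')) ∷ def (τ y') (τ y) ∷ def (τ y') (τ x) ∷ row y')
    outer-rows vs =
      cong₂ _▷_ (cong₂ _▷_ (cong (λ r → rowsOf T vs ▷ map (arc T x) vs ▷ (r ∷ map (arc T y) vs)) (adj-true xy))
        (cong₂ (λ r r' → r ∷ r' ∷ map (arc T x') vs) (l2 oy ox ox' yx x'~x x'~y (ne e₃)) (l2 ox oy ox' xy x'~y x'~x (ne e₁))))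
        (cong₂ _∷_ (adj-true x'y') (cong₂ (λ r r' → r ∷ r' ∷ map (arc T y') vs) (l2 oy ox oy' yx y'~x y'~y (ne e₄)) (l2 ox oy oy' xy y'~y y'~x (ne e₂))))

    rows : rowsOf T (y' ∷ x' ∷ y ∷ x ∷ X) ≡ rows-two (τ x) (τ y) (τ x') (τ y')
    rows = trans (outer-rows X) (cong (λ R → R ▷ τ x ▷ (not (def (τ y) (τ x)) ∷ τ y) ▷ (def (τ x') (τ y) ∷ def (τ x') (τ x) ∷ τ x') ▷
      (not (def (τ y') (τ x')) ∷ def (τ y') (τ y) ∷ def (τ y') (τ x) ∷ τ y')) X-rows)

module Classify {n : ℕ} (T : Tournament n) (a b : Fin n) (na : ¬ InW5 T a) (nb : ¬ InW5 T b)
  (c : Fin n) (ab : T ∶ a ⟶ b) (bc : T ∶ b ⟶ c) (ca : T ∶ c ⟶ a)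
  (loc : Cycle.Local T a b c ab bc ca) where

  open Cycle T a b c ab bc ca
  open Local loc
  open Structure T a b c ab bc ca loc
  open AvoidingW5 T a b na nb c ab bc ca using (no-w5ab)
  open TwoEdges T a b c ab bc ca loc
  open Families T a b c ab bc ca

  edge-allowed : ∀ {x y} → Outside x → Outside y → x ~ y ≡ true → allowed (τ x , τ y) ≡ true
  edge-allowed {x} {y} ox oy h = ∧⁺ (not⁺ (adj-diff (τ x) (τ y) (arc T x y) h))
    (not⁺ (trans (cong (w5ab 2) (sym rows)) (no-w5ab (y ∷ x ∷ []) ((≢-sym (~⇒≢ h) ∷ oy) ∷ ox ∷ X-distinct))))
    where
    rows : rowsOf T (y ∷ x ∷ X) ≡ base ▷ τ x ▷ (not (def (τ y) (τ x)) ∷ τ y)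
    rows = cong₂ (λ R r → R ▷ τ x ▷ (r ∷ τ y)) X-rows (adj-true h)

  -- A common type of the two edges makes their type pairs coincide by `partner-type`. Without one
  -- the edges are `Apart`, and `rows-two` is a real configuration, in which a and b avoid W5.
  edges-compatible : ∀ {x y x' y'} → Outside x → Outside y → Outside x' → Outside y' → x ~ y ≡ true → x' ~ y' ≡ true →
    compatible (τ x , τ y) (τ x' , τ y') ≡ true
  edges-compatible {x} {y} {x'} {y'} ox oy ox' oy' xy x'y' =
    by (bool-case (τ x ≡ᵗ τ x')) (bool-case (τ x ≡ᵗ τ y')) (bool-case (τ y ≡ᵗ τ x')) (bool-case (τ y ≡ᵗ τ y'))
    where
    yx : y ~ x ≡ true
    yx = ~-sym⁺ {x} {y} xy
    y'x' : y' ~ x' ≡ true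
    y'x' = ~-sym⁺ {x'} {y'} x'y'
    eqᵗ : ∀ {s t : Ty} → s ≡ t → (s ≡ᵗ t) ≡ true
    eqᵗ {s} refl = ≡ᵗ-refl s
    straight : τ x ≡ τ x' → τ y ≡ τ y' → compatible (τ x , τ y) (τ x' , τ y') ≡ true
    straight e e' = ∨⁺ˡ (∨⁺ˡ (∧⁺ (eqᵗ e) (eqᵗ e')))
    crossed : τ x ≡ τ y' → τ y ≡ τ x' → compatible (τ x , τ y) (τ x' , τ y') ≡ true
    crossed e e' = ∨⁺ˡ (∨⁺ʳ {(τ x ≡ᵗ τ x') ∧ (τ y ≡ᵗ τ y')} (∧⁺ (eqᵗ e) (eqᵗ e')))
    apart : ∀ {s t : Ty} → (s ≡ᵗ t) ≡ false → ¬ (s ≡ t)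
    apart e e' = true≢false (eqᵗ e') e
    by : (τ x ≡ᵗ τ x') ≡ true ⊎ (τ x ≡ᵗ τ x') ≡ false → (τ x ≡ᵗ τ y') ≡ true ⊎ (τ x ≡ᵗ τ y') ≡ false →
      (τ y ≡ᵗ τ x') ≡ true ⊎ (τ y ≡ᵗ τ x') ≡ false → (τ y ≡ᵗ τ y') ≡ true ⊎ (τ y ≡ᵗ τ y') ≡ false →
      compatible (τ x , τ y) (τ x' , τ y') ≡ true
    by (inj₁ e) _ _ _ = straight (≡ᵗ⁻ (τ x) (τ x') e) (partner-type ox ox' oy oy' (≡ᵗ⁻ (τ x) (τ x') e) xy x'y')
    by _ (inj₁ e) _ _ = crossed (≡ᵗ⁻ (τ x) (τ y') e) (partner-type ox oy' oy ox' (≡ᵗ⁻ (τ x) (τ y') e) xy y'x')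
    by _ _ (inj₁ e) _ = crossed (partner-type oy ox' ox oy' (≡ᵗ⁻ (τ y) (τ x') e) yx x'y') (≡ᵗ⁻ (τ y) (τ x') e)
    by _ _ _ (inj₁ e) = straight (partner-type oy oy' ox ox' (≡ᵗ⁻ (τ y) (τ y') e) yx y'x') (≡ᵗ⁻ (τ y) (τ y') e)
    by (inj₂ e₁) (inj₂ e₂) (inj₂ e₃) (inj₂ e₄) = ∨⁺ʳ {pairᵇ (τ x) (τ y) (τ x' , τ y')}
        (∧⁺ (not⁺ e₁) (∧⁺ (not⁺ e₂) (∧⁺ (not⁺ e₃) (∧⁺ (not⁺ e₄) (not⁺ (trans (cong (w5ab 4) (sym rows))
          (no-w5ab (y' ∷ x' ∷ y ∷ x ∷ []) dis)))))))
      where open Apart ox oy ox' oy' xy x'y' e₁ e₂ e₃ e₄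

  module _ (wc : InW5 T c) (no-m2 : ∀ x → Outside x → τ x ≢ m2) where

    private
      f : Fin 5 → Fin n
      f = proj₁ wc
      f-inj : ∀ {i j} → f i ≡ f j → i ≡ j
      f-inj = proj₁ (proj₂ wc)
      arcs : ∀ i j → arc T (f i) (f j) ≡ arcW5 i j
      arcs = proj₁ (proj₂ (proj₂ wc))
      i₀ : Fin 5
      i₀ = proj₁ (proj₂ (proj₂ (proj₂ wc)))
      fi₀ : f i₀ ≡ c
      fi₀ = proj₂ (proj₂ (proj₂ (proj₂ wc)))
      open W5Copy T a b na nb ab f (λ {i} {j} → f-inj {i} {j}) arcs
      ra rb : Vec Bool 5
      ra = row a
      rb = row b
      result : w5-two i₀ rb ra ≡ true
      result = ⇒⁻ {not (w5on (mat (w5rows ▷ rb ▷ (true ∷ ra))) first-two)} (⇒⁻ {not (w5on (mat (w5rows ▷ rb)) first-one)}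
        (⇒⁻ {not (lookup ra i₀)} (⇒⁻ {lookup rb i₀} (w5-two-check (i₀ , rb , ra))
          (trans (row-lookup b i₀) (trans (cong (arc T b) fi₀) bc)))
          (not⁺ (trans (row-lookup a i₀) (trans (cong (arc T a) fi₀) (asym T c a ca)))))
        (not⁺ no₆)) (not⁺ no₇)
      type≡ : ∀ j → w5-type i₀ rb ra j ≡ τ (f j)
      type≡ j = cong₂ _∷_ (trans (cong not (row-lookup a j)) (sym (flip-arc T (a≢f j))))
        (cong₂ _∷_ (trans (cong not (row-lookup b j)) (sym (flip-arc T (b≢f j))))
        (cong (_∷ []) (trans (sym (arcs j i₀)) (cong (arc T (f j)) fi₀))))
      f-outside : ∀ j → not (j == i₀) ≡ true → Outside (f j)
      f-outside j h = ≢-sym (a≢f j) ∷ ≢-sym (b≢f j) ∷ (λ e → undoes⁻ (j ≟ i₀) (not-true⁻ h) (f-inj (trans e (sym fi₀)))) ∷ []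
      decode : ∀ s t → w5-edge i₀ rb ra (s , t) ≡ true → HasEdge (s , t)
      decode s t h =
        let (j , h₁) = anyF⁻ {f = w5-start i₀ rb ra s t} h
            (nj , h₂) = ∧⁻ {not (j == i₀)} h₁
            (ej , h₃) = ∧⁻ {w5-type i₀ rb ra j ≡ᵗ s} h₂
            (k , h₄) = anyF⁻ {f = w5-end i₀ rb ra t j} h₃
            (nk , h₅) = ∧⁻ {not (k == i₀)} h₄
            (ek , h₆) = ∧⁻ {w5-type i₀ rb ra k ≡ᵗ t} h₅
        in f j , f k , f-outside j nj , f-outside k nk ,
           trans (cong₂ (λ u v → adj u v (arc T (f j) (f k))) (sym (type≡ j)) (sym (type≡ k))) (trans (cong (adj (w5-type i₀ rb ra j) (w5-type i₀ rb ra k)) (arcs j k)) h₆) ,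
           trans (sym (type≡ j)) (≡ᵗ⁻ (w5-type i₀ rb ra j) s ej) , trans (sym (type≡ k)) (≡ᵗ⁻ (w5-type i₀ rb ra k) t ek)

    two-edges-exist : ∃ λ i → HasEdge (proj₁ (two-edges i)) × HasEdge (proj₂ (two-edges i))
    two-edges-exist = [ no-first , two ]′ (∨⁻ {anyF (w5-m2 i₀ rb ra)} {anyF (w5-pair i₀ rb ra)} result)
      where
      Goal : Set
      Goal = ∃ λ i → HasEdge (proj₁ (two-edges i)) × HasEdge (proj₂ (two-edges i))
      no-first : anyF (w5-m2 i₀ rb ra) ≡ true → Goal
      no-first h = let (j , h₁) = anyF⁻ {f = w5-m2 i₀ rb ra} h
                       (nj , ej) = ∧⁻ {not (j == i₀)} h₁
                   in ⊥-elim (no-m2 (f j) (f-outside j nj) (trans (sym (type≡ j)) (≡ᵗ⁻ (w5-type i₀ rb ra j) m2 ej)))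
      two : anyF (w5-pair i₀ rb ra) ≡ true → Goal
      two h = let (i , h₁) = anyF⁻ {f = w5-pair i₀ rb ra} h
                  (h₂ , h₃) = ∧⁻ {w5-edge i₀ rb ra (proj₁ (two-edges i))} h₁
              in i , decode (proj₁ (proj₁ (two-edges i))) (proj₂ (proj₁ (two-edges i))) h₂ , decode (proj₁ (proj₂ (two-edges i))) (proj₂ (proj₂ (two-edges i))) h₃

    private
      edges-in : ∀ i → (6 ≤ᵇ toℕ i) ≡ false → HasEdge (proj₁ (two-edges i)) → HasEdge (proj₂ (two-edges i)) →
        ∀ {x y} → Outside x → Outside y → x ~ y ≡ true → matched (closed-under i) (τ x) (τ y) ≡ true
      edges-in i small e₁ e₂ {x} {y} ox oy xy =
        ⇒⁻ {compatible (τ x , τ y) (proj₂ (two-edges i))} (⇒⁻ {compatible (τ x , τ y) (proj₁ (two-edges i))} (⇒⁻ {allowed (τ x , τ y)}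
        (⇒⁻ {not (τ y ≡ᵗ m2)} (⇒⁻ {not (τ x ≡ᵗ m2)} (⇒⁻ {not (6 ≤ᵇ toℕ i)} (closed-check (i , τ x , τ y))
          (not⁺ small)) (not⁺ (not-m2 x ox))) (not⁺ (not-m2 y oy))) (edge-allowed ox oy xy)) (compat (proj₁ (two-edges i)) e₁)) (compat (proj₂ (two-edges i)) e₂)
        where
        not-m2 : ∀ x → Outside x → (τ x ≡ᵗ m2) ≡ false
        not-m2 x ox = refute (λ h → no-m2 x ox (≡ᵗ⁻ (τ x) m2 h))
        compat : ∀ e → HasEdge e → compatible (τ x , τ y) e ≡ true
        compat (s , t) (x' , y' , ox' , oy' , h , refl , refl) = edges-compatible ox oy ox' oy' xy h

      Edges : Matching → Set
      Edges [] = ⊤₀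
      Edges (e ∷ l) = HasEdge e × Edges l

      edges-real : ∀ l → Edges l → ∀ s t → matched l s t ≡ true → HasEdge (s , t)
      edges-real (e ∷ l) (h , hs) s t q with ∨⁻ {pairᵇ s t e} q
      ... | inj₂ q' = edges-real l hs s t q'
      ... | inj₁ q' with pair⁻ s t e q'
      ...   | inj₁ refl = h
      ...   | inj₂ refl = hasEdge-sym h

      without : ∀ l e {x y} → ¬ HasEdge e → Outside x → Outside y → x ~ y ≡ true → matched (e ∷ l) (τ x) (τ y) ≡ true → matched l (τ x) (τ y) ≡ true
      without l e {x} {y} none ox oy xy h with ∨⁻ {pairᵇ (τ x) (τ y) e} h
      ... | inj₂ h' = h'
      ... | inj₁ h' with pair⁻ (τ x) (τ y) e h'
      ...   | inj₁ refl = ⊥-elim (none (x , y , ox , oy , xy , refl , refl))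
      ...   | inj₂ refl = ⊥-elim (none (y , x , oy , ox , ~-sym⁺ {x} {y} xy , refl , refl))

      reorder : ∀ l l' → every (ty ⊗ ty) (λ (s , t) → matched l s t ⇒ matched l' s t) ≡ true → ∀ s t → matched l s t ≡ true → matched l' s t ≡ true
      reorder l l' chk s t = ⇒⁻ (sound (ty ⊗ ty) (λ (s , t) → matched l s t ⇒ matched l' s t) chk (s , t))

    Outcome : Set
    Outcome = Family famH ⊎ Family famI ⊎ Family famJ ⊎ Family famJ* ⊎ Family famK* ⊎ Family famL* ⊎ Family famF

    private
      inH : HasEdge (p0 , m∅) → HasEdge (p∅ , m1) → Outcome
      inH e₁ e₂ = inj₁ record { edge = edges-in 0F refl e₁ e₂ ; real = edges-real famH (e₁ , e₂ , tt) }

      inI : HasEdge (p0 , p2) → HasEdge (p1 , m0) → Outcome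
      inI e₁ e₂ = inj₂ (inj₁ record { edge = edges-in 1F refl e₁ e₂ ; real = edges-real famI (e₁ , e₂ , tt) })

      inJ : HasEdge (p1 , m∅) → HasEdge (m1 , m0) → Outcome
      inJ e₁ e₂ = inj₂ (inj₂ (inj₁ record { edge = edges-in 2F refl e₁ e₂ ; real = edges-real famJ (e₁ , e₂ , tt) }))

      inJ* : HasEdge (m0 , p∅) → HasEdge (p0 , p1) → Outcome
      inJ* e₁ e₂ = inj₂ (inj₂ (inj₂ (inj₁ record { edge = edges-in 3F refl e₁ e₂ ; real = edges-real famJ* (e₁ , e₂ , tt) })))

      inL* : (∀ {x y} → Outside x → Outside y → x ~ y ≡ true → matched famL* (τ x) (τ y) ≡ true) →
        HasEdge (m0 , p∅) → HasEdge (m1 , p2) → HasEdge (m∅ , p1) → Outcome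
      inL* ed e₁ e₂ e₃ = inj₂ (inj₂ (inj₂ (inj₂ (inj₂ (inj₁ record { edge = ed ; real = edges-real famL* (e₁ , e₂ , e₃ , tt) })))))

      -- The two given edges occur in K* and in L*; whether the third edge of `famL*` is realised
      -- decides between them.
      inK* : HasEdge (m0 , p∅) → HasEdge (m1 , p2) → Dec (HasEdge (m∅ , p1)) → Outcome
      inK* e₁ e₂ (yes e₃) = inL* (edges-in 4F refl e₁ e₂) e₁ e₂ e₃
      inK* e₁ e₂ (no none) = inj₂ (inj₂ (inj₂ (inj₂ (inj₁ record
        { edge = λ {x} {y} ox oy xy → without famK* (m∅ , p1) none ox oy xy (reorder famL* ((m∅ , p1) ∷ famK*) refl (τ x) (τ y) (edges-in 4F refl e₁ e₂ ox oy xy))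
        ; real = edges-real famK* (e₁ , e₂ , tt) }))))

      inF : HasEdge (p1 , m∅) → HasEdge (m1 , p2) → Dec (HasEdge (m0 , p∅)) → Outcome
      inF e₁ e₂ (yes e₃) = inL* (edges-in 5F refl e₁ e₂) e₃ e₂ (hasEdge-sym e₁)
      inF e₁ e₂ (no none) = inj₂ (inj₂ (inj₂ (inj₂ (inj₂ (inj₂ record
        { edge = λ {x} {y} ox oy xy → without famF (m0 , p∅) none ox oy xy (reorder famL* ((m0 , p∅) ∷ famF) refl (τ x) (τ y) (edges-in 5F refl e₁ e₂ ox oy xy))
        ; real = edges-real famF (e₁ , e₂ , tt) })))))

      absent : ∀ {s} → HasEdge (s , m2) → Outcome
      absent (_ , y , _ , oy , _ , _ , e) = ⊥-elim (no-m2 y oy e)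

      by-index : ∀ i → HasEdge (proj₁ (two-edges i)) → HasEdge (proj₂ (two-edges i)) → Outcome
      by-index 0F e₁ e₂ = inH e₁ e₂
      by-index 1F e₁ e₂ = inI e₁ e₂
      by-index 2F e₁ e₂ = inJ e₁ e₂
      by-index 3F e₁ e₂ = inJ* e₁ e₂
      by-index 4F e₁ e₂ = inK* e₁ e₂ (hasEdge? (m∅ , p1))
      by-index 5F e₁ e₂ = inF e₁ e₂ (hasEdge? (m0 , p∅))
      by-index 6F _ e₂ = absent e₂
      by-index 7F _ e₂ = absent e₂
      by-index (suc (suc (suc (suc (suc (suc (suc (suc _)))))))) _ e₂ = absent e₂

    outcome : Outcome
    outcome = let (i , e₁ , e₂) = two-edges-exist in by-index i e₁ e₂

-- Choice of the third vertex and duality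

record Avoids {n : ℕ} (T : Tournament n) (a b : Fin n) : Set where
  field
    prime : Prime T allᵛ
    na    : ¬ InW5 T a
    nb    : ¬ InW5 T b
    cover : ∀ v → v ≢ a → v ≢ b → InW5 T v
    a⟶b   : T ∶ a ⟶ b

record CycleWith {n : ℕ} (T : Tournament n) (a b c : Fin n) : Set where
  field
    ab : T ∶ a ⟶ b
    bc : T ∶ b ⟶ c
    ca : T ∶ c ⟶ a

module At {n : ℕ} (T : Tournament n) (a b c : Fin n) (cyc : CycleWith T a b c) where
  open CycleWith cyc public
  open Cycle T a b c ab bc ca public
  open Families T a b c ab bc ca public

avoids⇒local : ∀ {n} {T : Tournament n} {a b c} → Avoids T a b → (cyc : CycleWith T a b c) → At.Local T a b c cyc
avoids⇒local {T = T} {a} {b} {c} av cyc = Cycle.noSix⇒Local T a b c ab bc ca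
    (AvoidingW5.noSix T a b na nb c ab bc ca prime cover)
  where
  open Avoids av
  open CycleWith cyc

module _ {n : ℕ} {T : Tournament n} {a b : Fin n} (av : Avoids T a b) where
  open Avoids av

  -- c minimises its indegree among the vertices closing a 3-cycle with a → b.
  source-cycle : ∃ (CycleWith T a b) → ∃ λ c → Σ (CycleWith T a b c) λ cyc →
    ∀ x → At.Outside T a b c cyc x → At.τ T a b c cyc x ≢ m2
  source-cycle (c₀ , cyc₀) with argmin closing (λ c → count (into c)) (c₀ , ∧⁺ (CycleWith.bc cyc₀) (CycleWith.ca cyc₀))
    where
    closing : VSet n
    closing x = arc T b x ∧ arc T x a
    into : Fin n → VSet n
    into c y = (arc T b y ∧ arc T y a) ∧ arc T y c
  ... | c , clc , least = c , cyc , no-m2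
    where
    closing : VSet n
    closing x = arc T b x ∧ arc T x a
    into : Fin n → VSet n
    into c y = closing y ∧ arc T y c
    cyc : CycleWith T a b c
    cyc = record { ab = a⟶b ; bc = proj₁ (∧⁻ {arc T b c} clc) ; ca = proj₂ (∧⁻ {arc T b c} clc) }
    open At T a b c cyc hiding (ab; bc; ca)
    loc : Local
    loc = avoids⇒local av cyc
    no-m2 : ∀ x → Outside x → τ x ≢ m2
    no-m2 x ox@(x≢a ∷ x≢b ∷ x≢c ∷ []) e = <-irrefl refl (≤-trans (count-strict {f = into x} {into c} sub x in₁ in₂) (least x clx))
      where
      x⟶a : arc T x a ≡ true
      x⟶a = cong (λ t → lookup t 0F) e
      x⟶c : arc T x c ≡ true
      x⟶c = cong (λ t → lookup t 2F) e
      b⟶x : arc T b x ≡ true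
      b⟶x = trans (flip-arc T x≢b) (cong not (cong (λ t → lookup t 1F) e))
      clx : closing x ≡ true
      clx = ∧⁺ b⟶x x⟶a
      in₁ : into x x ≡ false
      in₁ = trans (cong (closing x ∧_) (irrefl T x)) (∧-zeroʳ (closing x))
      in₂ : into c x ≡ true
      in₂ = ∧⁺ clx x⟶c
      sub : into x ⊆ᵛ into c
      sub y h with ∧⁻ {closing y} h
      ... | cly , y⟶x with ∧⁻ {arc T b y} cly
      ...   | b⟶y , y⟶a with bool-case (arc T y c)
      ...     | inj₁ q = ∧⁺ cly q
      -- Now `x → c → y`, so `x` and `y` have the types `m2` and `p2` of one block. By `l1` no
      -- neighbour of `x` is one of `y`, and `l2` fixes their arc as `x → y`.
      ...     | inj₂ q = ⊥-elim (true≢false y⟶x (trans y-def (cong₂ def ey e)))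
        where
        y≢c : y ≢ c
        y≢c refl = true≢false y⟶x (asym T x y x⟶c)
        oy : Outside y
        oy = arc⇒≢ T y⟶a ∷ ≢-sym (arc⇒≢ T b⟶y) ∷ y≢c ∷ []
        ey : τ y ≡ p2
        ey = cong₂ _∷_ y⟶a (cong₂ _∷_ (asym T b y b⟶y) (cong (_∷ []) q))
        m2≢p2 : m2 ≢ p2
        m2≢p2 ()
        part : ∃ λ w → Outside w × x ~ w ≡ true
        part = Critical.partner T a b c (CycleWith.ab cyc) (CycleWith.bc cyc) (CycleWith.ca cyc) loc prime x ox
        y-def : arc T y x ≡ def (τ y) (τ x)
        y-def = let (w , ow , xw) = part in Local.l2 loc ox ow oy xw (refute (λ h → m2≢p2 (trans (sym e) (trans (Local.l1 loc ow ox oy (~-sym⁺ {x} {w} xw) (~-sym⁺ {y} {w} h)) ey))))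
                (~-same {y} {x} (trans (cong block ey) (sym (cong block e)))) (arc⇒≢ T y⟶x)

-- W5 is self-dual: reverse its transitive part and keep the fifth vertex.
InW5-dual : ∀ {n} {T T' : Tournament n} → (∀ x y → arc T' x y ≡ arc T y x) → ∀ {v} → InW5 T v → InW5 T' v
InW5-dual {T = T} {T'} opp {v} (f , _ , arcs , i , refl) =
  subst (InW5 T') (cong f (ρρ i)) (inW5 T' (f ∘ ρ) (λ j k → trans (opp _ _) (trans (arcs _ _) (ρ-arc j k))) (ρ i))
  where
  ρ : Fin 5 → Fin 5
  ρ = lookup (3F ∷ 2F ∷ 1F ∷ 0F ∷ 4F ∷ [])
  ρρ : ∀ i → ρ (ρ i) ≡ i
  ρρ i = ==⁻ _ _ (sound (index 5) (λ i → ρ (ρ i) == i) refl i)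
  ρ-arc : ∀ j k → arcW5 (ρ k) (ρ j) ≡ arcW5 j k
  ρ-arc j k = xor-false (not-true⁻ (sound (index 5 ⊗ index 5) (λ (j , k) → not (arcW5 (ρ k) (ρ j) xor arcW5 j k)) refl (j , k)))

Prime-dual : ∀ {n} {T T' : Tournament n} → (∀ x y → arc T' x y ≡ arc T y x) → ∀ {u} → Prime T u → Prime T' u
Prime-dual {T = T} {T'} opp pr f (sub , unif) = pr f (sub , λ x y z ux fx fy fz →
  let ne : ∀ {w} → f w ≡ true → w ≢ x
      ne = λ where fw refl → true≢false fw fx
  in flip-cong T (ne fy) (ne fz) (trans (sym (opp x y)) (trans (unif x y z ux fx fy fz) (opp x z))))

dual-avoids : ∀ {n} {T : Tournament n} {a b} → Avoids T a b → Avoids (dual T) b a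
dual-avoids {T = T} {a} {b} av = record
  { prime = Prime-dual {T = T} {dual T} (λ _ _ → refl) prime
  ; na = λ w → nb (InW5-dual {T = dual T} {T} (λ _ _ → refl) w)
  ; nb = λ w → na (InW5-dual {T = dual T} {T} (λ _ _ → refl) w)
  ; cover = λ v p q → InW5-dual {T = T} {dual T} (λ _ _ → refl) (cover v q p)
  ; a⟶b = a⟶b }
  where open Avoids av

-- Arcs are reversed, and the entries of a and b are exchanged because the dual has the arc from b
-- to a.
dualᵗ : Ty → Ty
dualᵗ (q ∷ r ∷ s ∷ []) = not r ∷ not q ∷ not s ∷ []

dual-cycle : ∀ {n} {T T' : Tournament n} → (∀ x y → arc T' x y ≡ arc T y x) → ∀ {a b c} → CycleWith T a b c → CycleWith T' b a c
dual-cycle opp cyc = record { ab = trans (opp _ _) ab ; bc = trans (opp _ _) ca ; ca = trans (opp _ _) bc }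
  where open CycleWith cyc

module DualFamily {n : ℕ} {T T' : Tournament n} (opp : ∀ x y → arc T' x y ≡ arc T y x) {a b c : Fin n}
  (cyc : CycleWith T a b c) (cyc' : CycleWith T' b a c) where

  private
    module S = At T a b c cyc
    module S' = At T' b a c cyc'

  out⁺ : ∀ {x} → S.Outside x → S'.Outside x
  out⁺ (p ∷ q ∷ r ∷ []) = q ∷ p ∷ r ∷ []

  out⁻ : ∀ {x} → S'.Outside x → S.Outside x
  out⁻ (p ∷ q ∷ r ∷ []) = q ∷ p ∷ r ∷ []

  type-dual : ∀ {x} → S.Outside x → S'.τ x ≡ dualᵗ (S.τ x)
  type-dual {x} (p ∷ q ∷ r ∷ []) = cong₂ _∷_ (neg q) (cong₂ _∷_ (neg p) (cong (_∷ []) (neg r)))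
    where
    neg : ∀ {y} → x ≢ y → arc T' x y ≡ not (arc T x y)
    neg ne = trans (opp _ _) (flip-arc T ne)

  edge-dual : ∀ {x y} → S.Outside x → S.Outside y → (x S'.~ y) ≡ (x S.~ y)
  edge-dual {x} {y} ox oy with x ≟ y
  ... | yes refl = trans (S'.~-same {x} {x} refl) (sym (S.~-same {x} {x} refl))
  ... | no x≢y = trans (cong₂ (λ s t → adj s t (arc T' x y)) (type-dual ox) (type-dual oy))
      (trans (cong (adj (dualᵗ (S.τ x)) (dualᵗ (S.τ y))) (trans (opp x y) (flip-arc T x≢y))) (dual-adj (S.τ x) (S.τ y) (arc T x y)))
    where
    dual-adj : ∀ s t r → adj (dualᵗ s) (dualᵗ t) (not r) ≡ adj s t r
    dual-adj s t r = xor-false (not-true⁻ (sound (ty ⊗ ty ⊗ bit) (λ (s , t , r) → not (adj (dualᵗ s) (dualᵗ t) (not r) xor adj s t r)) refl (s , t , r)))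

  family-dual : ∀ l l' → every (ty ⊗ ty) (λ (s , t) → not (matched l' s t xor matched l (dualᵗ s) (dualᵗ t))) ≡ true → S.Family l → S'.Family l'
  family-dual l l' chk fam = record
    { edge = λ {x} {y} ox oy h → trans (same (S'.τ x) (S'.τ y)) (trans (cong₂ (matched l) (back (out⁻ ox)) (back (out⁻ oy)))
        (S.edge fam (out⁻ ox) (out⁻ oy) (trans (sym (edge-dual (out⁻ ox) (out⁻ oy))) h)))
    ; real = λ s t h → let (x , y , ox , oy , xy , e , e') = S.real fam (dualᵗ s) (dualᵗ t) (trans (sym (same s t)) h) in
        x , y , out⁺ ox , out⁺ oy , trans (edge-dual ox oy) xy , trans (type-dual ox) (trans (cong dualᵗ e) (dual² s)) , trans (type-dual oy) (trans (cong dualᵗ e') (dual² t)) }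
    where
    dual² : ∀ s → dualᵗ (dualᵗ s) ≡ s
    dual² (q ∷ r ∷ s ∷ []) = cong₂ _∷_ (not-involutive q) (cong₂ _∷_ (not-involutive r) (cong (_∷ []) (not-involutive s)))
    back : ∀ {x} → S.Outside x → dualᵗ (S'.τ x) ≡ S.τ x
    back ox = trans (cong dualᵗ (type-dual ox)) (dual² _)
    same : ∀ s t → matched l' s t ≡ matched l (dualᵗ s) (dualᵗ t)
    same s t = xor-false (not-true⁻ (sound (ty ⊗ ty) (λ (s , t) → not (matched l' s t xor matched l (dualᵗ s) (dualᵗ t))) chk (s , t)))

data Main {n : ℕ} (T : Tournament n) (a b : Fin n) : Set where
  direct : ∀ c (cyc : CycleWith T a b c) → let open At T a b c cyc in
    Family famH ⊎ Family famI ⊎ Family famJ ⊎ Family famK ⊎ Family famL → Main T a b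
  dualed : ∀ c (cyc : CycleWith (dual T) b a c) → let open At (dual T) b a c cyc in
    Family famJ ⊎ Family famK ⊎ Family famL → Main T a b

main : ∀ {n} {T : Tournament n} {a b} → Avoids T a b → ∃ (CycleWith T a b) → Main T a b
main {n} {T} {a} {b} av ex with source-cycle av ex
... | c , cyc , no-m2 = first (Classify.outcome T a b na nb c ab bc ca loc (cover c (≢-sym a≢c) (≢-sym b≢c)) no-m2)
  where
  open Avoids av
  open At T a b c cyc
  loc : Local
  loc = avoids⇒local av cyc
  cyc* : CycleWith (dual T) b a c
  cyc* = dual-cycle {T = T} {dual T} (λ _ _ → refl) cyc
  open DualFamily {T = T} {dual T} (λ _ _ → refl) cyc cyc*
  -- The third vertex is chosen anew, as a source for the dual. A vertex `x` of type `m∅` for the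
  -- old cycle gets type `p∅` for the new one, and among the possible outcomes only H, J*, K* and L*
  -- contain that type; dualised back, they are classes of the list.
  second : Family famF → Main T a b
  second fam with real fam m∅ p1 refl
  ... | x , _ , ox@(x≢a ∷ x≢b ∷ x≢c ∷ []) , _ , _ , ex , _ with source-cycle (dual-avoids av) (c , cyc*)
  ...   | c' , cyc' , no-m2' = convert (Classify.outcome (dual T) b a (Avoids.na av*) (Avoids.nb av*) c' S'.ab S'.bc S'.ca loc'
              (Avoids.cover av* c' (≢-sym S'.a≢c) (≢-sym S'.b≢c)) no-m2')
    where
    av* : Avoids (dual T) b a
    av* = dual-avoids av
    module S' = At (dual T) b a c' cyc'
    loc' : S'.Local
    loc' = avoids⇒local av* cyc'
    cyc″ : CycleWith T a b c'
    cyc″ = dual-cycle {T = dual T} {T} (λ _ _ → refl) cyc'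
    module D = DualFamily {T = dual T} {T} (λ _ _ → refl) cyc' cyc″
    x⟶a : arc T x a ≡ true
    x⟶a = cong (λ t → lookup t 0F) ex
    x⟶b : arc T x b ≡ true
    x⟶b = cong (λ t → lookup t 1F) ex
    x≢c' : x ≢ c'
    x≢c' refl = true≢false x⟶b (asym T b x (CycleWith.bc cyc″))
    -- x is not adjacent to the vertices of type p2, so it dominates c'.
    x⟶c' : arc T x c' ≡ true
    x⟶c' with c' ≟ c
    ... | yes refl = cong (λ t → lookup t 2F) ex
    ... | no c'≢c = trans (adj-false (τ x) (τ c') (arc T x c') (cong₂ (λ s t → block s ≡ᴮ block t) ex ec')
          (refute (λ h → true≢false (trans (sym (cong₂ (matched famF) ex ec')) (edge fam ox oc' h)) refl))) (cong₂ def ex ec')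
      where
      oc' : Outside c'
      oc' = arc⇒≢ T (CycleWith.ca cyc″) ∷ ≢-sym (arc⇒≢ T (CycleWith.bc cyc″)) ∷ c'≢c ∷ []
      ec' : τ c' ≡ p2
      ec' with bool-case (arc T c' c)
      ... | inj₁ q = ⊥-elim (no-m2 c' oc' (cong₂ _∷_ (CycleWith.ca cyc″) (cong₂ _∷_ (asym T b c' (CycleWith.bc cyc″)) (cong (_∷ []) q))))
      ... | inj₂ q = cong₂ _∷_ (CycleWith.ca cyc″) (cong₂ _∷_ (asym T b c' (CycleWith.bc cyc″)) (cong (_∷ []) q))
    ox' : S'.Outside x
    ox' = x≢b ∷ x≢a ∷ x≢c' ∷ []
    ex' : S'.τ x ≡ p∅
    ex' = cong₂ _∷_ (asym T x b x⟶b) (cong₂ _∷_ (asym T x a x⟶a) (cong (_∷ []) (asym T x c' x⟶c')))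
    lacks : ∀ l → every ty (λ t → not (matched l p∅ t)) ≡ true → S'.Family l → ⊥
    lacks l chk fam' = let (y , oy , h) = Critical.partner (dual T) b a c' S'.ab S'.bc S'.ca loc' (Avoids.prime av*) x ox' in true≢false (trans (sym (cong (λ s → matched l s (S'.τ y)) ex')) (S'.edge fam' ox' oy h)) (not-true⁻ (sound ty (λ t → not (matched l p∅ t)) chk (S'.τ y)))
    convert : S'.Family famH ⊎ S'.Family famI ⊎ S'.Family famJ ⊎ S'.Family famJ* ⊎ S'.Family famK* ⊎ S'.Family famL* ⊎ S'.Family famF → Main T a b
    convert (inj₁ f) = direct c' cyc″ (inj₁ (D.family-dual famH famH refl f))
    convert (inj₂ (inj₁ f)) = ⊥-elim (lacks famI refl f)
    convert (inj₂ (inj₂ (inj₁ f))) = ⊥-elim (lacks famJ refl f)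
    convert (inj₂ (inj₂ (inj₂ (inj₁ f)))) = direct c' cyc″ (inj₂ (inj₂ (inj₁ (D.family-dual famJ* famJ refl f))))
    convert (inj₂ (inj₂ (inj₂ (inj₂ (inj₁ f))))) = direct c' cyc″ (inj₂ (inj₂ (inj₂ (inj₁ (D.family-dual famK* famK refl f)))))
    convert (inj₂ (inj₂ (inj₂ (inj₂ (inj₂ (inj₁ f)))))) = direct c' cyc″ (inj₂ (inj₂ (inj₂ (inj₂ (D.family-dual famL* famL refl f)))))
    convert (inj₂ (inj₂ (inj₂ (inj₂ (inj₂ (inj₂ f)))))) = ⊥-elim (lacks famF refl f)
  first : Family famH ⊎ Family famI ⊎ Family famJ ⊎ Family famJ* ⊎ Family famK* ⊎ Family famL* ⊎ Family famF → Main T a b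
  first (inj₁ f) = direct c cyc (inj₁ f)
  first (inj₂ (inj₁ f)) = direct c cyc (inj₂ (inj₁ f))
  first (inj₂ (inj₂ (inj₁ f))) = direct c cyc (inj₂ (inj₂ (inj₁ f)))
  first (inj₂ (inj₂ (inj₂ (inj₁ f)))) = dualed c cyc* (inj₁ (family-dual famJ* famJ refl f))
  first (inj₂ (inj₂ (inj₂ (inj₂ (inj₁ f))))) = dualed c cyc* (inj₂ (inj₁ (family-dual famK* famK refl f)))
  first (inj₂ (inj₂ (inj₂ (inj₂ (inj₂ (inj₁ f)))))) = dualed c cyc* (inj₂ (inj₂ (family-dual famL* famL refl f)))
  first (inj₂ (inj₂ (inj₂ (inj₂ (inj₂ (inj₂ f)))))) = second f

-- The arc from a to b lies on a 3-cycle

mid-two : ∀ {k} → Fin k → Bool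
mid-two zero = false
mid-two (suc i) = first-two i

module _ (i₀ : Fin 5) (rb ra : Vec Bool 5) where

  q-body r-body : Vec Bool 5 → Bool
  q-body rq = lookup rq i₀ ⇒ not (w5on (mat (w5rows ▷ rb ▷ (true ∷ ra) ▷ (false ∷ true ∷ rq))) mid-two) ⇒
    (ra ≡ᵗ rb) ⇒ noneB rb ∧ fullB rq
  r-body rr = lookup rr i₀ ⇒ not (w5on (mat (w5rows ▷ rb ▷ (true ∷ ra) ▷ (false ∷ false ∷ rr))) mid-two) ⇒
    noneB rb ⇒ noneB ra

  a-body : Bool
  a-body = not (lookup ra i₀) ⇒ (allF λ j → lookup rb j ⇒ lookup ra j) ⇒
    not (w5on (mat (w5rows ▷ rb ▷ (true ∷ ra))) first-two) ⇒ (noneB rb ∨ (ra ≡ᵗ rb)) ∧ allVec 5 q-body ∧ allVec 5 r-body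

-- Rows of b and a, then of `q` and `r`, towards a copy of W5 with a vertex of P at place `i₀`; each
-- row is tested before the next is enumerated. The outcome, drawn in `inside-K`, is that the whole
-- copy lies in P and is dominated by `q`.
b-body : Fin 5 × Vec Bool 5 → Bool
b-body (i₀ , rb) = not (lookup rb i₀) ⇒ not (w5on (mat (w5rows ▷ rb)) first-one) ⇒ allVec 5 (a-body i₀ rb)

opaque
  unfolding w5on

  b-check : ∀ z → b-body z ≡ true
  b-check = sound (index 5 ⊗ bits 5) b-body refl

-- A set that no outside vertex splits is an interval, so adding splitting vertices to a set with
-- two members ends only at V.
grow : ∀ {n} (T : Tournament n) → Prime T allᵛ → (Inv : VSet n → Set) →
  (∀ M z → Inv M → M z ≡ false → (∃₂ λ y y' → M y ≡ true × M y' ≡ true × arc T z y ≡ true × arc T z y' ≡ false) → Inv (M ⊕ z)) →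
  ∀ M → Inv M → (∃₂ λ x y → x ≢ y × M x ≡ true × M y ≡ true) → ∃ λ M' → Inv M' × (∀ v → M' v ≡ true)
grow {n} T prT Inv adv M inv two = go n M inv two (m≤m+n n (count M))
  where
  go : ∀ k M → Inv M → (∃₂ λ x y → x ≢ y × M x ≡ true × M y ≡ true) → n ≤ k + count M → ∃ λ M' → Inv M' × (∀ v → M' v ≡ true)
  go k M inv (x , y , x≢y , mx , my) le
    with any? (λ z → (M z ≟ᴮ false) ×-dec any? λ w → any? λ w' → (M w ≟ᴮ true) ×-dec ((M w' ≟ᴮ true) ×-dec ((arc T z w ≟ᴮ true) ×-dec (arc T z w' ≟ᴮ false))))
  ... | no none = M , inv , λ v → prT M ((λ _ _ → refl) , unif) x y x≢y mx my v refl
    where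
    unif : ∀ z w w' → true ≡ true → M z ≡ false → M w ≡ true → M w' ≡ true → arc T z w ≡ arc T z w'
    unif z w w' _ mz mw mw' with bool-case (arc T z w) | bool-case (arc T z w')
    ... | inj₁ p | inj₁ q = trans p (sym q)
    ... | inj₂ p | inj₂ q = trans p (sym q)
    ... | inj₁ p | inj₂ q = ⊥-elim (none (z , mz , w , w' , mw , mw' , p , q))
    ... | inj₂ p | inj₁ q = ⊥-elim (none (z , mz , w' , w , mw' , mw , q , p))
  go zero M inv (x , y , x≢y , mx , my) le | yes (z , mz , _) =
    ⊥-elim (<-irrefl refl (≤-trans (count-strict {f = M} {allᵛ} (λ _ _ → refl) z mz refl) (≤-trans (count≤ {n} allᵛ) le)))
  go (suc k) M inv (x , y , x≢y , mx , my) le | yes (z , mz , w , w' , mw , mw' , p , q) =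
    go k (M ⊕ z) (adv M z inv mz (w , w' , mw , mw' , p , q)) (x , y , x≢y , ⊕-old {u = M} mx , ⊕-old {u = M} my)
      (≤-trans le (subst (λ c → suc (k + count M) ≤ k + c) (sym (count-⊕ {u = M} mz)) (subst (suc (k + count M) ≤_) (sym (+-suc k (count M))) ≤-refl)))

-- No 3-cycle contains the arc a → b.  The remaining vertices are split into P → {a , b}, a → Q → b and
-- {a , b} → R; arcs P → Q → R and P → R are the expected ones.
module Acyclic {n : ℕ} {T : Tournament n} {a b : Fin n} (av : Avoids T a b)
  (acyclic : ∀ c → arc T b c ≡ true → arc T c a ≡ false) where

  open Avoids av

  P Q R : Fin n → Set
  P x = arc T x a ≡ true
  Q x = arc T a x ≡ true × arc T x b ≡ true
  R x = arc T b x ≡ true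

  b⟶a : arc T b a ≡ false
  b⟶a = asym T a b a⟶b

  P⟶b : ∀ {x} → P x → arc T x b ≡ true
  P⟶b {x} px with bool-case (arc T x b)
  ... | inj₁ h = h
  ... | inj₂ h = true≢false px (acyclic x (trans (flip-arc T λ where refl → true≢false px b⟶a) (cong not h)))

  a⟶R : ∀ {x} → R x → arc T a x ≡ true
  a⟶R {x} rx = trans (flip-arc T λ where refl → true≢false rx b⟶a) (cong not (acyclic x rx))

  data Class (x : Fin n) : Set where
    isA : x ≡ a → Class x
    isB : x ≡ b → Class x
    isP : P x → Class x
    isQ : Q x → Class x
    isR : R x → Class x

  class : ∀ x → Class x
  class x with x ≟ a | x ≟ b
  ... | yes e | _ = isA e
  ... | no _ | yes e = isB e
  ... | no x≢a | no x≢b with bool-case (arc T x a) | bool-case (arc T x b)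
  ...   | inj₁ p | _ = isP p
  ...   | inj₂ p | inj₁ q = isQ (trans (flip-arc T x≢a) (cong not p) , q)
  ...   | inj₂ p | inj₂ q = isR (trans (flip-arc T x≢b) (cong not q))

  conv : ∀ {x y} → x ≢ y → arc T x y ≡ false → arc T y x ≡ true
  conv x≢y h = trans (flip-arc T x≢y) (cong not h)

  P≢Q : ∀ {x y} → P x → Q y → x ≢ y
  P≢Q px (ay , _) refl = true≢false px (asym T a _ ay)
  P≢R : ∀ {x y} → P x → R y → x ≢ y
  P≢R px ry refl = true≢false px (acyclic _ ry)
  Q≢R : ∀ {x y} → Q x → R y → x ≢ y
  Q≢R (_ , xb) ry refl = true≢false xb (asym T b _ ry)

  PQ : ∀ {x y} → P x → Q y → arc T y x ≡ true ⊎ arc T x y ≡ true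
  PQ px qy = [ inj₁ , (λ h → inj₂ (conv (≢-sym (P≢Q px qy)) h)) ]′ (bool-case _)
  PR : ∀ {x y} → P x → R y → arc T y x ≡ true ⊎ arc T x y ≡ true
  PR px ry = [ inj₁ , (λ h → inj₂ (conv (≢-sym (P≢R px ry)) h)) ]′ (bool-case _)
  QR : ∀ {x y} → Q x → R y → arc T y x ≡ true ⊎ arc T x y ≡ true
  QR qx ry = [ inj₁ , (λ h → inj₂ (conv (≢-sym (Q≢R qx ry)) h)) ]′ (bool-case _)

  -- In this and the next two lemmas exactly two of the three arcs among `p`, `q`, `r` go against
  -- the expected order, and the three vertices form a W5 with a and b. The case of all three arcs
  -- is `Triangle`.
  t1 : ∀ {p q r} → P p → Q q → R r → arc T q p ≡ true → arc T r q ≡ true → arc T p r ≡ true → ⊥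
  t1 pa (aq , qb) br qp rq pr = na (arcs⇒W5 T pa (P⟶b pa) pr a⟶b (a⟶R br) aq br rq qp qb 1F)
  t2 : ∀ {p q r} → P p → Q q → R r → arc T q p ≡ true → arc T r p ≡ true → arc T q r ≡ true → ⊥
  t2 pa (aq , qb) br qp rp qr = na (arcs⇒W5 T aq a⟶b (a⟶R br) qb qr qp br rp pa (P⟶b pa) 0F)
  t3 : ∀ {p q r} → P p → Q q → R r → arc T r q ≡ true → arc T r p ≡ true → arc T p q ≡ true → ⊥
  t3 pa (aq , qb) br rq rp pq = na (arcs⇒W5 T pa pq (P⟶b pa) aq a⟶b (a⟶R br) qb br rp rq 1F)

  -- A contradiction by growth: the copy of W5 through `p` lies in the set `K` of vertices of P
  -- dominated by `q`, and adding splitting vertices never leaves `K`, although it would have to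
  -- reach a.
  module Triangle {p q r} (Pp : P p) (Qq : Q q) (Rr : R r)
    (q⟶p : arc T q p ≡ true) (r⟶p : arc T r p ≡ true) (r⟶q : arc T r q ≡ true) where

    K : VSet n
    K x = arc T x a ∧ arc T q x

    r⟶K : ∀ {x} → P x → arc T q x ≡ true → arc T r x ≡ true
    r⟶K px qx = [ id , (λ h → ⊥-elim (t1 px Qq Rr qx r⟶q h)) ]′ (PR px Rr)

    Q-uniform : ∀ {y x x'} → Q y → P x → P x' → arc T q x ≡ true → arc T q x' ≡ true → arc T y x ≡ true → arc T y x' ≡ true
    Q-uniform qy px px' qx qx' yx with QR qy Rr
    ... | inj₂ h = ⊥-elim (t2 px qy Rr yx (r⟶K px qx) h)
    ... | inj₁ h = [ id , (λ h' → ⊥-elim (t3 px' qy Rr h (r⟶K px' qx') h')) ]′ (PQ px' qy)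

    R-uniform : ∀ {y x x'} → R y → P x → P x' → arc T q x ≡ true → arc T q x' ≡ true → arc T y x ≡ true → arc T y x' ≡ true
    R-uniform ry px px' qx qx' yx with QR Qq ry
    ... | inj₂ h = ⊥-elim (t2 px Qq ry qx yx h)
    ... | inj₁ h = [ id , (λ h' → ⊥-elim (t1 px' Qq ry qx' h h')) ]′ (PR px' ry)

    P-split : ∀ {z x x'} → P z → arc T q z ≡ false → P x → P x' → arc T q x ≡ true → arc T q x' ≡ true →
      arc T x z ≡ true → arc T z x' ≡ true → arc T x x' ≡ true → ⊥
    P-split pz qz px px' qx qx' xz zx' xx' =
      na (arcs⇒W5 T xz xx' px zx' pz (conv (≢-sym (P≢Q pz Qq)) qz) px' (proj₁ Qq) qx qx' 3F)

    -- Strong connectivity in the form of cuts. With `D` the out-neighbours in `M` of a vertex `z`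
    -- that splits `M`, it yields an arc `s → t` with `s → z → t`, and `P-split` turns this into a
    -- W5 through a unless `q` dominates `z`.
    Strong : VSet n → Set
    Strong M = ∀ D → D ⊆ᵛ M → (∃ λ x → D x ≡ true) → (∃ λ x → M x ≡ true × D x ≡ false) →
      ∃₂ λ x y → M x ≡ true × D x ≡ false × D y ≡ true × arc T x y ≡ true

    Inv : VSet n → Set
    Inv M = M ⊆ᵛ K × Strong M

    private
      K⁻ : ∀ {x} → K x ≡ true → P x × arc T q x ≡ true
      K⁻ {x} = ∧⁻ {arc T x a}

    extend : ∀ M z → M z ≡ false → (∃₂ λ y y' → M y ≡ true × M y' ≡ true × arc T z y ≡ true × arc T z y' ≡ false) →
      K z ≡ true → Inv M → Inv (M ⊕ z)
    extend M z mz (y , y' , my , my' , zy , zy') kz (M⊆K , st) = sub , st'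
      where
      sub : (M ⊕ z) ⊆ᵛ K
      sub v h with ⊕⁻ M h
      ... | inj₁ e = M⊆K v e
      ... | inj₂ refl = kz
      M≢z : ∀ {v} → M v ≡ true → v ≢ z
      M≢z mv refl = true≢false mv mz
      st' : Strong (M ⊕ z)
      st' D D⊆ (x , dx) (w , mw , dw) with any? (λ v → (M v ≟ᴮ true) ×-dec (D v ≟ᴮ true)) | any? (λ v → (M v ≟ᴮ true) ×-dec (D v ≟ᴮ false))
      ... | yes (v , mv , dv) | yes (v' , mv' , dv') with st (λ v → D v ∧ M v) (λ v h → proj₂ (∧⁻ {D v} h)) (v , ∧⁺ dv mv) (v' , mv' , cong (_∧ M v') dv')
      ...   | s , t , ms , ds , dt , st₁ = s , t , ⊕-old {u = M} ms , ds' , proj₁ (∧⁻ {D t} dt) , st₁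
        where
        ds' : D s ≡ false
        ds' = [ (λ h → true≢false (∧⁺ h ms) ds) , id ]′ (bool-case (D s))
      st' D D⊆ (x , dx) (w , mw , dw) | no none | _ = y' , z , ⊕-old {u = M} my' , (refute (λ h → none (y' , my' , h))) , dz , conv (≢-sym (M≢z my')) zy'
        where
        dz : D z ≡ true
        dz with ⊕⁻ M (D⊆ x dx)
        ... | inj₁ e = ⊥-elim (none (x , e , dx))
        ... | inj₂ refl = dx
      st' D D⊆ (x , dx) (w , mw , dw) | _ | no none = z , y , ⊕-new M z , dz , ([ id , (λ h → ⊥-elim (none (y , my , h))) ]′ (bool-case (D y))) , zy
        where
        dz : D z ≡ false
        dz with ⊕⁻ M mw
        ... | inj₁ e = ⊥-elim (none (w , e , dw))
        ... | inj₂ refl = dw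

    advance : ∀ M z → Inv M → M z ≡ false → (∃₂ λ y y' → M y ≡ true × M y' ≡ true × arc T z y ≡ true × arc T z y' ≡ false) → Inv (M ⊕ z)
    advance M z inv@(M⊆K , st) mz sp@(y , y' , my , my' , zy , zy') with K⁻ (M⊆K y my) | K⁻ (M⊆K y' my') | class z
    ... | py , qy | py' , qy' | isA refl = true≢false zy (asym T y a py)
    ... | py , qy | py' , qy' | isB refl = true≢false zy (asym T y b (P⟶b py))
    ... | py , qy | py' , qy' | isQ qz = true≢false (Q-uniform qz py py' qy qy' zy) zy'
    ... | py , qy | py' , qy' | isR rz = true≢false (R-uniform rz py py' qy qy' zy) zy'
    ... | py , qy | py' , qy' | isP pz with bool-case (arc T q z)
    ...   | inj₁ qz = extend M z mz sp (∧⁺ pz qz) inv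
    ...   | inj₂ qz with st (λ v → M v ∧ arc T z v) (λ v h → proj₁ (∧⁻ {M v} h)) (y , ∧⁺ my zy) (y' , my' , trans (cong (M y' ∧_) zy') (∧-zeroʳ (M y')))
    ...     | s , t , ms , ds , dt , s⟶t with ∧⁻ {M t} dt
    ...       | mt , zt = ⊥-elim (P-split pz qz (proj₁ (K⁻ (M⊆K s ms))) (proj₁ (K⁻ (M⊆K t mt))) (proj₂ (K⁻ (M⊆K s ms))) (proj₂ (K⁻ (M⊆K t mt)))
                  (conv (λ where refl → true≢false ms mz) ([ (λ h → true≢false (∧⁺ ms h) ds) , id ]′ (bool-case (arc T z s)))) zt s⟶t)

    module Copy (f : Fin 5 → Fin n) (f-inj : ∀ {i j} → f i ≡ f j → i ≡ j) (arcs : ∀ i j → arc T (f i) (f j) ≡ arcW5 i j)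
      (i₀ : Fin 5) (fi₀ : f i₀ ≡ p) where
      open W5Copy T a b na nb a⟶b f f-inj arcs
      ra rb : Vec Bool 5
      ra = row a
      rb = row b
      no₈ : ∀ v d → v ≢ a → v ≢ b → (∀ j → v ≢ f j) → arc T v a ≡ false → arc T v b ≡ d →
        w5on (mat (w5rows ▷ rb ▷ (true ∷ ra) ▷ (false ∷ d ∷ row v))) mid-two ≡ false
      no₈ v d v≢a v≢b v≢f va vb = refute λ h → contra (w5on-sound T {vs = v ∷ a ∷ b ∷ fs}
          ((v≢a ∷ v≢b ∷ v≢f 0F ∷ v≢f 1F ∷ v≢f 2F ∷ v≢f 3F ∷ v≢f 4F ∷ []) ∷ abfs-distinct) mid-two (trans (cong (λ R → w5on (mat R) mid-two) rows) h))
        where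
        rows : rowsOf T (v ∷ a ∷ b ∷ fs) ≡ w5rows ▷ rb ▷ (true ∷ ra) ▷ (false ∷ d ∷ row v)
        rows = cong₂ _▷_ (cong₂ (λ R r → R ▷ rb ▷ (r ∷ ra)) fs-rows a⟶b) (cong₂ (λ r r' → r ∷ r' ∷ row v) va vb)
        contra : (∃ λ i → mid-two i ≡ true × InW5 T (lookup (v ∷ a ∷ b ∷ fs) i)) → ⊥
        contra (suc zero , _ , w) = na w
        contra (suc (suc zero) , _ , w) = nb w
      at-p : ∀ v {d} → arc T v p ≡ d → lookup (row v) i₀ ≡ d
      at-p v h = trans (row-lookup v i₀) (trans (cong (arc T v) fi₀) h)
      checked : (noneB rb ∨ (ra ≡ᵗ rb)) ∧ allVec 5 (q-body i₀ rb ra) ∧ allVec 5 (r-body i₀ rb ra) ≡ true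
      checked = ⇒⁻ {not (w5on (mat (w5rows ▷ rb ▷ (true ∷ ra))) first-two)} (⇒⁻ {allF λ j → lookup rb j ⇒ lookup ra j} (⇒⁻ {not (lookup ra i₀)}
          (allVec⁻ 5 {a-body i₀ rb} (⇒⁻ {not (w5on (mat (w5rows ▷ rb)) first-one)} (⇒⁻ {not (lookup rb i₀)} (b-check (i₀ , rb))
            (not⁺ (at-p b (asym T p b (P⟶b Pp))))) (not⁺ no₆)) ra)
          (not⁺ (at-p a (asym T p a Pp)))) (allF⁺ imp)) (not⁺ no₇)
        where
        imp : ∀ j → (lookup rb j ⇒ lookup ra j) ≡ true
        imp j with lookup rb j in eq
        ... | false = refl
        ... | true = trans (row-lookup a j) (a⟶R (trans (sym (row-lookup b j)) eq))
      q-checked : allVec 5 (q-body i₀ rb ra) ≡ true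
      q-checked = proj₁ (∧⁻ {allVec 5 (q-body i₀ rb ra)} (proj₂ (∧⁻ {noneB rb ∨ (ra ≡ᵗ rb)} checked)))
      r-checked : allVec 5 (r-body i₀ rb ra) ≡ true
      r-checked = proj₂ (∧⁻ {allVec 5 (q-body i₀ rb ra)} (proj₂ (∧⁻ {noneB rb ∨ (ra ≡ᵗ rb)} checked)))
      none-≡ᵗ : ∀ {k} (u v : Vec Bool k) → noneB u ≡ true → noneB v ≡ true → (u ≡ᵗ v) ≡ true
      none-≡ᵗ [] [] _ _ = refl
      none-≡ᵗ (false ∷ u) (false ∷ v) h h' = none-≡ᵗ u v h h'
      in-K : (ra ≡ᵗ rb) ≡ true → noneB ra ≡ true × fullB (row q) ≡ true
      in-K e = trans (cong noneB (≡ᵗ⁻ ra rb e)) (proj₁ res) , proj₂ res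
        where
        q∉ : ∀ j → q ≢ f j
        q∉ j e' = true≢false (trans (cong (arc T a) (sym e')) (proj₁ Qq))
          (trans (sym (row-lookup a j)) (trans (cong (λ r → lookup r j) (≡ᵗ⁻ ra rb e)) (trans (row-lookup b j) (trans (cong (arc T b) (sym e')) (asym T q b (proj₂ Qq))))))
        res : noneB rb ≡ true × fullB (row q) ≡ true
        res = ∧⁻ {noneB rb} (⇒⁻ {ra ≡ᵗ rb} (⇒⁻ {not (w5on (mat (w5rows ▷ rb ▷ (true ∷ ra) ▷ (false ∷ true ∷ row q))) mid-two)} (⇒⁻ {lookup (row q) i₀}
          (allVec⁻ 5 {q-body i₀ rb ra} q-checked (row q)) (at-p q q⟶p))
          (not⁺ (no₈ q true (≢-sym (arc⇒≢ T (proj₁ Qq))) (arc⇒≢ T (proj₂ Qq)) q∉ (asym T a q (proj₁ Qq)) (proj₂ Qq)))) e)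
      -- If the copy misses R, the row of `r` makes it miss Q as well. If it misses Q, so that `ra`
      -- equals `rb`, the row of `q` makes it miss R and lie below `q`.
      inside-K : noneB ra ≡ true × fullB (row q) ≡ true
      inside-K = [ (λ h → in-K (none-≡ᵗ ra rb (nra h) h)) , in-K ]′ (∨⁻ {noneB rb} (proj₁ (∧⁻ {noneB rb ∨ (ra ≡ᵗ rb)} checked)))
        where
        nra : noneB rb ≡ true → noneB ra ≡ true
        nra h = ⇒⁻ {noneB rb} (⇒⁻ {not (w5on (mat (w5rows ▷ rb ▷ (true ∷ ra) ▷ (false ∷ false ∷ row r))) mid-two)} (⇒⁻ {lookup (row r) i₀}
          (allVec⁻ 5 {r-body i₀ rb ra} r-checked (row r)) (at-p r r⟶p))
          (not⁺ (no₈ r false (≢-sym (arc⇒≢ T (a⟶R Rr))) (≢-sym (arc⇒≢ T Rr)) r∉ (asym T a r (a⟶R Rr)) (asym T b r Rr)))) h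
          where
          r∉ : ∀ j → r ≢ f j
          r∉ j e = noneB⁻ rb h j (trans (row-lookup b j) (trans (cong (arc T b) (sym e)) Rr))
      f∈K : ∀ j → K (f j) ≡ true
      f∈K j = ∧⁺ (conv (a≢f j) (refute λ h → noneB⁻ ra (proj₁ inside-K) j (trans (row-lookup a j) h)))
        (trans (sym (row-lookup q j)) (fullB⁻ (row q) (proj₂ inside-K) j))
      w5-strong : ∀ D → noneB D ≡ false → fullB D ≡ false → ∃₂ λ i j → lookup D i ≡ false × lookup D j ≡ true × arcW5 i j ≡ true
      w5-strong D h h' =
        let (i , h₁) = anyF⁻ {f = λ i → not (lookup D i) ∧ anyF λ j → lookup D j ∧ arcW5 i j} (⇒⁻ {not (fullB D)} (⇒⁻ {not (noneB D)} (sound (bits 5) (λ D → not (noneB D) ⇒ not (fullB D) ⇒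
              anyF λ i → not (lookup D i) ∧ anyF λ j → lookup D j ∧ arcW5 i j) refl D) (not⁺ h)) (not⁺ h'))
            (h₂ , h₃) = ∧⁻ {not (lookup D i)} h₁
            (j , h₄) = anyF⁻ {f = λ j → lookup D j ∧ arcW5 i j} h₃
            (h₅ , h₆) = ∧⁻ {lookup D j} h₄
        in i , j , not-true⁻ h₂ , h₅ , h₆
      start-inv : Inv (setOf fs)
      start-inv = sub , st
        where
        at-index : ∀ v → setOf fs v ≡ true → ∃ λ j → f j ≡ v
        at-index v h = let (j , e) = setOf⁻ fs h in j , trans (sym (fs-lookup j)) e
        sub : setOf fs ⊆ᵛ K
        sub v h with at-index v h
        ... | j , refl = f∈K j
        st : Strong (setOf fs)
        st D D⊆ (x , dx) (y , my , dy) = arc-into (w5-strong (map D fs)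
            (refute λ h → let (jx , e) = at-index x (D⊆ x dx) in noneB⁻ (map D fs) h jx (trans (D-lookup jx) (trans (cong D e) dx)))
            (refute λ h → let (jy , e) = at-index y my in true≢false (fullB⁻ (map D fs) h jy) (trans (D-lookup jy) (trans (cong D e) dy))))
          where
          D-lookup : ∀ j → lookup (map D fs) j ≡ D (f j)
          D-lookup j = trans (lookup-map j D fs) (cong D (fs-lookup j))
          arc-into : (∃₂ λ i j → lookup (map D fs) i ≡ false × lookup (map D fs) j ≡ true × arcW5 i j ≡ true) →
            ∃₂ λ x y → setOf fs x ≡ true × D x ≡ false × D y ≡ true × arc T x y ≡ true
          arc-into (i , j , di , dj , ij) = f i , f j , subst (λ v → setOf fs v ≡ true) (fs-lookup i) (setOf⁺ fs i) ,
            trans (sym (D-lookup i)) di , trans (sym (D-lookup j)) dj , trans (arcs i j) ij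
      absurd : ⊥
      absurd with grow T prime Inv advance (setOf fs) start-inv (f 0F , f 1F , f≢ (λ ()) , setOf⁺ fs 0F , setOf⁺ fs 1F)
      ... | M , (M⊆K , _) , all-M = true≢false (proj₁ (K⁻ (M⊆K a (all-M a)))) (irrefl T a)

    impossible : ⊥
    impossible with cover p (arc⇒≢ T Pp) (arc⇒≢ T (P⟶b Pp))
    ... | f , f-inj , arcs , i₀ , fi₀ = Copy.absurd f f-inj arcs i₀ fi₀

  -- Together with `no-triangle'`: an unexpected arc from Q to P excludes unexpected arcs from R to
  -- either of its ends.
  no-triangle : ∀ {p q r} → P p → Q q → R r → arc T q p ≡ true → arc T r p ≡ true → ⊥
  no-triangle Pp Qq Rr qp rp with QR Qq Rr
  ... | inj₁ rq = Triangle.impossible Pp Qq Rr qp rp rq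
  ... | inj₂ qr = t2 Pp Qq Rr qp rp qr

  no-triangle' : ∀ {p q r} → P p → Q q → R r → arc T q p ≡ true → arc T r q ≡ true → ⊥
  no-triangle' Pp Qq Rr qp rq with PR Pp Rr
  ... | inj₁ rp = Triangle.impossible Pp Qq Rr qp rp rq
  ... | inj₂ pr = t1 Pp Qq Rr qp rq pr

  -- If q → p, then a, the unexpected arcs between P and Q, and the vertices they absorb form an interval missing b.
  P⟶Q : ∀ {p₀ q₀} → P p₀ → Q q₀ → arc T q₀ p₀ ≡ true → ⊥
  P⟶Q {p₀} {q₀} Pp₀ Qq₀ qp₀ = true≢false (prime f ((λ _ _ → refl) , unif) a p₀ (≢-sym (arc⇒≢ T Pp₀)) fa (f-of Pp₀ (qp₀-in)) b refl) fb
    where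
    Qᵇ : VSet n
    Qᵇ x = arc T a x ∧ arc T x b
    PQ? : ∀ x → Dec (∃ λ q → Qᵇ q ≡ true × arc T q x ≡ true)
    PQ? x = any? λ q → (Qᵇ q ≟ᴮ true) ×-dec (arc T q x ≟ᴮ true)
    QP? : ∀ x → Dec (∃ λ p → arc T p a ≡ true × arc T x p ≡ true)
    QP? x = any? λ p → (arc T p a ≟ᴮ true) ×-dec (arc T x p ≟ᴮ true)
    -- The second alternative absorbs vertices of P dominated by one that already has an unexpected
    -- arc. One round of absorption is enough: the need for a second would give a W5 through a, as
    -- the case `fZ` of `P-val` shows.
    inP : ∀ x → Dec ((∃ λ q → Qᵇ q ≡ true × arc T q x ≡ true) ⊎ (∃ λ p → arc T p a ≡ true × (∃ λ q → Qᵇ q ≡ true × arc T q p ≡ true) × arc T p x ≡ true))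
    inP x = PQ? x ⊎-dec any? λ p → (arc T p a ≟ᴮ true) ×-dec (PQ? p ×-dec (arc T p x ≟ᴮ true))
    inQ : ∀ x → Dec ((∃ λ p → arc T p a ≡ true × arc T x p ≡ true) ⊎ (∃ λ q → Qᵇ q ≡ true × (∃ λ p → arc T p a ≡ true × arc T q p ≡ true) × arc T x q ≡ true))
    inQ x = QP? x ⊎-dec any? λ q → (Qᵇ q ≟ᴮ true) ×-dec (QP? q ×-dec (arc T x q ≟ᴮ true))
    f : VSet n
    f x = (x == a) ∨ (arc T x a ∧ does (inP x)) ∨ (Qᵇ x ∧ does (inQ x))
    Qᵇ⁺ : ∀ {x} → Q x → Qᵇ x ≡ true
    Qᵇ⁺ (h , h') = ∧⁺ h h'
    Qᵇ⁻ : ∀ {x} → Qᵇ x ≡ true → Q x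
    Qᵇ⁻ {x} = ∧⁻ {arc T a x}
    fa : f a ≡ true
    fa = ∨⁺ˡ (==-refl a)
    f-of : ∀ {x} → P x → _ → f x ≡ true
    f-of {x} px w = ∨⁺ʳ {x == a} (∨⁺ˡ (∧⁺ px (does⁺ (inP x) w)))
    f-ofQ : ∀ {x} → Q x → _ → f x ≡ true
    f-ofQ {x} qx w = ∨⁺ʳ {x == a} (∨⁺ʳ {arc T x a ∧ does (inP x)} (∧⁺ (Qᵇ⁺ qx) (does⁺ (inQ x) w)))
    qp₀-in : (∃ λ q → Qᵇ q ≡ true × arc T q p₀ ≡ true) ⊎ (∃ λ p → arc T p a ≡ true × (∃ λ q → Qᵇ q ≡ true × arc T q p ≡ true) × arc T p p₀ ≡ true)
    qp₀-in = inj₁ (q₀ , Qᵇ⁺ Qq₀ , qp₀)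
    fb : f b ≡ false
    fb = ∨-false⁺ (≢⇒==false (≢-sym (arc⇒≢ T a⟶b))) (∨-false⁺ (cong (_∧ does (inP b)) b⟶a) (cong (_∧ does (inQ b)) (trans (cong (arc T a b ∧_) (irrefl T b)) (∧-zeroʳ (arc T a b)))))
    data InF (x : Fin n) : Set where
      fA : x ≡ a → InF x
      fP : P x → (q : Fin n) → Q q → arc T q x ≡ true → InF x
      fZ : P x → (p q : Fin n) → P p → Q q → arc T q p ≡ true → arc T p x ≡ true → InF x
      fQ : Q x → (p : Fin n) → P p → arc T x p ≡ true → InF x
      fY : Q x → (p q : Fin n) → P p → Q q → arc T q p ≡ true → arc T x q ≡ true → InF x
    view : ∀ x → f x ≡ true → InF x
    view x h with ∨⁻ {x == a} h
    ... | inj₁ e = fA (==⁻ x a e)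
    ... | inj₂ h₁ with ∨⁻ {arc T x a ∧ does (inP x)} h₁
    ...   | inj₁ h₂ with ∧⁻ {arc T x a} h₂
    ...     | px , d with does⁻ (inP x) d
    ...       | inj₁ (q , qq , qx) = fP px q (Qᵇ⁻ qq) qx
    ...       | inj₂ (p , pp , (q , qq , qp) , p⟶x) = fZ px p q pp (Qᵇ⁻ qq) qp p⟶x
    view x h | inj₂ h₁ | inj₂ h₂ with ∧⁻ {Qᵇ x} h₂
    ...     | qx , d with does⁻ (inQ x) d
    ...       | inj₁ (p , pp , xp) = fQ (Qᵇ⁻ qx) p pp xp
    ...       | inj₂ (q , qq , (p , pp , qp) , xq) = fY (Qᵇ⁻ qx) p q pp (Qᵇ⁻ qq) qp xq
    contra : {A : Set} {d : Bool} → d ≡ false → d ≡ true → A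
    contra h h' = true≢false h' h
    R-val : ∀ v → R v → ∀ x → InF x → arc T x v ≡ true
    R-val v rv x (fA refl) = a⟶R rv
    R-val v rv x (fP px q qq qx) = [ (λ h → ⊥-elim (no-triangle px qq rv qx h)) , id ]′ (PR px rv)
    R-val v rv x (fQ qx p pp xp) = [ (λ h → ⊥-elim (no-triangle' pp qx rv xp h)) , id ]′ (QR qx rv)
    R-val v rv x (fZ px p q pp qq qp p⟶x) with PR px rv | PQ px qq
    ... | inj₂ h | _ = h
    ... | inj₁ h | inj₁ qx = ⊥-elim (no-triangle px qq rv qx h)
    ... | inj₁ h | inj₂ xq with PR pp rv | QR qq rv
    ...   | inj₁ vp | _ = ⊥-elim (no-triangle pp qq rv qp vp)
    ...   | _ | inj₁ vq = ⊥-elim (no-triangle' pp qq rv qp vq)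
    ...   | inj₂ pv | inj₂ qv = ⊥-elim (nb (arcs⇒W5 T qp (proj₂ qq) qv (P⟶b pp) pv p⟶x rv h xq (P⟶b px) 2F))
    R-val v rv x (fY qx p q pp qq qp xq) with QR qx rv | PQ pp qx
    ... | inj₂ h | _ = h
    ... | inj₁ h | inj₁ xp = ⊥-elim (no-triangle' pp qx rv xp h)
    ... | inj₁ h | inj₂ px with PR pp rv | QR qq rv
    ...   | inj₁ vp | _ = ⊥-elim (no-triangle pp qq rv qp vp)
    ...   | _ | inj₁ vq = ⊥-elim (no-triangle' pp qq rv qp vq)
    ...   | inj₂ pv | inj₂ qv = ⊥-elim (na (arcs⇒W5 T pp pv px (a⟶R rv) (proj₁ qx) (proj₁ qq) h xq qp qv 1F))
    P-val : ∀ v → P v → f v ≡ false → ∀ x → InF x → arc T v x ≡ true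
    P-val v pv fv x (fA refl) = pv
    P-val v pv fv x (fQ qx _ _ _) = [ (λ h → contra fv (f-of pv (inj₁ (x , Qᵇ⁺ qx , h)))) , id ]′ (PQ pv qx)
    P-val v pv fv x (fY qx _ _ _ _ _ _) = [ (λ h → contra fv (f-of pv (inj₁ (x , Qᵇ⁺ qx , h)))) , id ]′ (PQ pv qx)
    P-val v pv fv x (fP px q qq qx) with bool-case (arc T v x)
    ... | inj₁ h = h
    ... | inj₂ h = contra fv (f-of pv (inj₂ (x , px , (q , Qᵇ⁺ qq , qx) , conv (λ where refl → contra fv (f-of px (inj₁ (q , Qᵇ⁺ qq , qx)))) h)))
    P-val v pv fv x (fZ px p q pp qq qp p⟶x) with bool-case (arc T v x)
    ... | inj₁ h = h
    ... | inj₂ h with PQ px qq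
    ...   | inj₁ qx = contra fv (f-of pv (inj₂ (x , px , (q , Qᵇ⁺ qq , qx) , x⟶v)))
      where
      x⟶v : arc T x v ≡ true
      x⟶v = conv (λ where refl → contra fv (f-of px (inj₁ (q , Qᵇ⁺ qq , qx)))) h
    ...   | inj₂ xq = ⊥-elim (na (arcs⇒W5 T x⟶v px xq pv (P-val v pv fv q (fQ qq p pp qp)) (P-val v pv fv p (fP pp q qq qp)) (proj₁ qq) qp p⟶x pp 2F))
      where
      x⟶v : arc T x v ≡ true
      x⟶v = conv (λ where refl → contra fv (f-of px (inj₂ (p , pp , (q , Qᵇ⁺ qq , qp) , p⟶x)))) h
    Q-val : ∀ v → Q v → f v ≡ false → ∀ x → InF x → arc T x v ≡ true
    Q-val v qv fv x (fA refl) = proj₁ qv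
    Q-val v qv fv x (fP px _ _ _) = [ (λ h → contra fv (f-ofQ qv (inj₁ (x , px , h)))) , id ]′ (PQ px qv)
    Q-val v qv fv x (fZ px _ _ _ _ _ _) = [ (λ h → contra fv (f-ofQ qv (inj₁ (x , px , h)))) , id ]′ (PQ px qv)
    Q-val v qv fv x (fQ qx p pp xp) with bool-case (arc T x v)
    ... | inj₁ h = h
    ... | inj₂ h = contra fv (f-ofQ qv (inj₂ (x , Qᵇ⁺ qx , (p , pp , xp) , conv (λ where refl → contra fv (f-ofQ qx (inj₁ (p , pp , xp)))) h)))
    Q-val v qv fv x (fY qx p q pp qq qp xq) with bool-case (arc T x v)
    ... | inj₁ h = h
    ... | inj₂ h with PQ pp qx
    ...   | inj₁ xp = contra fv (f-ofQ qv (inj₂ (x , Qᵇ⁺ qx , (p , pp , xp) , v⟶x)))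
      where
      v⟶x : arc T v x ≡ true
      v⟶x = conv (λ where refl → contra fv (f-ofQ qx (inj₁ (p , pp , xp)))) h
    ...   | inj₂ px = ⊥-elim (na (arcs⇒W5 T pp (Q-val v qv fv p (fP pp q qq qp)) px (proj₁ qv) (proj₁ qx) (proj₁ qq) v⟶x xq qp (Q-val v qv fv q (fQ qq p pp qp)) 1F))
      where
      v⟶x : arc T v x ≡ true
      v⟶x = conv (λ where refl → contra fv (f-ofQ qx (inj₂ (q , Qᵇ⁺ qq , (p , pp , qp) , xq)))) h
    b-val : ∀ x → InF x → arc T x b ≡ true
    b-val x (fA refl) = a⟶b
    b-val x (fP px _ _ _) = P⟶b px
    b-val x (fZ px _ _ _ _ _ _) = P⟶b px
    b-val x (fQ qx _ _ _) = proj₂ qx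
    b-val x (fY qx _ _ _ _ _ _) = proj₂ qx
    unif : ∀ v x y → true ≡ true → f v ≡ false → f x ≡ true → f y ≡ true → arc T v x ≡ arc T v y
    unif v x y _ fv fx fy with class v
    ... | isA refl = contra fv fa
    ... | isB refl = trans (asym T x b (b-val x (view x fx))) (sym (asym T y b (b-val y (view y fy))))
    ... | isP pv = trans (P-val v pv fv x (view x fx)) (sym (P-val v pv fv y (view y fy)))
    ... | isQ qv = trans (asym T x v (Q-val v qv fv x (view x fx))) (sym (asym T y v (Q-val v qv fv y (view y fy))))
    ... | isR rv = trans (asym T x v (R-val v rv x (view x fx))) (sym (asym T y v (R-val v rv y (view y fy))))

-- Without such a cycle, `P⟶Q` for T and for its dual makes Q with a and b an interval, hence all of
-- V. Then a dominates every other vertex, and V without a is a nontrivial interval.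
cycle-exists : ∀ {n} {T : Tournament n} {a b} → Avoids T a b → (∃ λ v → v ≢ a × v ≢ b) → ∃ (CycleWith T a b)
cycle-exists {n} {T} {a} {b} av (v₀ , v₀≢a , v₀≢b) with any? (λ c → (arc T b c ≟ᴮ true) ×-dec (arc T c a ≟ᴮ true))
... | yes (c , bc , ca) = c , record { ab = Avoids.a⟶b av ; bc = bc ; ca = ca }
... | no none' = ⊥-elim last-step
  where
  open Avoids av
  module A = Acyclic av (λ c bc → refute λ ca → none' (c , bc , ca))
  module A* = Acyclic (dual-avoids av) (λ c ca → refute λ bc → none' (c , bc , ca))
  open A using (P; Q; R; class; isA; isB; isP; isQ; isR; P⟶b; a⟶R)
  f : VSet n
  f x = not (arc T x a) ∧ not (arc T b x)
  f⁻ : ∀ x → f x ≡ true → arc T x a ≡ false × arc T b x ≡ false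
  f⁻ x h = let (h₁ , h₂) = ∧⁻ {not (arc T x a)} h in not-true⁻ h₁ , not-true⁻ h₂
  P⟶f : ∀ {x y} → P x → f y ≡ true → arc T x y ≡ true
  P⟶f {x} {y} px fy with class y
  ... | isA refl = px
  ... | isB refl = P⟶b px
  ... | isP py = true≢false py (proj₁ (f⁻ y fy))
  ... | isR ry = true≢false ry (proj₂ (f⁻ y fy))
  ... | isQ qy = [ (λ h → ⊥-elim (A.P⟶Q px qy h)) , id ]′ (A.PQ px qy)
  f⟶R : ∀ {x y} → f x ≡ true → R y → arc T x y ≡ true
  f⟶R {x} {y} fx ry with class x
  ... | isA refl = a⟶R ry
  ... | isB refl = ry
  ... | isP px = true≢false px (proj₁ (f⁻ x fx))
  ... | isR rx = true≢false rx (proj₂ (f⁻ x fx))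
  ... | isQ qx = [ (λ h → ⊥-elim (A*.P⟶Q ry (proj₂ qx , proj₁ qx) h)) , id ]′ (A.QR qx ry)
  unif : ∀ x y z → true ≡ true → f x ≡ false → f y ≡ true → f z ≡ true → arc T x y ≡ arc T x z
  unif x y z _ fx fy fz with bool-case (arc T x a) | bool-case (arc T b x)
  ... | inj₁ px | _ = trans (P⟶f px fy) (sym (P⟶f px fz))
  ... | inj₂ _ | inj₁ rx = trans (asym T y x (f⟶R fy rx)) (sym (asym T z x (f⟶R fz rx)))
  ... | inj₂ h | inj₂ h' = true≢false (cong₂ (λ u v → not u ∧ not v) h h') fx
  everywhere : ∀ x → f x ≡ true
  everywhere x = prime f ((λ _ _ → refl) , unif) a b (arc⇒≢ T a⟶b)
    (∧⁺ (not⁺ (irrefl T a)) (not⁺ (asym T a b a⟶b))) (∧⁺ (not⁺ (asym T a b a⟶b)) (not⁺ (irrefl T b))) x refl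
  last-step : ⊥
  last-step = true≢false (prime g ((λ _ _ → refl) , unif') b v₀ (≢-sym v₀≢b) (not⁺ (≢⇒==false (≢-sym (arc⇒≢ T a⟶b)))) (not⁺ (≢⇒==false v₀≢a)) a refl) (cong not (==-refl a))
    where
    g : VSet n
    g x = not (x == a)
    dom : ∀ y → g y ≡ true → arc T a y ≡ true
    dom y h = trans (flip-arc T (undoes⁻ (y ≟ a) (not-true⁻ h))) (cong not (proj₁ (f⁻ y (everywhere y))))
    unif' : ∀ x y z → true ≡ true → g x ≡ false → g y ≡ true → g z ≡ true → arc T x y ≡ arc T x z
    unif' x y z _ gx gy gz with does⁻ (x ≟ a) (not-cong⁻ gx)
    ... | refl = trans (dom y gy) (sym (dom z gz))

-- From the families back to W5 and the support

data Label : Set where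
  onCycle : Fin 3 → Label
  typ : Ty → Label

opaque
  allLabels : (Label → Bool) → Bool
  allLabels f = allF (f ∘ onCycle) ∧ allTy (f ∘ typ)

  allLabels⁻ : ∀ f → allLabels f ≡ true → ∀ A → f A ≡ true
  allLabels⁻ f h (onCycle i) = allF⁻ {f = f ∘ onCycle} (proj₁ (∧⁻ {allF (f ∘ onCycle)} h)) i
  allLabels⁻ f h (typ s) = allVec⁻ 3 {f ∘ typ} (proj₂ (∧⁻ {allF (f ∘ onCycle)} h)) s

labels : Finite Label
labels = record { every = allLabels ; sound = allLabels⁻ }

present : Matching → Ty → Bool
present l s = anyL (λ (s' , t') → (s ≡ᵗ s') ∨ (s ≡ᵗ t')) l

-- The constraints on arcs in a tournament of the family l: pairs are determined by the types unless
-- they lie in one component, where neighbourhoods are nested.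
okL : Matching → Label → Bool
okL l (onCycle _) = true
okL l (typ s) = present l s

okP : Matching → Label → Label → Bool → Bool
okP l (onCycle i) (onCycle j) d = not (d xor mat base i j)
okP l (onCycle i) (typ t) d = d xor lookup t i
okP l (typ s) (onCycle j) d = not (d xor lookup s j)
okP l (typ s) (typ t) d = (s ≡ᵗ t) ∨ matched l s t ∨ not (d xor def s t)

okT : Label → Label → Label → Bool → Bool → Bool → Bool
okT (typ s) (typ s') (typ t) xy zy zx = (s ≡ᵗ s') ⇒ adj s t xy ⇒ not (adj s' t zy) ⇒ not (zx xor def s' s)
okT _ _ _ _ _ _ = true

isAB : Label → Bool
isAB (onCycle zero) = true
isAB (onCycle (suc zero)) = true
isAB _ = false

module Embedding (l : Matching) where

  pair : Fin 5 → Fin 5 → Label → Label → Bool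
  pair i j A B = okP l A B (arcW5 i j)

  triple : Fin 5 → Fin 5 → Fin 5 → Label → Label → Label → Bool
  triple i j k A B C = t i j k A B C ∧ t j i k B A C ∧ t i k j A C B ∧ t k i j C A B ∧ t j k i B C A ∧ t k j i C B A
    where
    t : Fin 5 → Fin 5 → Fin 5 → Label → Label → Label → Bool
    t i j k A B C = okT A B C (arcW5 i k) (arcW5 j k) (arcW5 j i)

  free₂ : Label × Label → Bool
  free₃ : Label → Label → Label → Bool
  free₄ : Label → Label → Label → Label → Bool
  free₅ : Label → Label → Label → Label → Label → Bool
  free₂ (A , B) = okL l A ⇒ okL l B ⇒ pair 0F 1F A B ⇒ every labels (free₃ A B)
  free₃ A B C = okL l C ⇒ pair 0F 2F A C ∧ pair 1F 2F B C ∧ triple 0F 1F 2F A B C ⇒ every labels (free₄ A B C)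
  free₄ A B C D = okL l D ⇒ pair 0F 3F A D ∧ pair 1F 3F B D ∧ pair 2F 3F C D ∧
    triple 0F 1F 3F A B D ∧ triple 0F 2F 3F A C D ∧ triple 1F 2F 3F B C D ⇒ every labels (free₅ A B C D)
  free₅ A B C D E = okL l E ⇒ pair 0F 4F A E ∧ pair 1F 4F B E ∧ pair 2F 4F C E ∧ pair 3F 4F D E ∧
    triple 0F 1F 4F A B E ∧ triple 0F 2F 4F A C E ∧ triple 0F 3F 4F A D E ∧ triple 1F 2F 4F B C E ∧ triple 1F 3F 4F B D E ∧ triple 2F 3F 4F C D E ⇒
    not (isAB A ∨ isAB B ∨ isAB C ∨ isAB D ∨ isAB E)

  -- T may be large, but a copy of W5 shows only five labels, subject to the constraints on pairs
  -- and triples. Labels are assigned one vertex at a time, so that the constraints prune the search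
  -- before the next choice.
  ab-free : Bool
  ab-free = every (labels ⊗ labels) free₂

without-a without-b : Ty → Vec Bool 2
without-a (q ∷ r ∷ s ∷ []) = r ∷ s ∷ []
without-b (q ∷ r ∷ s ∷ []) = q ∷ s ∷ []

rows-less : (Ty → Vec Bool 2) → Bool → Ty → Ty → Ty → Ty → Rows 6
rows-less sel d s t s' t' = [] ▷ [] ▷ (d ∷ []) ▷ sel s ▷ (not (def t s) ∷ sel t) ▷ (def s' t ∷ def s' s ∷ sel s') ▷
  (not (def t' s') ∷ def t' t ∷ def t' s ∷ sel t')

c-and-outer : List (Fin 7)
c-and-outer = 0F ∷ 1F ∷ 2F ∷ 3F ∷ 6F ∷ []

-- Two edges of different components span with c a copy of W5, which is extended by a and by b.
companion : Matching → Ty × Ty → Ty × Ty → Bool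
companion l (s , t) (s' , t') = matched l s' t' ∧ not (s ≡ᵗ s') ∧ not (s ≡ᵗ t') ∧ not (t ≡ᵗ s') ∧ not (t ≡ᵗ t') ∧
  allL (λ i → w5on (mat (rows-two s t s' t')) (i ==_)) c-and-outer ∧
  indecB (rows-less without-a true s t s' t') ∧ indecB (rows-less without-b false s t s' t')

companions : Matching → Bool
companions l = every (ty ⊗ ty) λ (s , t) → matched l s t ⇒ anyL (companion l (s , t)) l

family-check : Matching → Bool
family-check l = Embedding.ab-free l ∧ companions l

opaque
  unfolding w5on indecB allLabels

  base-prime : indecB base ≡ true
  base-prime = refl

  checkH : family-check famH ≡ true
  checkH = refl
  checkI : family-check famI ≡ true
  checkI = refl
  checkJ : family-check famJ ≡ true
  checkJ = refl
  checkK : family-check famK ≡ true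
  checkK = refl
  checkL : family-check famL ≡ true
  checkL = refl

count-none : ∀ {n} → count {n} (λ _ → false) ≡ 0
count-none {zero} = refl
count-none {suc n} = count-none {n}

count-setOf : ∀ {n m} {vs : Vec (Fin n) m} → Distinct vs → count (setOf vs) ≡ m
count-setOf {n} {vs = []} [] = count-none {n}
count-setOf {vs = x ∷ xs} (q ∷ qs) = trans (count-⊕ {u = setOf xs} (setOf-∉ xs q)) (cong suc (count-setOf qs))

-- The complements of a three-vertex and a six-vertex set differ in size by an odd number.
gap-parity : ∀ {n} {vs : Vec (Fin n) 3} {ws : Vec (Fin n) 6} → Distinct vs → Distinct ws → EvenGap (setOf vs) → EvenGap (setOf ws) → ⊥
gap-parity {n} {vs} {ws} d d' g g' with evenGap-count g | evenGap-count g'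
... | k , e | k' , e' = odd k k' 3 (trans (sym (cong (double k +_) (count-setOf d))) (trans e (trans (sym e') (cong (double k' +_) (count-setOf d')))))
  where
  odd : ∀ k k' j → double k + j ≡ double k' + suc (suc (suc j)) → ⊥
  odd zero zero j h = <-irrefl h (s≤s (m≤n⇒m≤1+n (n≤1+n j)))
  odd zero (suc k') j h = <-irrefl h (s≤s (m≤n⇒m≤1+n (≤-trans (m≤n⇒m≤1+n (m≤n⇒m≤1+n (n≤1+n j))) (m≤n+m (suc (suc (suc j))) (double k')))))
  odd (suc zero) zero j h = <-irrefl (ℕ-suc-injective (ℕ-suc-injective h)) (n<1+n j)
  odd (suc (suc k)) zero j h = <-irrefl (sym (ℕ-suc-injective (ℕ-suc-injective (ℕ-suc-injective h)))) (s≤s (m≤n+m j (double k)))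
  odd (suc k) (suc k') j h = odd k k' j (ℕ-suc-injective (ℕ-suc-injective h))

matched⇒present : ∀ l s t → matched l s t ≡ true → present l s ≡ true
matched⇒present ((s' , t') ∷ l) s t h with ∨⁻ {pairᵇ s t (s' , t')} h
... | inj₂ h' = ∨⁺ʳ {(s ≡ᵗ s') ∨ (s ≡ᵗ t')} (matched⇒present l s t h')
... | inj₁ h' with ∨⁻ {(s ≡ᵗ s') ∧ (t ≡ᵗ t')} h'
...   | inj₁ q = ∨⁺ˡ (∨⁺ˡ (proj₁ (∧⁻ {s ≡ᵗ s'} q)))
...   | inj₂ q = ∨⁺ˡ (∨⁺ʳ {s ≡ᵗ s'} (proj₁ (∧⁻ {s ≡ᵗ t'} q)))

xor-not : ∀ {q r} → q ≡ not r → (q xor r) ≡ true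
xor-not {true} {false} refl = refl
xor-not {false} {true} refl = refl

module Reverse {n : ℕ} (T : Tournament n) (a b c : Fin n)
  (ab : T ∶ a ⟶ b) (bc : T ∶ b ⟶ c) (ca : T ∶ c ⟶ a) (loc : Cycle.Local T a b c ab bc ca) (prT : Prime T allᵛ)
  (l : Matching) (fam : Families.Family T a b c ab bc ca l) (chk : family-check l ≡ true) where

  open Cycle T a b c ab bc ca
  open Local loc
  open Families T a b c ab bc ca
  open TwoEdges T a b c ab bc ca loc
  open Critical T a b c ab bc ca loc prT

  -- Inside a block non-adjacency says nothing about the arc. But a neighbour `w` of `y` is not
  -- adjacent to `x` by `l1`, so `l2` along the edge from `y` to `w` supplies the default.
  cross : ∀ {x y} → Outside x → Outside y → (τ x ≡ᵗ τ y) ≡ false → matched l (τ x) (τ y) ≡ false → arc T x y ≡ def (τ x) (τ y)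
  cross {x} {y} ox oy ne nm with partner y oy
  ... | w , ow , yw = l2 oy ow ox yw (refute λ h → true≢false (subst (λ t → (τ x ≡ᵗ t) ≡ true) (l1 ow ox oy (~-sym⁺ {x} {w} h) (~-sym⁺ {y} {w} yw)) (≡ᵗ-refl (τ x))) ne)
        (refute λ h → true≢false (edge fam ox oy h) nm) (λ where refl → true≢false (≡ᵗ-refl (τ x)) ne)

  present-type : ∀ x → Outside x → present l (τ x) ≡ true
  present-type x ox with partner x ox
  ... | y , oy , h = matched⇒present l (τ x) (τ y) (edge fam ox oy h)

  data Labelled : Fin n → Label → Set where
    in-cycle : ∀ i → Labelled (lookup X i) (onCycle i)
    outer    : ∀ {x} → Outside x → Labelled x (typ (τ x))

  labelled : ∀ x → ∃ (Labelled x)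
  labelled x with in-or-out x
  ... | inj₁ (i , refl) = onCycle i , in-cycle i
  ... | inj₂ o = typ (τ x) , outer o

  okL⁺ : ∀ {x A} → Labelled x A → okL l A ≡ true
  okL⁺ (in-cycle i) = refl
  okL⁺ (outer o) = present-type _ o

  okP⁺ : ∀ {x y A B} → Labelled x A → Labelled y B → okP l A B (arc T x y) ≡ true
  okP⁺ (in-cycle i) (in-cycle j) = not⁺ (xor-≡ (X-arc i j))
  okP⁺ {y = y} (in-cycle i) (outer o) = xor-not (trans (flip-arc T (lookup⁺ o i)) (cong not (sym (τ-lookup y i))))
  okP⁺ {x} (outer o) (in-cycle j) = not⁺ (xor-≡ (sym (τ-lookup x j)))
  okP⁺ {x} {y} (outer o) (outer o') with bool-case (τ x ≡ᵗ τ y) | bool-case (matched l (τ x) (τ y))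
  ... | inj₁ h | _ = ∨⁺ˡ h
  ... | _ | inj₁ h = ∨⁺ʳ {τ x ≡ᵗ τ y} (∨⁺ˡ h)
  ... | inj₂ h | inj₂ h' = ∨⁺ʳ {τ x ≡ᵗ τ y} (∨⁺ʳ {matched l (τ x) (τ y)} (not⁺ (xor-≡ (cross o o' h h'))))

  imp : ∀ {q r} → (q ≡ true → r ≡ true) → (q ⇒ r) ≡ true
  imp {true} h = h refl
  imp {false} h = refl

  okT⁺ : ∀ {x z y A B C} → Labelled x A → Labelled z B → Labelled y C → z ≢ x → okT A B C (arc T x y) (arc T z y) (arc T z x) ≡ true
  okT⁺ {x} {z} {y} (outer ox) (outer oz) (outer oy) z≢x = imp λ e → imp λ xy → imp λ zy → not⁺ (xor-≡
    (l2 ox oy oz xy (not-true⁻ zy) (~-same {z} {x} (cong block (sym (≡ᵗ⁻ (τ x) (τ z) e)))) z≢x))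
  okT⁺ (in-cycle _) _ _ _ = refl
  okT⁺ (outer _) (in-cycle _) _ _ = refl
  okT⁺ (outer _) (outer _) (in-cycle _) _ = refl

  module Copy (f : Fin 5 → Fin n) (f-inj : ∀ {i j} → f i ≡ f j → i ≡ j) (arcs : ∀ i j → arc T (f i) (f j) ≡ arcW5 i j) where
    open Embedding l

    L : Fin 5 → Label
    L j = proj₁ (labelled (f j))

    ll : ∀ j → Labelled (f j) (L j)
    ll j = proj₂ (labelled (f j))

    pr₂ : ∀ i j → pair i j (L i) (L j) ≡ true
    pr₂ i j = trans (cong (okP l (L i) (L j)) (sym (arcs i j))) (okP⁺ (ll i) (ll j))

    tr₁ : ∀ i j k → i ≢ j → okT (L i) (L j) (L k) (arcW5 i k) (arcW5 j k) (arcW5 j i) ≡ true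
    tr₁ i j k i≢j = trans (cong₂ (λ u (v , w) → okT (L i) (L j) (L k) u v w) (sym (arcs i k)) (cong₂ _,_ (sym (arcs j k)) (sym (arcs j i))))
      (okT⁺ (ll i) (ll j) (ll k) (λ e → i≢j (sym (f-inj e))))

    tr₃ : ∀ i j k → i ≢ j → i ≢ k → j ≢ k → triple i j k (L i) (L j) (L k) ≡ true
    tr₃ i j k ij ik jk = ∧⁺ (tr₁ i j k ij) (∧⁺ (tr₁ j i k (≢-sym ij)) (∧⁺ (tr₁ i k j ik) (∧⁺ (tr₁ k i j (≢-sym ik)) (∧⁺ (tr₁ j k i jk) (tr₁ k j i (≢-sym jk))))))

    conclusion : not (isAB (L 0F) ∨ isAB (L 1F) ∨ isAB (L 2F) ∨ isAB (L 3F) ∨ isAB (L 4F)) ≡ true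
    conclusion = ⇒⁻ {pair 0F 4F A E ∧ pair 1F 4F B E ∧ pair 2F 4F C E ∧ pair 3F 4F D E ∧
        triple 0F 1F 4F A B E ∧ triple 0F 2F 4F A C E ∧ triple 0F 3F 4F A D E ∧ triple 1F 2F 4F B C E ∧ triple 1F 3F 4F B D E ∧ triple 2F 3F 4F C D E}
      (⇒⁻ {okL l E} (sound labels (free₅ A B C D) h₅ E) (okL⁺ (ll 4F)))
      (∧⁺ (pr₂ 0F 4F) (∧⁺ (pr₂ 1F 4F) (∧⁺ (pr₂ 2F 4F) (∧⁺ (pr₂ 3F 4F) (∧⁺ (tr₃ 0F 1F 4F (λ ()) (λ ()) (λ ())) (∧⁺ (tr₃ 0F 2F 4F (λ ()) (λ ()) (λ ()))
        (∧⁺ (tr₃ 0F 3F 4F (λ ()) (λ ()) (λ ())) (∧⁺ (tr₃ 1F 2F 4F (λ ()) (λ ()) (λ ())) (∧⁺ (tr₃ 1F 3F 4F (λ ()) (λ ()) (λ ())) (tr₃ 2F 3F 4F (λ ()) (λ ()) (λ ())))))))))))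
      where
      A B C D E : Label
      A = L 0F
      B = L 1F
      C = L 2F
      D = L 3F
      E = L 4F
      h₃ : every labels (free₃ A B) ≡ true
      h₃ = ⇒⁻ {pair 0F 1F A B} (⇒⁻ {okL l B} (⇒⁻ {okL l A} (sound (labels ⊗ labels) free₂ (proj₁ (∧⁻ {ab-free} {companions l} chk)) (A , B)) (okL⁺ (ll 0F))) (okL⁺ (ll 1F))) (pr₂ 0F 1F)
      h₄ : every labels (free₄ A B C) ≡ true
      h₄ = ⇒⁻ {pair 0F 2F A C ∧ pair 1F 2F B C ∧ triple 0F 1F 2F A B C} (⇒⁻ {okL l C} (sound labels (free₃ A B) h₃ C) (okL⁺ (ll 2F)))
        (∧⁺ (pr₂ 0F 2F) (∧⁺ (pr₂ 1F 2F) (tr₃ 0F 1F 2F (λ ()) (λ ()) (λ ()))))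
      h₅ : every labels (free₅ A B C D) ≡ true
      h₅ = ⇒⁻ {pair 0F 3F A D ∧ pair 1F 3F B D ∧ pair 2F 3F C D ∧ triple 0F 1F 3F A B D ∧ triple 0F 2F 3F A C D ∧ triple 1F 2F 3F B C D}
        (⇒⁻ {okL l D} (sound labels (free₄ A B C) h₄ D) (okL⁺ (ll 3F)))
        (∧⁺ (pr₂ 0F 3F) (∧⁺ (pr₂ 1F 3F) (∧⁺ (pr₂ 2F 3F) (∧⁺ (tr₃ 0F 1F 3F (λ ()) (λ ()) (λ ())) (∧⁺ (tr₃ 0F 2F 3F (λ ()) (λ ()) (λ ())) (tr₃ 1F 2F 3F (λ ()) (λ ()) (λ ())))))))

    not-AB : ∀ j → isAB (L j) ≡ false
    not-AB j = pick j (∨-false⁻ {isAB (L 0F)} (not-true⁻ conclusion))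
      where
      pick : ∀ j → isAB (L 0F) ≡ false × (isAB (L 1F) ∨ isAB (L 2F) ∨ isAB (L 3F) ∨ isAB (L 4F)) ≡ false → isAB (L j) ≡ false
      pick 0F (h , _) = h
      pick 1F (_ , h) = proj₁ (∨-false⁻ {isAB (L 1F)} h)
      pick 2F (_ , h) = proj₁ (∨-false⁻ {isAB (L 2F)} (proj₂ (∨-false⁻ {isAB (L 1F)} h)))
      pick 3F (_ , h) = proj₁ (∨-false⁻ {isAB (L 3F)} (proj₂ (∨-false⁻ {isAB (L 2F)} (proj₂ (∨-false⁻ {isAB (L 1F)} h)))))
      pick 4F (_ , h) = proj₂ (∨-false⁻ {isAB (L 3F)} (proj₂ (∨-false⁻ {isAB (L 2F)} (proj₂ (∨-false⁻ {isAB (L 1F)} h)))))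

  ab-label : ∀ {x A} i → isAB (onCycle i) ≡ true → x ≡ lookup X i → Labelled x A → isAB A ≡ true
  ab-label i h e (in-cycle j) with refl ← lookup-injective X-distinct j i e = h
  ab-label i h e (outer o) = ⊥-elim (lookup⁺ o i e)

  ∉W5 : ∀ i → isAB (onCycle i) ≡ true → ¬ InW5 T (lookup X i)
  ∉W5 i h (f , f-inj , arcs , j , e) = true≢false (ab-label i h e (Copy.ll f f-inj arcs j)) (Copy.not-AB f f-inj arcs j)

  na : ¬ InW5 T a
  na = ∉W5 0F refl

  nb : ¬ InW5 T b
  nb = ∉W5 1F refl

  X-gap : EvenGap Xˢ
  X-gap = [ id , (λ (v , v∉ , q) → ⊥-elim (outside-critical v (setOf-∉⁻ X v∉) q)) ]′
    (climb T prT Xˢ (indecB-sound T X-distinct (trans (cong indecB X-rows) base-prime)) a b c (setOf⁺ X 0F) (setOf⁺ X 1F) (setOf⁺ X 2F) a≢b a≢c b≢c)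

  -- Adding vertices to Y two at a time ends at all vertices but one, which can only be the i-th of the cycle.
  minus : ∀ i (Y : Vec (Fin n) 6) → Distinct Y → Prime T (setOf Y) → ∀ {u v w} → u ≢ v → u ≢ w → v ≢ w →
    setOf Y u ≡ true → setOf Y v ≡ true → setOf Y w ≡ true → (∀ j → j ≢ i → setOf Y (lookup X j) ≡ true) → Prime T (allᵛ ∖ lookup X i)
  minus i Y dis pr {u} {v} {w} uv uw vw hu hv hw others =
    [ (λ g → ⊥-elim (gap-parity X-distinct dis X-gap g)) , (λ (z , z∉ , q) → at-end z z∉ q (in-or-out z)) ]′ (climb T prT (setOf Y) pr u v w hu hv hw uv uw vw)
    where
    at-end : ∀ z → setOf Y z ≡ false → Prime T (allᵛ ∖ z) → (∃ λ j → lookup X j ≡ z) ⊎ Outside z → Prime T (allᵛ ∖ lookup X i)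
    at-end z z∉ q (inj₂ oz) = ⊥-elim (outside-critical z oz q)
    at-end z z∉ q (inj₁ (j , refl)) with j ≟ i
    ... | yes refl = q
    ... | no ne = true≢false (others j ne) z∉

  module Companion {x y : Fin n} (ox : Outside x) (oy : Outside y) (xy : x ~ y ≡ true) where

    found : ∃ λ e → companion l (τ x , τ y) e ≡ true
    found = anyL⁻ {f = companion l (τ x , τ y)} l (⇒⁻ {matched l (τ x) (τ y)}
      (sound (ty ⊗ ty) (λ (s , t) → matched l s t ⇒ anyL (companion l (s , t)) l) (proj₂ (∧⁻ {Embedding.ab-free l} {companions l} chk)) (τ x , τ y)) (edge fam ox oy xy))

    module Use {x' y' : Fin n} (ox' : Outside x') (oy' : Outside y') (x'y' : x' ~ y' ≡ true)
      (h : companion l (τ x , τ y) (τ x' , τ y') ≡ true) where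

      private
        s t s' t' : Ty
        s = τ x
        t = τ y
        s' = τ x'
        t' = τ y'
        c₁ = ∧⁻ {matched l s' t'} h
        c₂ = ∧⁻ {not (s ≡ᵗ s')} (proj₂ c₁)
        c₃ = ∧⁻ {not (s ≡ᵗ t')} (proj₂ c₂)
        c₄ = ∧⁻ {not (t ≡ᵗ s')} (proj₂ c₃)
        c₅ = ∧⁻ {not (t ≡ᵗ t')} (proj₂ c₄)
        c₆ = ∧⁻ {allL (λ i → w5on (mat (rows-two s t s' t')) (i ==_)) c-and-outer} (proj₂ c₅)
        c₇ = ∧⁻ {indecB (rows-less without-a true s t s' t')} (proj₂ c₆)
      open Apart ox oy ox' oy' xy x'y' (not-true⁻ (proj₁ c₂)) (not-true⁻ (proj₁ c₃)) (not-true⁻ (proj₁ c₄)) (not-true⁻ (proj₁ c₅))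

      at-root : ∀ i → w5on (mat (rows-two s t s' t')) (i ==_) ≡ true → InW5 T (lookup (y' ∷ x' ∷ y ∷ x ∷ X) i)
      at-root i w = let (j , e , inw) = w5on-sound T {vs = y' ∷ x' ∷ y ∷ x ∷ X} dis (i ==_) (trans (cong (λ R → w5on (mat R) (i ==_)) rows) w) in subst (λ k → InW5 T (lookup (y' ∷ x' ∷ y ∷ x ∷ X) k)) (sym (==⁻ i j e)) inw

      x∈W5 : InW5 T x
      x∈W5 = at-root 3F (proj₁ (∧⁻ {r 3F} (proj₂ (∧⁻ {r 2F} (proj₂ (∧⁻ {r 1F} (proj₂ (∧⁻ {r 0F} (proj₁ c₆)))))))))
        where
        r : Fin 7 → Bool
        r i = w5on (mat (rows-two s t s' t')) (i ==_)

      c∈W5 : InW5 T c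
      c∈W5 = at-root 6F (proj₁ (∧⁻ {r 6F} (proj₂ (∧⁻ {r 3F} (proj₂ (∧⁻ {r 2F} (proj₂ (∧⁻ {r 1F} (proj₂ (∧⁻ {r 0F} (proj₁ c₆)))))))))))
        where
        r : Fin 7 → Bool
        r i = w5on (mat (rows-two s t s' t')) (i ==_)

      bc-distinct : Distinct (y' ∷ x' ∷ y ∷ x ∷ b ∷ c ∷ [])
      bc-distinct = outer-distinct (tl oy') (tl ox') (tl oy) (tl ox) ((b≢c ∷ []) ∷ [] ∷ [])
        where
        tl : ∀ {v} → Outside v → All (v ≢_) (b ∷ c ∷ [])
        tl (_ ∷ q) = q

      ac-distinct : Distinct (y' ∷ x' ∷ y ∷ x ∷ a ∷ c ∷ [])
      ac-distinct = outer-distinct (tl oy') (tl ox') (tl oy) (tl ox) ((a≢c ∷ []) ∷ [] ∷ [])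
        where
        tl : ∀ {v} → Outside v → All (v ≢_) (a ∷ c ∷ [])
        tl (q ∷ _ ∷ r ∷ []) = q ∷ r ∷ []

      bc-prime : Prime T (setOf (y' ∷ x' ∷ y ∷ x ∷ b ∷ c ∷ []))
      bc-prime = indecB-sound T bc-distinct (trans (cong indecB (trans (outer-rows (b ∷ c ∷ [])) (cong (λ d → rows-less without-a d s t s' t') bc))) (proj₁ c₇))

      ac-prime : Prime T (setOf (y' ∷ x' ∷ y ∷ x ∷ a ∷ c ∷ []))
      ac-prime = indecB-sound T ac-distinct (trans (cong indecB (trans (outer-rows (a ∷ c ∷ [])) (cong (λ d → rows-less without-b d s t s' t') (asym T c a ca)))) (proj₂ c₇))

      minus-a : Prime T (allᵛ ∖ a)
      minus-a = minus 0F Y bc-distinct bc-prime b≢c (≢-sym (lookup⁺ ox 1F)) (≢-sym (lookup⁺ ox 2F)) (setOf⁺ Y 4F) (setOf⁺ Y 5F) (setOf⁺ Y 3F) others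
        where
        Y : Vec (Fin n) 6
        Y = y' ∷ x' ∷ y ∷ x ∷ b ∷ c ∷ []
        others : ∀ j → j ≢ 0F → setOf Y (lookup X j) ≡ true
        others 0F ne = ⊥-elim (ne refl)
        others 1F _ = setOf⁺ Y 4F
        others 2F _ = setOf⁺ Y 5F

      minus-b : Prime T (allᵛ ∖ b)
      minus-b = minus 1F Y ac-distinct ac-prime a≢c (≢-sym (lookup⁺ ox 0F)) (≢-sym (lookup⁺ ox 2F)) (setOf⁺ Y 4F) (setOf⁺ Y 5F) (setOf⁺ Y 3F) others
        where
        Y : Vec (Fin n) 6
        Y = y' ∷ x' ∷ y ∷ x ∷ a ∷ c ∷ []
        others : ∀ j → j ≢ 1F → setOf Y (lookup X j) ≡ true
        others 0F _ = setOf⁺ Y 4F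
        others 1F ne = ⊥-elim (ne refl)
        others 2F _ = setOf⁺ Y 5F

    consequences : InW5 T x × InW5 T c × Prime T (allᵛ ∖ a) × Prime T (allᵛ ∖ b)
    consequences with found
    ... | (s' , t') , h with real fam s' t' (proj₁ (∧⁻ {matched l s' t'} h))
    ...   | x' , y' , ox' , oy' , x'y' , refl , refl = U.x∈W5 , U.c∈W5 , U.minus-a , U.minus-b
      where module U = Use ox' oy' x'y' h

  module _ (e₀ : ∃ HasEdge) where

    at-edge : InW5 T c × Prime T (allᵛ ∖ a) × Prime T (allᵛ ∖ b)
    at-edge = let (_ , (_ , _ , ox , oy , xy , _)) = e₀ in proj₂ (Companion.consequences ox oy xy)

    -- Besides giving membership in the class, this makes `Local` available at every other 3-cycle
    -- through a → b.
    avoids : Avoids T a b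
    avoids = record { prime = prT ; na = na ; nb = nb ; cover = cover ; a⟶b = ab }
      where
      cover : ∀ v → v ≢ a → v ≢ b → InW5 T v
      cover v v≢a v≢b with in-or-out v
      ... | inj₁ (0F , refl) = ⊥-elim (v≢a refl)
      ... | inj₁ (1F , refl) = ⊥-elim (v≢b refl)
      ... | inj₁ (2F , refl) = proj₁ at-edge
      ... | inj₂ ov with partner v ov
      ...   | w , ow , h = proj₁ (Companion.consequences ov ow h)

    -- c is outside another 3-cycle through a → b.
    critical-by-cycle : ∀ x → Outside x → arc T x a ≡ true → arc T x b ≡ false → ¬ Prime T (allᵛ ∖ c)
    critical-by-cycle x ox@(_ ∷ x≢b ∷ x≢c ∷ []) xa xb = Critical.outside-critical T a b x ab (CycleWith.bc cyc') (CycleWith.ca cyc')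
        (avoids⇒local avoids cyc') prT c (≢-sym a≢c ∷ ≢-sym b≢c ∷ ≢-sym x≢c ∷ [])
      where
      cyc' : CycleWith T a b x
      cyc' = record { ab = ab ; bc = trans (flip-arc T x≢b) (cong not xb) ; ca = xa }

  -- A component together with a is an interval of T − c.
  module-body : (Ty → Bool) → Ty × Ty → Bool
  module-body ins (s , t) = present l s ⇒ present l t ⇒ ins t ⇒ lookup t 1F ∧
    (not (ins s) ⇒ not (s ≡ᵗ t) ∧ not (matched l s t) ∧ not (def s t xor lookup s 0F))

  -- Needed for H and J: they contain neither `m2` nor `p2`, so c is the only vertex closing a
  -- 3-cycle with a → b, and `critical-by-cycle` does not apply.
  critical-by-module : ∀ ins → every (ty ⊗ ty) (module-body ins) ≡ true → (∃ λ x → Outside x × ins (τ x) ≡ true) → ¬ Prime T (allᵛ ∖ c)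
  critical-by-module ins chk' (x₀ , ox₀ , ix₀) pr = true≢false (pr f (sub , unif) a x₀ (≢-sym (lookup⁺ ox₀ 0F)) fa fx₀ b (not⁺ (≢⇒==false {x = b} {c} b≢c))) fb
    where
    f : VSet n
    f v = (v == a) ∨ (outᵇ v ∧ ins (τ v))
    fa : f a ≡ true
    fa = ∨⁺ˡ (==-refl a)
    fx₀ : f x₀ ≡ true
    fx₀ = ∨⁺ʳ {x₀ == a} (∧⁺ (outside⁺ ox₀) ix₀)
    fb : f b ≡ false
    fb = trans (cong (_∨ (outᵇ b ∧ ins (τ b))) (≢⇒==false {x = b} {a} (≢-sym a≢b))) (cong (λ d → not d ∧ ins (τ b)) (setOf⁺ X 1F))
    f⁻ : ∀ v → f v ≡ true → v ≡ a ⊎ (Outside v × ins (τ v) ≡ true)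
    f⁻ v h with ∨⁻ {v == a} h
    ... | inj₁ e = inj₁ (==⁻ v a e)
    ... | inj₂ e = let (o , i) = ∧⁻ {outᵇ v} e in inj₂ (outside⁻ v o , i)
    sub : f ⊆ᵛ (allᵛ ∖ c)
    sub v h = not⁺ (≢⇒==false {x = v} {c} λ where refl → case f⁻ v h of λ where
      (inj₁ e) → a≢c (sym e)
      (inj₂ (_ ∷ _ ∷ v≢v ∷ [] , _)) → v≢v refl)
    checked : ∀ {v y} → Outside v → Outside y → ins (τ y) ≡ true → lookup (τ y) 1F ∧
      (not (ins (τ v)) ⇒ not (τ v ≡ᵗ τ y) ∧ not (matched l (τ v) (τ y)) ∧ not (def (τ v) (τ y) xor lookup (τ v) 0F)) ≡ true
    checked {v} {y} ov oy iy = ⇒⁻ {ins (τ y)} (⇒⁻ {present l (τ y)} (⇒⁻ {present l (τ v)} (sound (ty ⊗ ty) (module-body ins) chk' (τ v , τ y))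
      (present-type v ov)) (present-type y oy)) iy
    val : ∀ v y → (allᵛ ∖ c) v ≡ true → f v ≡ false → f y ≡ true → arc T v y ≡ arc T v a
    val v y vc fv fy with f⁻ y fy | in-or-out v
    ... | inj₁ refl | _ = refl
    ... | inj₂ _ | inj₁ (0F , refl) = true≢false fa fv
    ... | inj₂ _ | inj₁ (2F , refl) = true≢false vc (cong not (==-refl c))
    ... | inj₂ (oy , iy) | inj₁ (1F , refl) = trans (asym T y b (proj₁ (∧⁻ {lookup (τ y) 1F} (checked oy oy iy)))) (sym (asym T a b ab))
    ... | inj₂ (oy , iy) | inj₂ ov = trans (cross ov oy (not-true⁻ (proj₁ c₁)) (not-true⁻ (proj₁ c₂))) (xor-false (not-true⁻ (proj₂ c₂)))
      where
      c₁ = ∧⁻ {not (τ v ≡ᵗ τ y)} (⇒⁻ {not (ins (τ v))} (proj₂ (∧⁻ {lookup (τ y) 1F} (checked ov oy iy)))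
        (not⁺ (refute λ h → true≢false (∨⁺ʳ {v == a} (∧⁺ (outside⁺ ov) h)) fv)))
      c₂ = ∧⁻ {not (matched l (τ v) (τ y))} (proj₂ c₁)
    unif : ∀ v y z → (allᵛ ∖ c) v ≡ true → f v ≡ false → f y ≡ true → f z ≡ true → arc T v y ≡ arc T v z
    unif v y z vc fv fy fz = trans (val v y vc fv fy) (sym (val v z vc fv fz))

-- The notions of the theorem in terms of types; components of the outside graph

lookup-⊤ : ∀ {n} (x : Fin n) → lookup ⊤ x ≡ true
lookup-⊤ zero = refl
lookup-⊤ (suc x) = lookup-⊤ x

lookup-⁅⁆ : ∀ {n} (x v : Fin n) → lookup ⁅ x ⁆ v ≡ (v == x)
lookup-⁅⁆ zero zero = refl
lookup-⁅⁆ zero (suc v) = lookup-replicate v false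
lookup-⁅⁆ (suc x) zero = refl
lookup-⁅⁆ (suc x) (suc v) = trans (lookup-⁅⁆ x v) (sym (==-suc v x))

lookup-∁⁅⁆ : ∀ {n} (x v : Fin n) → lookup (∁ ⁅ x ⁆) v ≡ (allᵛ ∖ x) v
lookup-∁⁅⁆ x v = trans (lookup-map v not ⁅ x ⁆) (cong not (lookup-⁅⁆ x v))

lookup-∪ : ∀ {n} (A B : Subset n) v → lookup (A ∪ B) v ≡ lookup A v ∨ lookup B v
lookup-∪ A B v = lookup-zipWith _∨_ v A B

-- Since all vertices outside X are critical, growth by pairs from X and from a six-vertex superset
-- would both have to end at V.
critical⇒noSix : ∀ {n} (T : Tournament n) a b c (ab : T ∶ a ⟶ b) (bc : T ∶ b ⟶ c) (ca : T ∶ c ⟶ a) → Prime T allᵛ →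
  (∀ x → Cycle.Outside T a b c ab bc ca x → ¬ Prime T (allᵛ ∖ x)) → Cycle.NoSix T a b c ab bc ca
critical⇒noSix T a b c ab bc ca prT crit x y z ox oy oz xy xz yz pr₆ = gap-parity X-distinct dis X-gap Y-gap
  where
  open Cycle T a b c ab bc ca
  dis : Distinct (z ∷ y ∷ x ∷ X)
  dis = distinct₆ ox oy oz xy xz yz
  X-gap : EvenGap Xˢ
  X-gap = [ id , (λ (v , v∉ , q) → ⊥-elim (crit v (setOf-∉⁻ X v∉) q)) ]′
    (climb T prT Xˢ (indecB-sound T X-distinct (trans (cong indecB X-rows) base-prime)) a b c (setOf⁺ X 0F) (setOf⁺ X 1F) (setOf⁺ X 2F) a≢b a≢c b≢c)
  tl : ∀ {v} → All (v ≢_) (z ∷ y ∷ x ∷ X) → Outside v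
  tl (_ ∷ _ ∷ _ ∷ o) = o
  Y-gap : EvenGap (setOf (z ∷ y ∷ x ∷ X))
  Y-gap = [ id , (λ (v , v∉ , q) → ⊥-elim (crit v (tl (setOf-∉⁻ (z ∷ y ∷ x ∷ X) v∉)) q)) ]′
    (climb T prT (setOf (z ∷ y ∷ x ∷ X)) pr₆ a b c (setOf⁺ (z ∷ y ∷ x ∷ X) 3F) (setOf⁺ (z ∷ y ∷ x ∷ X) 4F) (setOf⁺ (z ∷ y ∷ x ∷ X) 5F) a≢b a≢c b≢c)

five-body : Ty × Ty × Bool → Bool
five-body (s , t , d) = adj s t d ⇒ indecB (base ▷ s ▷ (not d ∷ t))

opaque
  unfolding indecB

  five-check : ∀ q → five-body q ≡ true
  five-check = sound (ty ⊗ ty ⊗ bit) five-body refl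

lookup-ext : ∀ {m} {u v : Vec Bool m} → (∀ i → lookup u i ≡ lookup v i) → u ≡ v
lookup-ext {u = u} {v} h = trans (sym (tabulate∘lookup u)) (trans (tabulate-cong h) (tabulate∘lookup v))

module Standard {k : ℕ} (T : Tournament (3 + k)) (ab : T ∶ v0 ⟶ v1) (bc : T ∶ v1 ⟶ v2) (ca : T ∶ v2 ⟶ v0) where

  open Cycle T v0 v1 v2 ab bc ca

  N3-lookup : ∀ x → lookup N3 x ≡ Xˢ x
  N3-lookup zero = refl
  N3-lookup (suc zero) = refl
  N3-lookup (suc (suc zero)) = refl
  N3-lookup (suc (suc (suc x))) = lookup∘tabulate (λ x → toℕ (suc (suc (suc x))) <ᵇ 3) x

  ∉N3⇒outside : ∀ {x} → x ∉ N3 → Outside x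
  ∉N3⇒outside {x} h = setOf-∉⁻ X (trans (sym (N3-lookup x)) (∉⇒lookup-false h))

  outside⇒∉N3 : ∀ {x} → Outside x → x ∉ N3
  outside⇒∉N3 {x} o = lookup-false⇒∉ (trans (N3-lookup x) (setOf-∉ X o))

  X∈N3 : ∀ i → lookup X i ∈ N3
  X∈N3 i = lookup⇒∈ (trans (N3-lookup (lookup X i)) (setOf⁺ X i))

  N3⇒X : ∀ {y} → y ∈ N3 → ∃ λ i → lookup X i ≡ y
  N3⇒X {y} h = setOf⁻ X (trans (sym (N3-lookup y)) (∈⇒lookup h))

  pair-lookup : ∀ x y v → lookup ((N3 ∪ ⁅ x ⁆) ∪ ⁅ y ⁆) v ≡ setOf (y ∷ x ∷ X) v
  pair-lookup x y v = trans (lookup-∪ (N3 ∪ ⁅ x ⁆) ⁅ y ⁆ v) (cong₂ _∨_ (trans (lookup-∪ N3 ⁅ x ⁆ v) (cong₂ _∨_ (N3-lookup v) (lookup-⁅⁆ x v))) (lookup-⁅⁆ y v))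

  IsType : (Fin (3 + k) → Set) → Ty → Set
  IsType A s = ∀ x → A x ⇔ (Outside x × τ x ≡ s)

  private
    type-of : ∀ {x s} → (∀ i → arc T x (lookup X i) ≡ lookup s i) → τ x ≡ s
    type-of {x} h = lookup-ext λ i → trans (τ-lookup x i) (h i)

    arc-of : ∀ {x s} → τ x ≡ s → ∀ i → arc T x (lookup X i) ≡ lookup s i
    arc-of {x} e i = trans (sym (τ-lookup x i)) (cong (λ t → lookup t i) e)

  minus-type : IsType (Minus T N3) m∅
  minus-type x = mk⇔
    (λ (o , h) → ∉N3⇒outside o , type-of λ i → trans (h (lookup X i) (X∈N3 i)) (sym (lookup-replicate i true)))
    (λ (o , e) → outside⇒∉N3 o , λ y y∈ → case N3⇒X y∈ of λ where (i , refl) → trans (arc-of e i) (lookup-replicate i true))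

  plus-type : IsType (Plus T N3) p∅
  plus-type x = mk⇔
    (λ (o , h) → ∉N3⇒outside o , type-of λ i → trans (asym T (lookup X i) x (h (lookup X i) (X∈N3 i))) (sym (lookup-replicate i false)))
    (λ (o , e) → outside⇒∉N3 o , λ y y∈ → case N3⇒X y∈ of λ where (i , refl) → trans (flip-arc T (lookup⁺ o i)) (cong not (trans (arc-of e i) (lookup-replicate i false))))

  -- `AtU` fixes the arcs to the two other vertices of the cycle; the remaining arc to `u` separates
  -- X⁻(u) from X⁺(u).
  at-type : ∀ u s x → block s ≡ at u → (AtU T N3 (lookup X u) x × arc T x (lookup X u) ≡ lookup s u) ⇔ (Outside x × τ x ≡ s)
  at-type u s x be = mk⇔ to from
    where
    to : AtU T N3 (lookup X u) x × arc T x (lookup X u) ≡ lookup s u → Outside x × τ x ≡ s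
    to ((o , h) , e) = ∉N3⇒outside o , type-of entry
      where
      entry : ∀ i → arc T x (lookup X i) ≡ lookup s i
      entry i with i ≟ u
      ... | yes refl = e
      ... | no i≢u = trans side (sym (trans (at-row s u i be i≢u) (sym (X-arc u i))))
        where
        side : arc T x (lookup X i) ≡ arc T (lookup X u) (lookup X i)
        side with h (lookup X i) (X∈N3 i) (λ e' → i≢u (lookup-injective X-distinct i u e'))
        ... | inj₁ (q , r) = trans (asym T (lookup X i) x r) (sym (asym T (lookup X i) (lookup X u) q))
        ... | inj₂ (q , r) = trans r (sym q)
    from : Outside x × τ x ≡ s → AtU T N3 (lookup X u) x × arc T x (lookup X u) ≡ lookup s u
    from (o , e) = (outside⇒∉N3 o , λ y y∈ y≢ → near y y≢ (N3⇒X y∈)) , arc-of e u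
      where
      near : ∀ y → y ≢ lookup X u → (∃ λ i → lookup X i ≡ y) → (T ∶ y ⟶ lookup X u × T ∶ y ⟶ x) ⊎ (T ∶ lookup X u ⟶ y × T ∶ x ⟶ y)
      near y y≢ (i , refl) with bool-case (arc T (lookup X u) (lookup X i))
      ... | inj₁ q = inj₂ (q , trans same q)
        where
        same : arc T x (lookup X i) ≡ arc T (lookup X u) (lookup X i)
        same = trans (arc-of e i) (trans (at-row s u i be (λ e' → y≢ (cong (lookup X) e'))) (sym (X-arc u i)))
      ... | inj₂ q = inj₁ (trans (flip-arc T (≢-sym y≢)) (cong not q) , trans (flip-arc T (lookup⁺ o i)) (cong not (trans same q)))
        where
        same : arc T x (lookup X i) ≡ arc T (lookup X u) (lookup X i)
        same = trans (arc-of e i) (trans (at-row s u i be (λ e' → y≢ (cong (lookup X) e'))) (sym (X-arc u i)))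

  minusU-type : ∀ u s → block s ≡ at u → lookup s u ≡ true → IsType (MinusU T N3 (lookup X u)) s
  minusU-type u s be e x = mk⇔ (λ (h , q) → E.to (h , trans q (sym e))) (λ h → proj₁ (E.from h) , trans (proj₂ (E.from h)) e)
    where module E = Equivalence (at-type u s x be)

  plusU-type : ∀ u s → block s ≡ at u → lookup s u ≡ false → IsType (PlusU T N3 (lookup X u)) s
  plusU-type u s be e x = mk⇔ (λ (h , q) → E.to (h , trans (asym T (lookup X u) x q) (sym e)))
      (λ h → proj₁ (E.from h) , trans (flip-arc T (lookup⁺ (proj₁ h) u)) (cong not (trans (proj₂ (E.from h)) e)))
    where module E = Equivalence (at-type u s x be)

  indecomposable⇒prime : Indecomposable T → Prime T allᵛ
  indecomposable⇒prime = Indec⇒Prime {T = T} lookup-⊤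

  noncritical⇒prime : ∀ {x} → NonCritical T x → Prime T (allᵛ ∖ x)
  noncritical⇒prime {x} = Indec⇒Prime {T = T} (lookup-∁⁅⁆ x)

  prime⇒noncritical : ∀ {x} → Prime T (allᵛ ∖ x) → NonCritical T x
  prime⇒noncritical {x} = Prime⇒Indec {T = T} (lookup-∁⁅⁆ x)

  module Components (loc : Local) (prT : Prime T allᵛ) where
    open Local loc
    open Structure T v0 v1 v2 ab bc ca loc
    open Critical T v0 v1 v2 ab bc ca loc prT
    open Families T v0 v1 v2 ab bc ca

    C3-critical : C3Critical T
    C3-critical = Prime⇒Indec {T = T} lookup-⊤ prT , arcs , λ x nc → [ (λ (i , e) → subst (_∈ N3) e (X∈N3 i)) , (λ o → ⊥-elim (outside-critical x o (noncritical⇒prime nc))) ]′ (in-or-out x)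
      where
      arcs : ∀ i j → arc T (emb3 i) (emb3 j) ≡ arcC3 i j
      arcs 0F 0F = irrefl T v0
      arcs 0F 1F = ab
      arcs 0F 2F = asym T v2 v0 ca
      arcs 1F 0F = asym T v0 v1 ab
      arcs 1F 1F = irrefl T v1
      arcs 1F 2F = bc
      arcs 2F 0F = ca
      arcs 2F 1F = asym T v1 v2 bc
      arcs 2F 2F = irrefl T v2

    ~⇒OEdge : ∀ {x y} → Outside x → Outside y → x ~ y ≡ true → OEdge T N3 x y
    ~⇒OEdge {x} {y} ox oy h = outside⇒∉N3 ox , outside⇒∉N3 oy , ~⇒≢ h , Prime⇒Indec {T = T} (pair-lookup x y)
      (indecB-sound T ((≢-sym (~⇒≢ h) ∷ oy) ∷ ox ∷ X-distinct) (trans (cong indecB rows) (⇒⁻ {x ~ y} (five-check (τ x , τ y , arc T x y)) h)))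
      where
      rows : rowsOf T (y ∷ x ∷ X) ≡ base ▷ τ x ▷ (not (arc T x y) ∷ τ y)
      rows = cong₂ (λ R r → R ▷ τ x ▷ (r ∷ τ y)) X-rows (flip-arc T (~⇒≢ h))

    -- Inside the indecomposable set X ∪ {x , y} the vertex `x` is not isolated, and only `y` can be
    -- its neighbour.
    OEdge⇒~ : ∀ {x y} → OEdge T N3 x y → x ~ y ≡ true
    OEdge⇒~ {x} {y} (x∉ , y∉ , x≢y , ind) with Within.not-isolated (setOf (y ∷ x ∷ X)) (λ i → setOf⁺ (y ∷ x ∷ X) (suc (suc i))) (Indec⇒Prime {T = T} (pair-lookup x y) ind) x (∉N3⇒outside x∉) (setOf⁺ (y ∷ x ∷ X) 1F)
    ... | z , z∈ , oz , xz with setOf⁻ (y ∷ x ∷ X) {z} z∈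
    ...   | zero , refl = xz
    ...   | suc zero , refl = ⊥-elim (~⇒≢ xz refl)
    ...   | suc (suc i) , refl = ⊥-elim (lookup⁺ (outside⁻ z oz) i refl)

    Members : Ty → Ty → Fin (3 + k) → Set
    Members s t x = Outside x × (τ x ≡ s ⊎ τ x ≡ t)

    module _ {s t : Ty} (st : HasEdge (s , t)) where

      comp : Subset (3 + k)
      comp = tabulate λ x → outᵇ x ∧ ((τ x ≡ᵗ s) ∨ (τ x ≡ᵗ t))

      comp⁻ : ∀ {x} → x ∈ comp → Members s t x
      comp⁻ {x} h with ∧⁻ {outᵇ x} (trans (sym (lookup∘tabulate (λ x → outᵇ x ∧ ((τ x ≡ᵗ s) ∨ (τ x ≡ᵗ t))) x)) (∈⇒lookup h))
      ... | o , q with ∨⁻ {τ x ≡ᵗ s} q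
      ...   | inj₁ r = outside⁻ x o , inj₁ (≡ᵗ⁻ (τ x) s r)
      ...   | inj₂ r = outside⁻ x o , inj₂ (≡ᵗ⁻ (τ x) t r)

      comp⁺ : ∀ {x} → Members s t x → x ∈ comp
      comp⁺ {x} (o , q) = lookup⇒∈ (trans (lookup∘tabulate (λ x → outᵇ x ∧ ((τ x ≡ᵗ s) ∨ (τ x ≡ᵗ t))) x) (∧⁺ (outside⁺ o) (typ⁺ q)))
        where
        typ⁺ : τ x ≡ s ⊎ τ x ≡ t → ((τ x ≡ᵗ s) ∨ (τ x ≡ᵗ t)) ≡ true
        typ⁺ (inj₁ refl) = ∨⁺ˡ (≡ᵗ-refl (τ x))
        typ⁺ (inj₂ refl) = ∨⁺ʳ {τ x ≡ᵗ s} (≡ᵗ-refl (τ x))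

      neighbour-type : ∀ {x y} → Outside x → Outside y → x ~ y ≡ true → (τ x ≡ s → τ y ≡ t) × (τ x ≡ t → τ y ≡ s)
      neighbour-type {x} {y} ox oy xy = let (u , v , ou , ov , uv , eu , ev) = st in
        (λ e → trans (partner-type ox ou oy ov (trans e (sym eu)) xy uv) ev) ,
        (λ e → trans (partner-type ox ov oy ou (trans e (sym ev)) xy (~-sym⁺ {u} {v} uv)) eu)

      reach-closed : ∀ {x y} → Members s t x → Reach T N3 x y → Members s t y
      reach-closed mx here = mx
      reach-closed {x} (ox , ex) (step {y = y} oe r) = reach-closed (oy , [ (λ e → inj₂ (proj₁ nt e)) , (λ e → inj₁ (proj₂ nt e)) ]′ ex) r
        where
        oy : Outside y
        oy = ∉N3⇒outside (proj₁ (proj₂ oe))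
        nt : (τ x ≡ s → τ y ≡ t) × (τ x ≡ t → τ y ≡ s)
        nt = neighbour-type ox oy (OEdge⇒~ oe)

      link : ∀ {x y z} → Outside x → Outside y → x ~ y ≡ true → Reach T N3 y z → Reach T N3 x z
      link ox oy h r = step (~⇒OEdge ox oy h) r

      same-reach : ∀ {x y} → Outside x → Outside y → τ x ≡ τ y → Reach T N3 x y
      same-reach {x} {y} ox oy e = let (z , oz , xz , yz) = common ox oy e in link ox oz xz (link oz oy (~-sym⁺ {y} {z} yz) here)

      -- A partner `w` of `y` has the type of `x`, so a common neighbour of `x` and `w` completes a
      -- path of length three.
      other-reach : ∀ {x y} → Outside x → Outside y → (∀ {w} → Outside w → y ~ w ≡ true → τ x ≡ τ w) → Reach T N3 x y
      other-reach {x} {y} ox oy h =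
        let (w , ow , yw) = partner y oy
            (z , oz , xz , wz) = common ox ow (h ow yw)
        in link ox oz xz (link oz ow (~-sym⁺ {w} {z} wz) (link ow oy (~-sym⁺ {y} {w} yw) here))

      reach : ∀ {x y} → Members s t x → Members s t y → Reach T N3 x y
      reach (ox , inj₁ e) (oy , inj₁ e') = same-reach ox oy (trans e (sym e'))
      reach (ox , inj₂ e) (oy , inj₂ e') = same-reach ox oy (trans e (sym e'))
      reach (ox , inj₁ e) (oy , inj₂ e') = other-reach ox oy λ ow yw → trans e (sym (proj₂ (neighbour-type oy ow yw) e'))
      reach (ox , inj₂ e) (oy , inj₁ e') = other-reach ox oy λ ow yw → trans e (sym (proj₁ (neighbour-type oy ow yw) e'))

      comp-component : IsComponent T N3 comp
      comp-component = (λ x h → outside⇒∉N3 (proj₁ (comp⁻ h))) ,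
        (let (u , _ , ou , _ , _ , eu , _) = st in u , comp⁺ (ou , inj₁ eu)) ,
        λ x y hx → mk⇔ (λ hy → reach (comp⁻ hx) (comp⁻ hy)) (λ r → comp⁺ (reach-closed (comp⁻ hx) r))

      module _ {A B : Fin (3 + k) → Set} (tA : IsType A s) (tB : IsType B t) where

        union : ∀ x → (A ∪ᵖ B) x ⇔ Members s t x
        union x = mk⇔
          [ (λ h → let (o , e) = Equivalence.to (tA x) h in o , inj₁ e) , (λ h → let (o , e) = Equivalence.to (tB x) h in o , inj₂ e) ]′
          (λ (o , e) → [ (λ e → inj₁ (Equivalence.from (tA x) (o , e))) , (λ e → inj₂ (Equivalence.from (tB x) (o , e))) ]′ e)

        component-exists : ∃ λ C → IsComponent T N3 C × SameAs C (A ∪ᵖ B)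
        component-exists = comp , comp-component , λ x → mk⇔ (λ h → Equivalence.from (union x) (comp⁻ h)) (λ h → comp⁺ (Equivalence.to (union x) h))

        component-is : ∀ C → IsComponent T N3 C → ∀ {x} → x ∈ C → Members s t x → SameAs C (A ∪ᵖ B)
        component-is C (_ , _ , h) {x} x∈ mx y = mk⇔
          (λ y∈ → Equivalence.from (union y) (reach-closed mx (Equivalence.to (h x y x∈) y∈)))
          (λ q → Equivalence.from (h x y x∈) (reach mx (Equivalence.to (union y) q)))

    member-of : ∀ {s t} {A B : Fin (3 + k) → Set} → IsType A s → IsType B t → ∀ x → (A ∪ᵖ B) x → Members s t x
    member-of tA tB x (inj₁ h) = let (o , e) = Equivalence.to (tA x) h in o , inj₁ e
    member-of tA tB x (inj₂ h) = let (o , e) = Equivalence.to (tB x) h in o , inj₂ e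

    edge-types : ∀ {s t x y} → Members s t x → Members s t y → x ~ y ≡ true → pairᵇ (τ x) (τ y) (s , t) ≡ true
    edge-types {x = x} {y} (_ , inj₁ refl) (_ , inj₂ refl) h = ∨⁺ˡ (∧⁺ (≡ᵗ-refl (τ x)) (≡ᵗ-refl (τ y)))
    edge-types {s} {t} {x} {y} (_ , inj₂ refl) (_ , inj₁ refl) h = ∨⁺ʳ {(τ x ≡ᵗ s) ∧ (τ y ≡ᵗ t)} (∧⁺ (≡ᵗ-refl (τ x)) (≡ᵗ-refl (τ y)))
    edge-types {x = x} {y} (_ , inj₁ e) (_ , inj₁ e') h = true≢false h (~-same {x} {y} (cong block (trans e (sym e'))))
    edge-types {x = x} {y} (_ , inj₂ e) (_ , inj₂ e') h = true≢false h (~-same {x} {y} (cong block (trans e (sym e'))))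

    component-edge : ∀ {s t C} {A B : Fin (3 + k) → Set} → IsType A s → IsType B t → IsComponent T N3 C → SameAs C (A ∪ᵖ B) → HasEdge (s , t)
    component-edge {s} {t} {C} tA tB (_ , (x , x∈) , h) same = oriented (pair⁻ (τ x) (τ y) (s , t) (edge-types mx my xy))
      where
      mx : Members s t x
      mx = member-of tA tB x (Equivalence.to (same x) x∈)
      ox : Outside x
      ox = proj₁ mx
      y : Fin (3 + k)
      y = proj₁ (partner x ox)
      oy : Outside y
      oy = proj₁ (proj₂ (partner x ox))
      xy : x ~ y ≡ true
      xy = proj₂ (proj₂ (partner x ox))
      my : Members s t y
      my = member-of tA tB y (Equivalence.to (same y) (Equivalence.from (h x y x∈) (step (~⇒OEdge ox oy xy) here)))
      oriented : (τ x , τ y) ≡ (s , t) ⊎ (τ y , τ x) ≡ (s , t) → HasEdge (s , t)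
      oriented (inj₁ e) = x , y , ox , oy , xy , cong proj₁ e , cong proj₂ e
      oriented (inj₂ e) = y , x , oy , ox , ~-sym⁺ {x} {y} xy , cong proj₁ e , cong proj₂ e

    edge-in : ∀ {s t C x y} {A B : Fin (3 + k) → Set} → IsType A s → IsType B t → SameAs C (A ∪ᵖ B) → x ∈ C → y ∈ C → x ~ y ≡ true → pairᵇ (τ x) (τ y) (s , t) ≡ true
    edge-in tA tB same x∈ y∈ h = edge-types (member-of tA tB _ (Equivalence.to (same _) x∈)) (member-of tA tB _ (Equivalence.to (same _) y∈)) h

module _ {k : ℕ} {T : Tournament (3 + k)} {ab : T ∶ v0 ⟶ v1} {bc : T ∶ v1 ⟶ v2} {ca : T ∶ v2 ⟶ v0}
  (loc : Cycle.Local T v0 v1 v2 ab bc ca) (prT : Prime T allᵛ) where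

  private
    V : Set
    V = Fin (3 + k)

  open Cycle T v0 v1 v2 ab bc ca
  open Families T v0 v1 v2 ab bc ca
  open Standard T ab bc ca
  open Components loc prT
  open Critical T v0 v1 v2 ab bc ca loc prT using (partner)

  private
    own : ∀ s t → pairᵇ s t (s , t) ≡ true
    own s t = ∨⁺ˡ (∧⁺ (≡ᵗ-refl s) (≡ᵗ-refl t))

    last : ∀ {q} → q ∨ false ≡ true → q ≡ true
    last {true} _ = refl

    mem : ∀ {s t} x y → Outside x → pairᵇ (τ x) (τ y) (s , t) ≡ true → Members s t x
    mem {s} {t} x y ox h with pair⁻ (τ x) (τ y) (s , t) h
    ... | inj₁ refl = ox , inj₁ refl
    ... | inj₂ refl = ox , inj₂ refl

    real₁ : ∀ {s t u v} → HasEdge (s , t) → pairᵇ u v (s , t) ≡ true → HasEdge (u , v)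
    real₁ {s} {t} {u} {v} e h with pair⁻ u v (s , t) h
    ... | inj₁ refl = e
    ... | inj₂ refl = hasEdge-sym e

    edge-component : ∀ {x y} → Outside x → Outside y → x ~ y ≡ true → ∃ λ C → IsComponent T N3 C × x ∈ C × y ∈ C
    edge-component {x} {y} ox oy h = comp e , comp-component e , comp⁺ e (ox , inj₁ refl) , comp⁺ e (oy , inj₂ refl)
      where
      e : HasEdge (τ x , τ y)
      e = x , y , ox , oy , h , refl , refl

  module _ {s t s' t' : Ty} {A B C D : V → Set} (tA : IsType A s) (tB : IsType B t) (tC : IsType C s') (tD : IsType D t') where

    family⇒Comps2 : Family ((s , t) ∷ (s' , t') ∷ []) → Comps2 T N3 (A ∪ᵖ B) (C ∪ᵖ D)
    family⇒Comps2 fam = component-exists e₁ tA tB , component-exists e₂ tC tD , λ K isC@(K∉ , (x , x∈) , _) → go K isC x x∈ (∉N3⇒outside (K∉ x x∈))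
      where
      e₁ : HasEdge (s , t)
      e₁ = real fam s t (∨⁺ˡ {pairᵇ s t (s , t)} (own s t))
      e₂ : HasEdge (s' , t')
      e₂ = real fam s' t' (∨⁺ʳ {pairᵇ s' t' (s , t)} (∨⁺ˡ {pairᵇ s' t' (s' , t')} (own s' t')))
      go : ∀ K → IsComponent T N3 K → ∀ x → x ∈ K → Outside x → SameAs K (A ∪ᵖ B) ⊎ SameAs K (C ∪ᵖ D)
      go K isC x x∈ ox = let (y , oy , h) = partner x ox in
        [ (λ q → inj₁ (component-is e₁ tA tB K isC x∈ (mem x y ox q))) ,
          (λ q → inj₂ (component-is e₂ tC tD K isC x∈ (mem x y ox (last {pairᵇ (τ x) (τ y) (s' , t')} q)))) ]′
        (∨⁻ {pairᵇ (τ x) (τ y) (s , t)} (edge fam ox oy h))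

    Comps2⇒family : Comps2 T N3 (A ∪ᵖ B) (C ∪ᵖ D) → Family ((s , t) ∷ (s' , t') ∷ [])
    Comps2⇒family ((K₁ , c₁ , s₁) , (K₂ , c₂ , s₂) , all') = record { edge = ed ; real = re }
      where
      ed : ∀ {x y} → Outside x → Outside y → x ~ y ≡ true → matched ((s , t) ∷ (s' , t') ∷ []) (τ x) (τ y) ≡ true
      ed {x} {y} ox oy h with edge-component ox oy h
      ... | K , c , x∈ , y∈ with all' K c
      ...   | inj₁ same = ∨⁺ˡ {pairᵇ (τ x) (τ y) (s , t)} (edge-in tA tB same x∈ y∈ h)
      ...   | inj₂ same = ∨⁺ʳ {pairᵇ (τ x) (τ y) (s , t)} (∨⁺ˡ {pairᵇ (τ x) (τ y) (s' , t')} (edge-in tC tD same x∈ y∈ h))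
      re : ∀ u v → matched ((s , t) ∷ (s' , t') ∷ []) u v ≡ true → HasEdge (u , v)
      re u v h with ∨⁻ {pairᵇ u v (s , t)} h
      ... | inj₁ q = real₁ (component-edge tA tB c₁ s₁) q
      ... | inj₂ q with ∨⁻ {pairᵇ u v (s' , t')} q
      ...   | inj₁ r = real₁ (component-edge tC tD c₂ s₂) r

    module _ {s″ t″ : Ty} {E F : V → Set} (tE : IsType E s″) (tF : IsType F t″) where

      family⇒Comps3 : Family ((s , t) ∷ (s' , t') ∷ (s″ , t″) ∷ []) → Comps3 T N3 (A ∪ᵖ B) (C ∪ᵖ D) (E ∪ᵖ F)
      family⇒Comps3 fam = component-exists e₁ tA tB , component-exists e₂ tC tD , component-exists e₃ tE tF ,
          λ K isC@(K∉ , (x , x∈) , _) → go K isC x x∈ (∉N3⇒outside (K∉ x x∈))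
        where
        e₁ : HasEdge (s , t)
        e₁ = real fam s t (∨⁺ˡ {pairᵇ s t (s , t)} (own s t))
        e₂ : HasEdge (s' , t')
        e₂ = real fam s' t' (∨⁺ʳ {pairᵇ s' t' (s , t)} (∨⁺ˡ {pairᵇ s' t' (s' , t')} (own s' t')))
        e₃ : HasEdge (s″ , t″)
        e₃ = real fam s″ t″ (∨⁺ʳ {pairᵇ s″ t″ (s , t)} (∨⁺ʳ {pairᵇ s″ t″ (s' , t')} (∨⁺ˡ {pairᵇ s″ t″ (s″ , t″)} (own s″ t″))))
        go : ∀ K → IsComponent T N3 K → ∀ x → x ∈ K → Outside x → SameAs K (A ∪ᵖ B) ⊎ SameAs K (C ∪ᵖ D) ⊎ SameAs K (E ∪ᵖ F)
        go K isC x x∈ ox = let (y , oy , h) = partner x ox in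
          [ (λ q → inj₁ (component-is e₁ tA tB K isC x∈ (mem x y ox q))) ,
            (λ q → inj₂ ([ (λ r → inj₁ (component-is e₂ tC tD K isC x∈ (mem x y ox r))) ,
              (λ r → inj₂ (component-is e₃ tE tF K isC x∈ (mem x y ox (last {pairᵇ (τ x) (τ y) (s″ , t″)} r)))) ]′ (∨⁻ {pairᵇ (τ x) (τ y) (s' , t')} q))) ]′
          (∨⁻ {pairᵇ (τ x) (τ y) (s , t)} (edge fam ox oy h))

      Comps3⇒family : Comps3 T N3 (A ∪ᵖ B) (C ∪ᵖ D) (E ∪ᵖ F) → Family ((s , t) ∷ (s' , t') ∷ (s″ , t″) ∷ [])
      Comps3⇒family ((K₁ , c₁ , s₁) , (K₂ , c₂ , s₂) , (K₃ , c₃ , s₃) , all') = record { edge = ed ; real = re }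
        where
        ed : ∀ {x y} → Outside x → Outside y → x ~ y ≡ true → matched ((s , t) ∷ (s' , t') ∷ (s″ , t″) ∷ []) (τ x) (τ y) ≡ true
        ed {x} {y} ox oy h with edge-component ox oy h
        ... | K , c , x∈ , y∈ with all' K c
        ...   | inj₁ same = ∨⁺ˡ {pairᵇ (τ x) (τ y) (s , t)} (edge-in tA tB same x∈ y∈ h)
        ...   | inj₂ (inj₁ same) = ∨⁺ʳ {pairᵇ (τ x) (τ y) (s , t)} (∨⁺ˡ {pairᵇ (τ x) (τ y) (s' , t')} (edge-in tC tD same x∈ y∈ h))
        ...   | inj₂ (inj₂ same) = ∨⁺ʳ {pairᵇ (τ x) (τ y) (s , t)} (∨⁺ʳ {pairᵇ (τ x) (τ y) (s' , t')} (∨⁺ˡ {pairᵇ (τ x) (τ y) (s″ , t″)} (edge-in tE tF same x∈ y∈ h)))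
        re : ∀ u v → matched ((s , t) ∷ (s' , t') ∷ (s″ , t″) ∷ []) u v ≡ true → HasEdge (u , v)
        re u v h with ∨⁻ {pairᵇ u v (s , t)} h
        ... | inj₁ q = real₁ (component-edge tA tB c₁ s₁) q
        ... | inj₂ q with ∨⁻ {pairᵇ u v (s' , t')} q
        ...   | inj₁ r = real₁ (component-edge tC tD c₂ s₂) r
        ...   | inj₂ r with ∨⁻ {pairᵇ u v (s″ , t″)} r
        ...     | inj₁ w = real₁ (component-edge tE tF c₃ s₃) w

  private
    t-p0 : IsType (PlusU T N3 v0) p0
    t-p0 = plusU-type 0F p0 refl refl
    t-p1 : IsType (PlusU T N3 v1) p1
    t-p1 = plusU-type 1F p1 refl refl
    t-p2 : IsType (PlusU T N3 v2) p2
    t-p2 = plusU-type 2F p2 refl refl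
    t-m0 : IsType (MinusU T N3 v0) m0
    t-m0 = minusU-type 0F m0 refl refl
    t-m1 : IsType (MinusU T N3 v1) m1
    t-m1 = minusU-type 1F m1 refl refl
    t-m2 : IsType (MinusU T N3 v2) m2
    t-m2 = minusU-type 2F m2 refl refl

  family⇒H : Family famH → InH T
  family⇒H fam = C3-critical , family⇒Comps2 t-p0 minus-type plus-type t-m1 fam
  family⇒I : Family famI → InI T
  family⇒I fam = C3-critical , family⇒Comps2 t-p0 t-p2 t-p1 t-m0 fam
  family⇒J : Family famJ → InJ T
  family⇒J fam = C3-critical , family⇒Comps2 t-p1 minus-type t-m1 t-m0 fam
  family⇒K : Family famK → InK T
  family⇒K fam = C3-critical , family⇒Comps2 t-p1 minus-type t-p0 t-m2 fam
  family⇒L : Family famL → InL T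
  family⇒L fam = C3-critical , family⇒Comps3 t-p1 minus-type t-p0 t-m2 plus-type t-m0 fam

  H⇒family : InH T → Family famH
  H⇒family (_ , h) = Comps2⇒family t-p0 minus-type plus-type t-m1 h
  I⇒family : InI T → Family famI
  I⇒family (_ , h) = Comps2⇒family t-p0 t-p2 t-p1 t-m0 h
  J⇒family : InJ T → Family famJ
  J⇒family (_ , h) = Comps2⇒family t-p1 minus-type t-m1 t-m0 h
  K⇒family : InK T → Family famK
  K⇒family (_ , h) = Comps2⇒family t-p1 minus-type t-p0 t-m2 h
  L⇒family : InL T → Family famL
  L⇒family (_ , h) = Comps3⇒family t-p1 minus-type t-p0 t-m2 plus-type t-m0 h

-- Members of the classes: W5 and the support

Facts : ∀ {k} → Tournament (3 + k) → Set
Facts {k} T = InClassT T × (∀ (x : Fin (3 + k)) → ((¬ InW5 T x) ⇔ (x ≡ v0 ⊎ x ≡ v1)) × (NonCritical T x ⇔ (x ≡ v0 ⊎ x ≡ v1)))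

module _ {k : ℕ} {T : Tournament (3 + k)} (crit : C3Critical T) where

  private
    ab : T ∶ v0 ⟶ v1
    ab = proj₁ (proj₂ crit) 0F 1F
    bc : T ∶ v1 ⟶ v2
    bc = proj₁ (proj₂ crit) 1F 2F
    ca : T ∶ v2 ⟶ v0
    ca = proj₁ (proj₂ crit) 2F 0F

  open Cycle T v0 v1 v2 ab bc ca
  open Families T v0 v1 v2 ab bc ca
  open Standard T ab bc ca

  private
    prT : Prime T allᵛ
    prT = indecomposable⇒prime (proj₁ crit)
    out-crit : ∀ x → Outside x → ¬ Prime T (allᵛ ∖ x)
    out-crit x o q = outside⇒∉N3 o (proj₂ (proj₂ crit) x (prime⇒noncritical q))
    loc : Local
    loc = noSix⇒Local (critical⇒noSix T v0 v1 v2 ab bc ca prT out-crit)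

    facts : Avoids T v0 v1 → Prime T (allᵛ ∖ v0) → Prime T (allᵛ ∖ v1) → ¬ Prime T (allᵛ ∖ v2) → Facts T
    facts av p₀ p₁ p₂ = (proj₁ crit , s≤s (s≤s (s≤s z≤n)) , S , S-W5 , trans (∣⊤∣≡n (suc k)) refl) , λ x →
        mk⇔ (λ nw → not-in nw) [ (λ where refl → Avoids.na av) , (λ where refl → Avoids.nb av) ]′ ,
        mk⇔ (λ nc → non-crit x nc (in-or-out x)) [ (λ where refl → prime⇒noncritical p₀) , (λ where refl → prime⇒noncritical p₁) ]′
      where
      S : Subset (3 + k)
      S = false ∷ false ∷ ⊤
      S-W5 : ∀ v → (v ∈ S) ⇔ InW5 T v
      S-W5 v = mk⇔ (λ v∈ → Avoids.cover av v (λ where refl → true≢false (∈⇒lookup v∈) refl) (λ where refl → true≢false (∈⇒lookup v∈) refl))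
        (λ w → lookup⇒∈ (at-vertex v w))
        where
        at-vertex : ∀ v → InW5 T v → lookup S v ≡ true
        at-vertex zero w = ⊥-elim (Avoids.na av w)
        at-vertex (suc zero) w = ⊥-elim (Avoids.nb av w)
        at-vertex (suc (suc v)) w = lookup-⊤ v
      not-in : ∀ {x} → ¬ InW5 T x → x ≡ v0 ⊎ x ≡ v1
      not-in {x} nw with x ≟ v0 | x ≟ v1
      ... | yes e | _ = inj₁ e
      ... | no _ | yes e = inj₂ e
      ... | no ne | no ne' = ⊥-elim (nw (Avoids.cover av x ne ne'))
      non-crit : ∀ x → NonCritical T x → (∃ λ i → lookup X i ≡ x) ⊎ Outside x → x ≡ v0 ⊎ x ≡ v1
      non-crit x nc (inj₂ o) = ⊥-elim (out-crit x o (noncritical⇒prime nc))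
      non-crit x nc (inj₁ (0F , e)) = inj₁ (sym e)
      non-crit x nc (inj₁ (1F , e)) = inj₂ (sym e)
      non-crit x nc (inj₁ (2F , refl)) = ⊥-elim (p₂ (noncritical⇒prime nc))

    module Rev {l : Matching} (fam : Family l) (chk : family-check l ≡ true) (s t : Ty) (st : matched l s t ≡ true) where
      module R = Reverse T v0 v1 v2 ab bc ca loc prT l fam chk
      e₀ : HasEdge (s , t)
      e₀ = real fam s t st
      result : ¬ Prime T (allᵛ ∖ v2) → Facts T
      result = facts (R.avoids ((s , t) , e₀)) (proj₁ (proj₂ (R.at-edge ((s , t) , e₀)))) (proj₂ (proj₂ (R.at-edge ((s , t) , e₀))))

      by-cycle : lookup t 0F ≡ true → lookup t 1F ≡ false → Facts T
      by-cycle h h' = let (x , y , ox , oy , xy , _ , e) = e₀ in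
        result (R.critical-by-cycle ((s , t) , e₀) y oy (trans (cong (λ u → lookup u 0F) e) h) (trans (cong (λ u → lookup u 1F) e) h'))

      by-module : every (ty ⊗ ty) (R.module-body (λ u → (u ≡ᵗ s) ∨ (u ≡ᵗ t))) ≡ true → Facts T
      by-module chk' = let (x , y , ox , oy , xy , e , _) = e₀ in
        result (R.critical-by-module (λ u → (u ≡ᵗ s) ∨ (u ≡ᵗ t)) chk' (x , ox , ∨⁺ˡ (subst (λ u → (u ≡ᵗ s) ≡ true) (sym e) (≡ᵗ-refl s))))

  factsH : Comps2 T N3 (PlusU T N3 v0 ∪ᵖ Minus T N3) (Plus T N3 ∪ᵖ MinusU T N3 v1) → Facts T
  factsH h = Rev.by-module (H⇒family loc prT (crit , h)) checkH p0 m∅ refl refl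
  factsI : Comps2 T N3 (PlusU T N3 v0 ∪ᵖ PlusU T N3 v2) (PlusU T N3 v1 ∪ᵖ MinusU T N3 v0) → Facts T
  factsI h = Rev.by-cycle (I⇒family loc prT (crit , h)) checkI p0 p2 refl refl refl
  factsJ : Comps2 T N3 (PlusU T N3 v1 ∪ᵖ Minus T N3) (MinusU T N3 v1 ∪ᵖ MinusU T N3 v0) → Facts T
  factsJ h = Rev.by-module (J⇒family loc prT (crit , h)) checkJ m1 m0 refl refl
  factsK : Comps2 T N3 (PlusU T N3 v1 ∪ᵖ Minus T N3) (PlusU T N3 v0 ∪ᵖ MinusU T N3 v2) → Facts T
  factsK h = Rev.by-cycle (K⇒family loc prT (crit , h)) checkK p0 m2 refl refl refl
  factsL : Comps3 T N3 (PlusU T N3 v1 ∪ᵖ Minus T N3) (PlusU T N3 v0 ∪ᵖ MinusU T N3 v2) (Plus T N3 ∪ᵖ MinusU T N3 v0) → Facts T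
  factsL h = Rev.by-cycle (L⇒family loc prT (crit , h)) checkL p0 m2 refl refl refl

dual-facts : ∀ {k} {T T' : Tournament (3 + k)} → (∀ x y → arc T x y ≡ arc (dual T') x y) → Facts T' → Facts T
dual-facts {k} {T} {T'} opp ((ind , le , S , hS , card) , h) =
  (Prime⇒Indec {T = T} lookup-⊤ (Prime-dual {T = T'} {T} opp (Indec⇒Prime {T = T'} lookup-⊤ ind)) , le , S ,
    (λ v → mk⇔ (λ v∈ → to (Equivalence.to (hS v) v∈)) (λ w → Equivalence.from (hS v) (back w))) , card) ,
  λ x → mk⇔ (λ nw → Equivalence.to (proj₁ (h x)) (λ w → nw (to w))) (λ e w → Equivalence.from (proj₁ (h x)) e (back w)) ,
    mk⇔ (λ nc → Equivalence.to (proj₂ (h x)) (Prime⇒Indec {T = T'} (lookup-∁⁅⁆ x) (Prime-dual {T = T} {T'} opp' (Indec⇒Prime {T = T} (lookup-∁⁅⁆ x) nc))))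
      (λ e → Prime⇒Indec {T = T} (lookup-∁⁅⁆ x) (Prime-dual {T = T'} {T} opp (Indec⇒Prime {T = T'} (lookup-∁⁅⁆ x) (Equivalence.from (proj₂ (h x)) e))))
  where
  opp' : ∀ x y → arc T' x y ≡ arc T y x
  opp' x y = sym (opp y x)
  to : ∀ {v} → InW5 T' v → InW5 T v
  to = InW5-dual {T = T'} {T} opp
  back : ∀ {v} → InW5 T v → InW5 T' v
  back = InW5-dual {T = T} {T'} opp'

member-facts : ∀ {k} (T : Tournament (3 + k)) → InM T → Facts T
member-facts T (inj₁ (c , h)) = factsH c h
member-facts T (inj₂ (inj₁ (c , h))) = factsI c h
member-facts T (inj₂ (inj₂ (inj₁ (c , h)))) = factsJ c h
member-facts T (inj₂ (inj₂ (inj₂ (inj₁ (T' , (c , h) , opp))))) = dual-facts {T = T} {T'} opp (factsJ c h)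
member-facts T (inj₂ (inj₂ (inj₂ (inj₂ (inj₁ (c , h)))))) = factsK c h
member-facts T (inj₂ (inj₂ (inj₂ (inj₂ (inj₂ (inj₁ (T' , (c , h) , opp))))))) = dual-facts {T = T} {T'} opp (factsK c h)
member-facts T (inj₂ (inj₂ (inj₂ (inj₂ (inj₂ (inj₂ (inj₁ (c , h)))))))) = factsL c h
member-facts T (inj₂ (inj₂ (inj₂ (inj₂ (inj₂ (inj₂ (inj₂ (T' , (c , h) , opp)))))))) = dual-facts {T = T} {T'} opp (factsL c h)

-- Relabelling the cycle as 0, 1, 2

module Transport {n m : ℕ} {S : Tournament n} {S' : Tournament m} (φ : Fin n ↔ Fin m)
  (iso : ∀ x y → arc S' (Inverse.to φ x) (Inverse.to φ y) ≡ arc S x y)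
  {a b c : Fin n} {a' b' c' : Fin m} (a↦ : Inverse.to φ a ≡ a') (b↦ : Inverse.to φ b ≡ b') (c↦ : Inverse.to φ c ≡ c')
  (cyc : CycleWith S a b c) where

  open Inverse φ using (to; from; strictlyInverseˡ; strictlyInverseʳ)

  to-injective : ∀ {x y} → to x ≡ to y → x ≡ y
  to-injective {x} {y} e = trans (sym (strictlyInverseʳ x)) (trans (cong from e) (strictlyInverseʳ y))

  cyc' : CycleWith S' a' b' c'
  cyc' = record
    { ab = trans (cong₂ (arc S') (sym a↦) (sym b↦)) (trans (iso a b) (CycleWith.ab cyc))
    ; bc = trans (cong₂ (arc S') (sym b↦) (sym c↦)) (trans (iso b c) (CycleWith.bc cyc))
    ; ca = trans (cong₂ (arc S') (sym c↦) (sym a↦)) (trans (iso c a) (CycleWith.ca cyc)) }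

  private
    module A = At S a b c cyc
    module A' = At S' a' b' c' cyc'

  iso⁻ : ∀ x y → arc S' x y ≡ arc S (from x) (from y)
  iso⁻ x y = trans (cong₂ (arc S') (sym (strictlyInverseˡ x)) (sym (strictlyInverseˡ y))) (iso (from x) (from y))

  out⁺ : ∀ {x} → A.Outside x → A'.Outside (to x)
  out⁺ (p ∷ q ∷ r ∷ []) = ne p a↦ ∷ ne q b↦ ∷ ne r c↦ ∷ []
    where
    ne : ∀ {x y z} → x ≢ y → to y ≡ z → to x ≢ z
    ne x≢y e e' = x≢y (to-injective (trans e' (sym e)))

  out⁻ : ∀ {x} → A'.Outside x → A.Outside (from x)
  out⁻ {x} (p ∷ q ∷ r ∷ []) = ne p a↦ ∷ ne q b↦ ∷ ne r c↦ ∷ []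
    where
    ne : ∀ {y z} → x ≢ z → to y ≡ z → from x ≢ y
    ne x≢z e e' = x≢z (trans (sym (strictlyInverseˡ x)) (trans (cong to e') e))

  type⁺ : ∀ x → A'.τ (to x) ≡ A.τ x
  type⁺ x = cong₂ _∷_ (entry a↦) (cong₂ _∷_ (entry b↦) (cong (_∷ []) (entry c↦)))
    where
    entry : ∀ {y z} → to y ≡ z → arc S' (to x) z ≡ arc S x y
    entry {y} e = trans (cong (arc S' (to x)) (sym e)) (iso x y)

  type⁻ : ∀ x → A'.τ x ≡ A.τ (from x)
  type⁻ x = trans (cong A'.τ (sym (strictlyInverseˡ x))) (type⁺ (from x))

  edge⁺ : ∀ x y → (to x A'.~ to y) ≡ (x A.~ y)
  edge⁺ x y = trans (cong₂ (λ s t → adj s t (arc S' (to x) (to y))) (type⁺ x) (type⁺ y)) (cong (adj (A.τ x) (A.τ y)) (iso x y))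

  edge⁻ : ∀ x y → (x A'.~ y) ≡ (from x A.~ from y)
  edge⁻ x y = trans (cong₂ A'._~_ (sym (strictlyInverseˡ x)) (sym (strictlyInverseˡ y))) (edge⁺ (from x) (from y))

  local : A.Local → A'.Local
  local loc = record
    { l1 = λ {x} {y} {z} ox oy oz xy xz → trans (type⁻ y) (trans (A.Local.l1 loc (out⁻ ox) (out⁻ oy) (out⁻ oz)
        (trans (sym (edge⁻ x y)) xy) (trans (sym (edge⁻ x z)) xz)) (sym (type⁻ z)))
    ; l2 = λ {x} {y} {z} ox oy oz xy zy zx z≢x → trans (iso⁻ z x) (trans (A.Local.l2 loc (out⁻ ox) (out⁻ oy) (out⁻ oz)
        (trans (sym (edge⁻ x y)) xy) (trans (sym (edge⁻ z y)) zy) (trans (sym (edge⁻ z x)) zx)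
        (λ e → z≢x (trans (sym (strictlyInverseˡ z)) (trans (cong to e) (strictlyInverseˡ x)))))
        (sym (cong₂ def (type⁻ z) (type⁻ x)))) }

  family : ∀ {l} → A.Family l → A'.Family l
  family {l} fam = record
    { edge = λ {x} {y} ox oy h → trans (cong₂ (matched l) (type⁻ x) (type⁻ y)) (A.edge fam (out⁻ ox) (out⁻ oy) (trans (sym (edge⁻ x y)) h))
    ; real = λ s t h → let (x , y , ox , oy , xy , e , e') = A.real fam s t h in
        to x , to y , out⁺ ox , out⁺ oy , trans (edge⁺ x y) xy , trans (type⁺ x) e , trans (type⁺ y) e' }

  prime : Prime S allᵛ → Prime S' allᵛ
  prime pr f (_ , unif) x y x≢y fx fy z _ = subst (λ v → f v ≡ true) (strictlyInverseˡ z)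
    (pr (f ∘ to) ((λ _ _ → refl) , λ u v w _ fu fv fw → trans (sym (iso u v)) (trans (unif (to u) (to v) (to w) refl fu fv fw) (iso u w)))
      (from x) (from y) (λ e → x≢y (trans (sym (strictlyInverseˡ x)) (trans (cong to e) (strictlyInverseˡ y))))
      (subst (λ v → f v ≡ true) (sym (strictlyInverseˡ x)) fx) (subst (λ v → f v ≡ true) (sym (strictlyInverseˡ y)) fy) (from z) refl)

transpose-left : ∀ {n} (i j : Fin n) → Inverse.to (transpose i j) i ≡ j
transpose-left i j rewrite does⁺ (i ≟ i) refl = refl

transpose-other : ∀ {n} (i j k : Fin n) → k ≢ i → k ≢ j → Inverse.to (transpose i j) k ≡ k
transpose-other i j k k≢i k≢j rewrite dec-false (k ≟ i) k≢i | dec-false (k ≟ j) k≢j = refl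

-- Each transposition puts one vertex in place; distinctness keeps the later ones from moving 0 and
-- 1 again.
to-front : ∀ {k} (a b c : Fin (3 + k)) → a ≢ b → a ≢ c → b ≢ c →
  Σ (Fin (3 + k) ↔ Fin (3 + k)) λ φ → Inverse.to φ a ≡ v0 × Inverse.to φ b ≡ v1 × Inverse.to φ c ≡ v2
to-front {k} a b c a≢b a≢c b≢c = (σ₁ ∘ₚ σ₂ ∘ₚ σ₃) ,
    trans (cong (Inverse.to σ₃ ∘ Inverse.to σ₂) s₁a) (trans (cong (Inverse.to σ₃) s₂0) s₃0) ,
    trans (cong (Inverse.to σ₃) s₂b) s₃1 ,
    transpose-left c₂ v2
  where
  V : Set
  V = Fin (3 + k)
  σ₁ σ₂ σ₃ : V ↔ V
  σ₁ = transpose a v0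
  b₁ c₁ c₂ : V
  b₁ = Inverse.to σ₁ b
  c₁ = Inverse.to σ₁ c
  σ₂ = transpose b₁ v1
  c₂ = Inverse.to σ₂ c₁
  σ₃ = transpose c₂ v2
  injective : ∀ (σ : V ↔ V) {x y} → Inverse.to σ x ≡ Inverse.to σ y → x ≡ y
  injective σ {x} {y} e = trans (sym (Inverse.strictlyInverseʳ σ x)) (trans (cong (Inverse.from σ) e) (Inverse.strictlyInverseʳ σ y))
  s₁a : Inverse.to σ₁ a ≡ v0
  s₁a = transpose-left a v0
  0≢b₁ : v0 ≢ b₁
  0≢b₁ e = a≢b (injective σ₁ (trans s₁a e))
  0≢c₁ : v0 ≢ c₁
  0≢c₁ e = a≢c (injective σ₁ (trans s₁a e))
  s₂b : Inverse.to σ₂ b₁ ≡ v1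
  s₂b = transpose-left b₁ v1
  s₂0 : Inverse.to σ₂ v0 ≡ v0
  s₂0 = transpose-other b₁ v1 v0 0≢b₁ (λ ())
  s₃0 : Inverse.to σ₃ v0 ≡ v0
  s₃0 = transpose-other c₂ v2 v0 (λ e → 0≢c₁ (injective σ₂ (trans s₂0 e))) (λ ())
  s₃1 : Inverse.to σ₃ v1 ≡ v1
  s₃1 = transpose-other c₂ v2 v1 (λ e → b≢c (injective σ₁ (injective σ₂ (trans s₂b e)))) (λ ())

relabel : ∀ {n m} → Tournament n → Fin n ↔ Fin m → Tournament m
relabel S φ = record
  { arc = λ x y → arc S (from x) (from y)
  ; irrefl = λ x → irrefl S (from x)
  ; total = λ x y x≢y → total S (from x) (from y) λ e → x≢y (trans (sym (strictlyInverseˡ x)) (trans (cong to e) (strictlyInverseˡ y)))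
  ; asym = λ x y → asym S (from x) (from y) }
  where open Inverse φ

record Labelling {n : ℕ} (S : Tournament n) (a b c : Fin n) : Set where
  field
    k   : ℕ
    S'  : Tournament (3 + k)
    φ   : Fin n ↔ Fin (3 + k)
    iso : ∀ x y → arc S' (Inverse.to φ x) (Inverse.to φ y) ≡ arc S x y
    a↦  : Inverse.to φ a ≡ v0
    b↦  : Inverse.to φ b ≡ v1
    c↦  : Inverse.to φ c ≡ v2

labelling : ∀ {n} (S : Tournament n) a b c → a ≢ b → a ≢ c → b ≢ c → Labelling S a b c
labelling {suc zero} S zero zero c a≢b _ _ = ⊥-elim (a≢b refl)
labelling {suc (suc zero)} S a b c a≢b a≢c b≢c = ⊥-elim (pigeon a b c a≢b a≢c b≢c)
  where
  pigeon : (a b c : Fin 2) → a ≢ b → a ≢ c → b ≢ c → ⊥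
  pigeon 0F 0F _ p _ _ = p refl
  pigeon 1F 1F _ p _ _ = p refl
  pigeon 0F 1F 0F _ p _ = p refl
  pigeon 0F 1F 1F _ _ p = p refl
  pigeon 1F 0F 1F _ p _ = p refl
  pigeon 1F 0F 0F _ _ p = p refl
labelling {suc (suc (suc k))} S a b c a≢b a≢c b≢c = record
  { k = k ; S' = relabel S φ ; φ = φ ; iso = λ x y → cong₂ (arc S) (Inverse.strictlyInverseʳ φ x) (Inverse.strictlyInverseʳ φ y)
  ; a↦ = proj₁ (proj₂ front) ; b↦ = proj₁ (proj₂ (proj₂ front)) ; c↦ = proj₂ (proj₂ (proj₂ front)) }
  where
  front : Σ (Fin (3 + k) ↔ Fin (3 + k)) λ φ → Inverse.to φ a ≡ v0 × Inverse.to φ b ≡ v1 × Inverse.to φ c ≡ v2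
  front = to-front a b c a≢b a≢c b≢c
  φ : Fin (3 + k) ↔ Fin (3 + k)
  φ = proj₁ front

standardise : ∀ {n} {S : Tournament n} {a b} → Avoids S a b → ∀ c (cyc : CycleWith S a b c) →
  Σ ℕ λ k → Σ (Tournament (3 + k)) λ S' → Σ (CycleWith S' v0 v1 v2) λ cyc' → At.Local S' v0 v1 v2 cyc' × Prime S' allᵛ × Isomorphic S S' ×
    (∀ {l} → At.Family S a b c cyc l → At.Family S' v0 v1 v2 cyc' l)
standardise {S = S} {a} {b} av c cyc = k , S' , Tr.cyc' , Tr.local (avoids⇒local av cyc) , Tr.prime (Avoids.prime av) , (φ , iso) , λ {l} → Tr.family {l}
  where
  open At S a b c cyc using (a≢b; a≢c; b≢c)
  open Labelling (labelling S a b c a≢b a≢c b≢c)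
  module Tr = Transport {S = S} {S'} φ iso a↦ b↦ c↦ cyc

-- From the class of tournaments with two vertices outside W5 to the listed classes

card-two : ∀ {n} (S : Subset n) → ∣ S ∣ ≡ 2 → ∃₂ λ a b → a ≢ b × lookup S a ≡ true × lookup S b ≡ true × (∀ v → lookup S v ≡ true → v ≡ a ⊎ v ≡ b)
card-two (false ∷ S) e with card-two S e
... | a , b , a≢b , ha , hb , h = suc a , suc b , (λ e' → a≢b (suc-injective e')) , ha , hb , λ where
  (suc v) hv → [ (λ e' → inj₁ (cong suc e')) , (λ e' → inj₂ (cong suc e')) ]′ (h v hv)
card-two (true ∷ S) e with card-one S (ℕ-suc-injective e)
  where
  card-one : ∀ {m} (S : Subset m) → ∣ S ∣ ≡ 1 → ∃ λ b → lookup S b ≡ true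
  card-one (true ∷ S) e = zero , refl
  card-one (false ∷ S) e = let (b , h) = card-one S e in suc b , h
... | b , hb = zero , suc b , (λ ()) , refl , hb , λ where
  zero _ → inj₁ refl
  (suc v) hv → inj₂ (cong suc (card≤1⇒unique {S = S} (≤-reflexive (ℕ-suc-injective e)) hv hb))

third-vertex : ∀ {n} → 3 ≤ n → (a b : Fin n) → ∃ λ v → v ≢ a × v ≢ b
third-vertex {suc (suc (suc n))} (s≤s (s≤s (s≤s _))) a b with 0F ≟ a | 0F ≟ b
... | no p | no q = 0F , p , q
... | yes refl | _ with 1F ≟ b
...   | no q = 1F , (λ ()) , q
...   | yes refl = 2F , (λ ()) , (λ ())
third-vertex {suc (suc (suc n))} (s≤s (s≤s (s≤s _))) a b | no p | yes refl with 1F ≟ a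
...   | no q = 1F , q , (λ ())
...   | yes refl = 2F , (λ ()) , (λ ())

-- As 3 ≤ n, the truncated subtraction is a true one and exactly two vertices lie outside W5; their
-- arc decides which of them is called a.
class⇒avoids : ∀ {n} {T : Tournament n} → InClassT T → ∃₂ λ a b → Avoids T a b × (∃ λ v → v ≢ a × v ≢ b)
class⇒avoids {n} {T} (ind , 3≤n , S , hS , card) with card-two (∁ S) (trans (∣∁p∣≡n∸∣p∣ S) (trans (cong (n ∸_) card) (m∸[m∸n]≡n (≤-trans (s≤s (s≤s z≤n)) 3≤n))))
... | a , b , a≢b , ha , hb , only = orient (total T a b a≢b)
  where
  prT : Prime T allᵛ
  prT = Indec⇒Prime {T = T} lookup-⊤ ind
  ∁-lookup : ∀ v → lookup (∁ S) v ≡ not (lookup S v)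
  ∁-lookup v = lookup-map v not S
  avoid : ∀ {v} → lookup (∁ S) v ≡ true → ¬ InW5 T v
  avoid {v} h w = true≢false (∈⇒lookup (Equivalence.from (hS v) w)) (not-true⁻ (trans (sym (∁-lookup v)) h))
  cover : ∀ v → v ≢ a → v ≢ b → InW5 T v
  cover v v≢a v≢b = Equivalence.to (hS v) (lookup⇒∈ ([ id , (λ h → ⊥-elim ([ v≢a , v≢b ]′ (only v (trans (∁-lookup v) (cong not h))))) ]′ (bool-case (lookup S v))))
  orient : T ∶ a ⟶ b ⊎ T ∶ b ⟶ a → ∃₂ λ a b → Avoids T a b × (∃ λ v → v ≢ a × v ≢ b)
  orient (inj₁ ab) = a , b , record { prime = prT ; na = avoid ha ; nb = avoid hb ; cover = cover ; a⟶b = ab } , third-vertex 3≤n a b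
  orient (inj₂ ba) = b , a , record { prime = prT ; na = avoid hb ; nb = avoid ha ; cover = λ v p q → cover v q p ; a⟶b = ba } , third-vertex 3≤n b a

class⇒member : ∀ {n} (T : Tournament n) → InClassT T → Σ ℕ λ k → Σ (Tournament (3 + k)) λ T' → InM T' × Isomorphic T T'
class⇒member {n} T inT with class⇒avoids inT
... | a , b , av , third = from-main (main av (cycle-exists av third))
  where
  Goal : Set
  Goal = Σ ℕ λ k → Σ (Tournament (3 + k)) λ T' → InM T' × Isomorphic T T'
  module Direct (c : Fin n) (cyc : CycleWith T a b c) {k : ℕ} {T' : Tournament (3 + k)} (cyc' : CycleWith T' v0 v1 v2)
    (loc : At.Local T' v0 v1 v2 cyc') (prT : Prime T' allᵛ) (tr : ∀ {l} → At.Family T a b c cyc l → At.Family T' v0 v1 v2 cyc' l) where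
    open At T a b c cyc
    member : Family famH ⊎ Family famI ⊎ Family famJ ⊎ Family famK ⊎ Family famL → InM T'
    member (inj₁ f) = inj₁ (family⇒H loc prT (tr f))
    member (inj₂ (inj₁ f)) = inj₂ (inj₁ (family⇒I loc prT (tr f)))
    member (inj₂ (inj₂ (inj₁ f))) = inj₂ (inj₂ (inj₁ (family⇒J loc prT (tr f))))
    member (inj₂ (inj₂ (inj₂ (inj₁ f)))) = inj₂ (inj₂ (inj₂ (inj₂ (inj₁ (family⇒K loc prT (tr f))))))
    member (inj₂ (inj₂ (inj₂ (inj₂ f)))) = inj₂ (inj₂ (inj₂ (inj₂ (inj₂ (inj₂ (inj₁ (family⇒L loc prT (tr f))))))))
  module Dualed (c : Fin n) (cyc : CycleWith (dual T) b a c) {k : ℕ} {S' : Tournament (3 + k)} (cyc' : CycleWith S' v0 v1 v2)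
    (loc : At.Local S' v0 v1 v2 cyc') (prT : Prime S' allᵛ) (tr : ∀ {l} → At.Family (dual T) b a c cyc l → At.Family S' v0 v1 v2 cyc' l) where
    open At (dual T) b a c cyc
    member : Family famJ ⊎ Family famK ⊎ Family famL → InM (dual S')
    member (inj₁ f) = inj₂ (inj₂ (inj₂ (inj₁ (S' , family⇒J loc prT (tr f) , λ _ _ → refl))))
    member (inj₂ (inj₁ f)) = inj₂ (inj₂ (inj₂ (inj₂ (inj₂ (inj₁ (S' , family⇒K loc prT (tr f) , λ _ _ → refl))))))
    member (inj₂ (inj₂ f)) = inj₂ (inj₂ (inj₂ (inj₂ (inj₂ (inj₂ (inj₂ (S' , family⇒L loc prT (tr f) , λ _ _ → refl)))))))
  from-main : Main T a b → Goal
  from-main (direct c cyc fam) = let (k , T' , cyc' , loc , prT , iso , tr) = standardise av c cyc in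
    k , T' , Direct.member c cyc cyc' loc prT (λ {l} → tr {l}) fam , iso
  from-main (dualed c cyc fam) = let (k , S' , cyc' , loc , prT , (φ , iso) , tr) = standardise (dual-avoids av) c cyc in
    -- An isomorphism from the dual of T onto `S'` is also one from T onto the dual of `S'`.
    k , dual S' , Dualed.member c cyc cyc' loc prT (λ {l} → tr {l}) fam , φ , λ x y → iso y x

theorem1p6 : (∀ {n} (T : Tournament n) → InClassT T →
    Σ ℕ λ k → Σ (Tournament (3 + k)) λ T' → InM T' × Isomorphic T T')
    × (∀ {k} (T : Tournament (3 + k)) → InM T → InClassT T)
    × (∀ {k} (T : Tournament (3 + k)) → InM T → ∀ (x : Fin (3 + k)) →
    ((¬ InW5 T x) ⇔ (x ≡ v0 ⊎ x ≡ v1)) × (NonCritical T x ⇔ (x ≡ v0 ⊎ x ≡ v1)))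
theorem1p6 = class⇒member , (λ T h → proj₁ (member-facts T h)) , (λ T h → proj₂ (member-facts T h))
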